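{- The class of $(\overline{2P_1+P_2},\,P_2+P_3)$-free graphs has bounded clique-width.
   Context: All graphs are finite, simple and undirected. For graphs $H_1,\dots,H_p$, a graph $G$ is $(H_1,\dots,H_p)$-free if no induced subgraph of $G$ is isomorphic to any $H_i$. $P_r$ denotes the path on $r$ vertices; $G+H$ is the disjoint union of $G$ and $H$, and $rG$ is the disjoint union of $r$ copies of $G$; $\overline{G}$ is the complement of $G$. Thus $\overline{2P_1+P_2}$ is the diamond ($K_4$ minus an edge). The clique-width of a graph $G$ is the minimum number of labels needed to construct $G$ using the operations: (1) create a single vertex with label $i$; (2) take the disjoint union of two labelled graphs; (3) add all edges between vertices with label $i$ and vertices with label $j$ ($i\ne j$); (4) rename label $i$ to $j$. A class of graphs has bounded clique-width if there is a constant $c$ such that every graph in the class has clique-width at most $c$. -}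

module Defs where

open import Data.Nat using (ℕ; zero; suc; _+_; _<_)
open import Data.Fin using (Fin; toℕ; splitAt; _≟_)
open import Data.Sum using (_⊎_; inj₁; inj₂; [_,_])
open import Data.Bool using (Bool; true; false; not; _∧_; _∨_; if_then_else_)
open import Data.Bool.Properties using (∨-comm)
open import Data.Product using (Σ; ∃; _×_; _,_)
open import Relation.Nullary using (¬_; yes; no)
open import Relation.Nullary.Decidable using (⌊_⌋)
open import Relation.Binary.PropositionalEquality using (_≡_; refl; sym; cong; cong₂)
open import Function.Definitions using (Injective; Bijective)

record Graph : Set where
  field
    n      : ℕ
    adj    : Fin n → Fin n → Bool
    adj-sym    : ∀ i j → adj i j ≡ adj j i
    adj-irrefl : ∀ i → adj i i ≡ false
open Graph public

_==_ : ∀ {m} → Fin m → Fin m → Bool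
i == j = ⌊ i ≟ j ⌋

==-sym : ∀ {m} (i j : Fin m) → (i == j) ≡ (j == i)
==-sym i j with i ≟ j | j ≟ i
... | yes _ | yes _ = refl
... | no _  | no _  = refl
... | yes p | no q  = Data.Empty.⊥-elim (q (sym p)) where import Data.Empty
... | no p  | yes q = Data.Empty.⊥-elim (p (sym q)) where import Data.Empty

==-refl : ∀ {m} (i : Fin m) → (i == i) ≡ true
==-refl i with i ≟ i
... | yes _ = refl
... | no p  = Data.Empty.⊥-elim (p refl) where import Data.Empty

InducedSubgraph : Graph → Graph → Set
InducedSubgraph H G =
  Σ (Fin (n H) → Fin (n G)) λ f →
    Injective _≡_ _≡_ f × (∀ i j → adj G (f i) (f j) ≡ adj H i j)

Free : Graph → Graph → Set
Free H G = ¬ InducedSubgraph H G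

P : ℕ → Graph
P r = record
  { n = r
  ; adj = λ i j → ⌊ suc (toℕ i) Data.Nat.≟ toℕ j ⌋ ∨ ⌊ suc (toℕ j) Data.Nat.≟ toℕ i ⌋
  ; adj-sym = λ i j → ∨-comm ⌊ suc (toℕ i) Data.Nat.≟ toℕ j ⌋ ⌊ suc (toℕ j) Data.Nat.≟ toℕ i ⌋
  ; adj-irrefl = irr
  }
  where
  import Data.Nat
  import Data.Nat.Properties as NP
  irr : ∀ (i : Fin r) → (⌊ suc (toℕ i) Data.Nat.≟ toℕ i ⌋ ∨ ⌊ suc (toℕ i) Data.Nat.≟ toℕ i ⌋) ≡ false
  irr i with suc (toℕ i) Data.Nat.≟ toℕ i
  ... | yes p = Data.Empty.⊥-elim (NP.1+n≢n p) where import Data.Empty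
  ... | no _  = refl

_+ᴳ_ : Graph → Graph → Graph
G +ᴳ H = record
  { n = n G + n H
  ; adj = a
  ; adj-sym = s
  ; adj-irrefl = irr
  }
  where
  a' : Fin (n G) ⊎ Fin (n H) → Fin (n G) ⊎ Fin (n H) → Bool
  a' (inj₁ x) (inj₁ y) = adj G x y
  a' (inj₂ x) (inj₂ y) = adj H x y
  a' (inj₁ _) (inj₂ _) = false
  a' (inj₂ _) (inj₁ _) = false
  a : Fin (n G + n H) → Fin (n G + n H) → Bool
  a i j = a' (splitAt (n G) i) (splitAt (n G) j)
  s' : ∀ x y → a' x y ≡ a' y x
  s' (inj₁ x) (inj₁ y) = adj-sym G x y
  s' (inj₂ x) (inj₂ y) = adj-sym H x y
  s' (inj₁ _) (inj₂ _) = refl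
  s' (inj₂ _) (inj₁ _) = refl
  s : ∀ i j → a i j ≡ a j i
  s i j = s' (splitAt (n G) i) (splitAt (n G) j)
  irr' : ∀ x → a' x x ≡ false
  irr' (inj₁ x) = adj-irrefl G x
  irr' (inj₂ x) = adj-irrefl H x
  irr : ∀ i → a i i ≡ false
  irr i = irr' (splitAt (n G) i)

complement : Graph → Graph
complement G = record
  { n = n G
  ; adj = λ i j → not (i == j) ∧ not (adj G i j)
  ; adj-sym = λ i j → cong₂ (λ u v → not u ∧ not v) (==-sym i j) (adj-sym G i j)
  ; adj-irrefl = λ i → cong (λ u → not u ∧ not (adj G i i)) (==-refl i)
  }

diamond : Graph
diamond = complement ((P 1 +ᴳ P 1) +ᴳ P 2)

P₂+P₃ : Graph
P₂+P₃ = P 2 +ᴳ P 3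

data Expr (k : ℕ) : Set where
  vtx : Fin k → Expr k
  _⊕_ : Expr k → Expr k → Expr k
  η   : (i j : Fin k) → ¬ i ≡ j → Expr k → Expr k
  ρ   : (i j : Fin k) → Expr k → Expr k

size : ∀ {k} → Expr k → ℕ
size (vtx _)     = 1
size (e ⊕ f)     = size e + size f
size (η _ _ _ e) = size e
size (ρ _ _ e)   = size e

label : ∀ {k} (e : Expr k) → Fin (size e) → Fin k
label (vtx i)     _ = i
label (e ⊕ f)     x = [ label e , label f ] (splitAt (size e) x)
label (η _ _ _ e) x = label e x
label (ρ i j e)   x = if label e x == i then j else label e x

eadj : ∀ {k} (e : Expr k) → Fin (size e) → Fin (size e) → Bool
eadj (vtx _) _ _ = false
eadj (e ⊕ f) x y = go (splitAt (size e) x) (splitAt (size e) y)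
  where
  go : Fin (size e) ⊎ Fin (size f) → Fin (size e) ⊎ Fin (size f) → Bool
  go (inj₁ a) (inj₁ b) = eadj e a b
  go (inj₂ a) (inj₂ b) = eadj f a b
  go _ _ = false
eadj (η i j _ e) x y =
  eadj e x y ∨ ((label e x == i ∧ label e y == j) ∨ (label e x == j ∧ label e y == i))
eadj (ρ _ _ e) x y = eadj e x y

CwAtMost : ℕ → Graph → Set
CwAtMost k G =
  Σ (Expr k) λ e → Σ (Fin (size e) → Fin (n G)) λ f →
    Bijective _≡_ _≡_ f × (∀ x y → adj G (f x) (f y) ≡ eadj e x y)

-- A vertex set is built by repeatedly splitting it in two so that the adjacency across the split depends only
-- on the outcomes of a bounded list of tests; this costs a bounded number of labels, and deleting boundedly many
-- vertices only adds tests.  So it suffices to split every induced subgraph, or to find it of bounded size.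
--
-- If G has a K₅, let K be the maximal clique containing it: every other vertex has at most one neighbour in K,
-- and G − K is a disjoint union of cliques.  Otherwise suppose that a bounded set H is such that any two further
-- vertices u, v avoid an edge of H, share a neighbour in H, or have nonadjacent private neighbours in H.
-- Complementing the adjacency of the pairs of the third sort turns G into a graph F of bounded degree, and after
-- the deletion of boundedly many vertices, P₂+P₃-freeness leaves F with components of bounded size.  This applies
-- with H = K₄; for K₄-free G with H an induced C₅, with H a triangle with a private neighbour at each vertex,
-- and with H a triangle together with an edge anticomplete to it.  In all remaining cases G is, up to boundedly
-- many vertices and splits along triangles, a bipartite P₂+P₃-free graph.  There, two vertices on one side of
-- different degrees have nested neighbourhoods, which gives a split unless all degrees agree, and then the
-- graph splits like a matching or the bipartite complement of one.

module Submission where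

open import Defs hiding (P)
open import Data.Bool as Bool using (Bool; true; false; if_then_else_; _∧_; _∨_; not; _xor_)
import Data.Bool.Properties as Boolₚ
open import Data.Bool.Properties using (∨-identityʳ; ∨-zeroʳ; ∨-comm; ∧-comm)
open import Data.Empty using (⊥; ⊥-elim)
open import Data.Unit using (tt)
open import Data.Fin as Fin using (Fin; zero; suc; splitAt; _↑ˡ_; _↑ʳ_; _≟_; toℕ; combine; inject≤; fromℕ<)
import Data.Fin.Properties as Finₚ
open import Data.List as List using (List; []; _∷_; length; map; _++_; allFin; cartesianProduct; filter)
open import Data.List.Membership.Propositional using (_∈_; _∉_; find; lose)
open import Data.List.Membership.Propositional.Properties
  using (∈-allFin; ∈-filter⁺; ∈-filter⁻; ∈-cartesianProduct⁺; ∈-map⁺; ∈-++⁺ˡ; ∈-++⁺ʳ; ∈-tabulate⁺; ∈-tabulate⁻)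
import Data.List.Membership.DecPropositional as DecMembership
import Data.List.Properties as Listₚ
open import Data.List.Relation.Unary.All as All using (All; []; _∷_)
import Data.List.Relation.Unary.All.Properties as Allₚ
open import Data.List.Relation.Unary.Any as Any using (Any; here; there)
open import Data.List.Relation.Unary.Any.Properties using (lookup-index)
open import Data.Nat as ℕ using (ℕ; zero; suc; _+_; _*_; _^_; _≤_; _<_; z≤n; s≤s)
open import Data.Nat.Induction using (<-wellFounded)
import Data.Nat.Properties as ℕₚ
open import Data.Product using (Σ; ∃; _×_; _,_; proj₁; proj₂)
open import Data.Sum using (_⊎_; inj₁; inj₂; [_,_])
open import Data.Vec as Vec using (Vec; []; _∷_; lookup)
open import Data.Vec.Properties using (lookup∘tabulate)
open import Data.Vec.Membership.Propositional.Properties using (∈-lookup)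
open import Data.Vec.Relation.Unary.All as VecAll using ([]; _∷_)
open import Data.Vec.Relation.Unary.AllPairs as AllPairs using (AllPairs; []; _∷_; allPairs?)
open import Function using (_∘_; id)
open import Induction.WellFounded using (Acc; acc)
open import Relation.Binary using (tri<; tri≈; tri>)
open import Relation.Binary.PropositionalEquality hiding ([_])
open import Relation.Nullary using (¬_; Dec; yes; no; does)
open import Relation.Nullary.Decidable using (⌊_⌋; _×-dec_; _⊎-dec_; _→-dec_; ¬?; decidable-stable; toWitness; toSum)
open import Relation.Unary using (Decidable)

-- Counting and finite search

-- The tests are fixed once for the whole graph, and every nonempty vertex set has to be small or
-- split by them. So labels do not accumulate along the recursion: a label records test outcomes,
-- and a join only needs a second copy of the label set to keep its two sides apart. Sets are
-- nonempty throughout because no expression denotes the empty graph. The obstacle without K₅ is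
-- density: two classes of vertices with the same neighbourhood in H may be joined almost
-- completely, and complementing such pairs gives F. The F-neighbours of a vertex in one class form
-- a clique of G, which bounds the degrees of F. An edge type of F is then either met by boundedly
-- many vertices, which are deleted, or it has an edge far from any three given vertices, and that
-- edge sees them exactly as the complemented pattern prescribes. With such far copies an induced P₃
-- of F yields a diamond or a P₂+P₃ in G, unless G is K₄-free and the three vertices form a
-- triangle. Distinct triangles then share no edge, so every remaining component of F is the closed
-- neighbourhood of one of its vertices.

count : ∀ {n} {P : Fin n → Set} → Decidable P → ℕ
count {zero}  P? = 0
count {suc n} P? = (if does (P? zero) then 1 else 0) + count (P? ∘ suc)

count-mono : ∀ {n} {P Q : Fin n → Set} (P? : Decidable P) (Q? : Decidable Q) →
             (∀ v → P v → Q v) → count P? ≤ count Q?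
count-mono {zero}  P? Q? P⊆Q = z≤n
count-mono {suc n} P? Q? P⊆Q with P? zero | Q? zero
... | yes p | yes q = s≤s (count-mono (P? ∘ suc) (Q? ∘ suc) (P⊆Q ∘ suc))
... | yes p | no ¬q = ⊥-elim (¬q (P⊆Q zero p))
... | no ¬p | yes q = ℕₚ.m≤n⇒m≤1+n (count-mono (P? ∘ suc) (Q? ∘ suc) (P⊆Q ∘ suc))
... | no ¬p | no ¬q = count-mono (P? ∘ suc) (Q? ∘ suc) (P⊆Q ∘ suc)

count-strict : ∀ {n} {P Q : Fin n → Set} (P? : Decidable P) (Q? : Decidable Q) →
               (∀ v → P v → Q v) → ∀ w → Q w → ¬ P w → count P? < count Q?
count-strict {suc n} P? Q? P⊆Q zero q ¬p with P? zero | Q? zero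
... | yes p | _     = ⊥-elim (¬p p)
... | no _  | no ¬q = ⊥-elim (¬q q)
... | no _  | yes _ = s≤s (count-mono (P? ∘ suc) (Q? ∘ suc) (P⊆Q ∘ suc))
count-strict {suc n} P? Q? P⊆Q (suc w) q ¬p with P? zero | Q? zero
... | yes p | yes _ = s≤s (count-strict (P? ∘ suc) (Q? ∘ suc) (P⊆Q ∘ suc) w q ¬p)
... | yes p | no ¬q = ⊥-elim (¬q (P⊆Q zero p))
... | no _  | yes _ = ℕₚ.m≤n⇒m≤1+n (count-strict (P? ∘ suc) (Q? ∘ suc) (P⊆Q ∘ suc) w q ¬p)
... | no _  | no _  = count-strict (P? ∘ suc) (Q? ∘ suc) (P⊆Q ∘ suc) w q ¬p

count-remove : ∀ {n} {P : Fin n → Set} (P? : Decidable P) w → P w →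
               count P? ≤ suc (count (λ v → P? v ×-dec ¬? (v ≟ w)))
count-remove {suc n} P? zero p with P? zero
... | yes _ = s≤s (count-mono (P? ∘ suc) (λ v → P? (suc v) ×-dec ¬? (suc v ≟ zero)) (λ v p → p , λ ()))
... | no ¬p = ⊥-elim (¬p p)
count-remove {suc n} P? (suc w) p with P? zero
... | yes _ = s≤s (ℕₚ.≤-trans (count-remove (P? ∘ suc) w p) (s≤s
                (count-mono (λ v → P? (suc v) ×-dec ¬? (v ≟ w)) (λ v → P? (suc v) ×-dec ¬? (suc v ≟ suc w))
                  (λ v (p , q) → p , q ∘ Finₚ.suc-injective))))
... | no ¬p = ℕₚ.≤-trans (count-remove (P? ∘ suc) w p) (s≤s
                (count-mono (λ v → P? (suc v) ×-dec ¬? (v ≟ w)) (λ v → P? (suc v) ×-dec ¬? (suc v ≟ suc w))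
                  (λ v (p , q) → p , q ∘ Finₚ.suc-injective)))

-- Removing the only element that `P` may have outside `Q` leaves a proper subset of `Q`, as it
-- lacks `w`.
count-exchange : ∀ {n} {P Q : Fin n → Set} (P? : Decidable P) (Q? : Decidable Q) →
                 (∀ u v → P u → ¬ Q u → P v → ¬ Q v → u ≡ v) →
                 ∀ w → Q w → ¬ P w → count P? ≤ count Q?
count-exchange {P = P} {Q} P? Q? uniq w q ¬p with Finₚ.any? (λ v → P? v ×-dec ¬? (Q? v))
... | yes (v , pv , ¬qv) = ℕₚ.≤-trans (count-remove P? v pv)
        (count-strict (λ u → P? u ×-dec ¬? (u ≟ v)) Q? sub w q (¬p ∘ proj₁))
  where
  sub : ∀ u → P u × ¬ u ≡ v → Q u
  sub u (pu , u≢v) with Q? u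
  ... | yes qu = qu
  ... | no ¬qu = ⊥-elim (u≢v (uniq u v pu ¬qu pv ¬qv))
... | no none = count-mono P? Q? sub
  where
  sub : ∀ u → P u → Q u
  sub u pu with Q? u
  ... | yes qu = qu
  ... | no ¬qu = ⊥-elim (none (u , pu , ¬qu))

⌊⌋-true : ∀ {P : Set} (P? : Dec P) → P → ⌊ P? ⌋ ≡ true
⌊⌋-true (yes _) _ = refl
⌊⌋-true (no ¬p) p = ⊥-elim (¬p p)

⌊⌋-false : ∀ {P : Set} (P? : Dec P) → ¬ P → ⌊ P? ⌋ ≡ false
⌊⌋-false (yes p) ¬p = ⊥-elim (¬p p)
⌊⌋-false (no _)  _  = refl

==-≢ : ∀ {m} {i j : Fin m} → i ≢ j → (i == j) ≡ false
==-≢ {i = i} {j} i≢j = ⌊⌋-false (i ≟ j) i≢j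

-- Clique-width expressions for the subgraph induced by a vertex set

-- `A` need not be the adjacency of the given graph: inside `rep-join` it is the graph without the
-- edges across the split. The labelling `ℓ` is prescribed on all vertices so that separately built
-- parts fit together.
record Rep {N k : ℕ} (S : Fin N → Set) (A : Fin N → Fin N → Bool) (ℓ : Fin N → Fin k) : Set where
  field
    expr       : Expr k
    vert       : Fin (size expr) → Fin N
    vert-inj   : ∀ {x y} → vert x ≡ vert y → x ≡ y
    vert-in    : ∀ x → S (vert x)
    vert-onto  : ∀ {v} → S v → ∃ λ x → vert x ≡ v
    vert-adj   : ∀ x y → A (vert x) (vert y) ≡ eadj expr x y
    vert-label : ∀ x → label expr x ≡ ℓ (vert x)
open Rep

module _ {N k : ℕ} where

  rep-vtx : ∀ {S : Fin N → Set} {A} {ℓ : Fin N → Fin k} v → S v → (∀ {u} → S u → u ≡ v) →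
            A v v ≡ false → Rep S A ℓ
  rep-vtx {ℓ = ℓ} v Sv only irr = record
    { expr = vtx (ℓ v)
    ; vert = λ _ → v
    ; vert-inj = λ { {zero} {zero} _ → refl }
    ; vert-in = λ _ → Sv
    ; vert-onto = λ Su → zero , sym (only Su)
    ; vert-adj = λ _ _ → irr
    ; vert-label = λ _ → refl
    }

  rep-cong : ∀ {S S′ : Fin N → Set} {A A′} {ℓ ℓ′ : Fin N → Fin k} →
             (∀ {v} → S v → S′ v) → (∀ {v} → S′ v → S v) →
             (∀ {u v} → S u → S v → A′ u v ≡ A u v) → (∀ {v} → S v → ℓ v ≡ ℓ′ v) →
             Rep S A ℓ → Rep S′ A′ ℓ′
  rep-cong to from A≡ ℓ≡ r = record
    { expr = expr r
    ; vert = vert r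
    ; vert-inj = vert-inj r
    ; vert-in = λ x → to (vert-in r x)
    ; vert-onto = λ Sv → vert-onto r (from Sv)
    ; vert-adj = λ x y → trans (A≡ (vert-in r x) (vert-in r y)) (vert-adj r x y)
    ; vert-label = λ x → trans (vert-label r x) (ℓ≡ (vert-in r x))
    }

  rep-η : ∀ {S : Fin N → Set} {A} {ℓ : Fin N → Fin k} (i j : Fin k) → ¬ i ≡ j → Rep S A ℓ →
          Rep S (λ u v → A u v ∨ ((ℓ u == i ∧ ℓ v == j) ∨ (ℓ u == j ∧ ℓ v == i))) ℓ
  rep-η i j i≢j r = record
    { expr = η i j i≢j (expr r)
    ; vert = vert r
    ; vert-inj = vert-inj r
    ; vert-in = vert-in r
    ; vert-onto = vert-onto r
    ; vert-adj = λ x y → cong₂ _∨_ (vert-adj r x y)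
        (cong₂ (λ a b → (a == i ∧ b == j) ∨ (a == j ∧ b == i)) (sym (vert-label r x)) (sym (vert-label r y)))
    ; vert-label = vert-label r
    }

  rep-ρ : ∀ {S : Fin N → Set} {A} {ℓ : Fin N → Fin k} (i j : Fin k) → Rep S A ℓ →
          Rep S A (λ v → if ℓ v == i then j else ℓ v)
  rep-ρ i j r = record
    { expr = ρ i j (expr r)
    ; vert = vert r
    ; vert-inj = vert-inj r
    ; vert-in = vert-in r
    ; vert-onto = vert-onto r
    ; vert-adj = vert-adj r
    ; vert-label = λ x → cong (λ a → if a == i then j else a) (vert-label r x)
    }

  rep-⊕ : ∀ {S₁ S₂ : Fin N → Set} {A} {ℓ : Fin N → Fin k} →
          (∀ {v} → S₁ v → S₂ v → ⊥) →
          (∀ {u v} → S₁ u → S₂ v → A u v ≡ false) → (∀ {u v} → S₂ u → S₁ v → A u v ≡ false) →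
          Rep S₁ A ℓ → Rep S₂ A ℓ → Rep (λ v → S₁ v ⊎ S₂ v) A ℓ
  rep-⊕ {S₁} {S₂} {A} {ℓ} disj A₁₂ A₂₁ r s = record
    { expr = expr r ⊕ expr s
    ; vert = v′
    ; vert-inj = λ {x} {y} eq → inj x y eq
    ; vert-in = in′
    ; vert-onto = onto
    ; vert-adj = adj′
    ; vert-label = lab
    }
    where
    m₁ = size (expr r)
    m₂ = size (expr s)
    v′ : Fin (m₁ + m₂) → Fin N
    v′ x = [ vert r , vert s ] (splitAt m₁ x)
    in′ : ∀ x → S₁ (v′ x) ⊎ S₂ (v′ x)
    in′ x with splitAt m₁ x
    ... | inj₁ a = inj₁ (vert-in r a)
    ... | inj₂ b = inj₂ (vert-in s b)
    inj′ : ∀ p q → [ vert r , vert s ] p ≡ [ vert r , vert s ] q → p ≡ q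
    inj′ (inj₁ a) (inj₁ b) eq = cong inj₁ (vert-inj r eq)
    inj′ (inj₂ a) (inj₂ b) eq = cong inj₂ (vert-inj s eq)
    inj′ (inj₁ a) (inj₂ b) eq = ⊥-elim (disj (vert-in r a) (subst S₂ (sym eq) (vert-in s b)))
    inj′ (inj₂ a) (inj₁ b) eq = ⊥-elim (disj (vert-in r b) (subst S₂ eq (vert-in s a)))
    inj : ∀ x y → v′ x ≡ v′ y → x ≡ y
    inj x y eq = trans (sym (Finₚ.join-splitAt m₁ m₂ x))
      (trans (cong (Fin.join m₁ m₂) (inj′ (splitAt m₁ x) (splitAt m₁ y) eq)) (Finₚ.join-splitAt m₁ m₂ y))
    onto : ∀ {v} → S₁ v ⊎ S₂ v → ∃ λ x → v′ x ≡ v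
    onto (inj₁ p) with vert-onto r p
    ... | a , refl = a ↑ˡ m₂ , cong [ vert r , vert s ] (Finₚ.splitAt-↑ˡ m₁ a m₂)
    onto (inj₂ p) with vert-onto s p
    ... | b , refl = m₁ ↑ʳ b , cong [ vert r , vert s ] (Finₚ.splitAt-↑ʳ m₁ m₂ b)
    adj′ : ∀ x y → A (v′ x) (v′ y) ≡ eadj (expr r ⊕ expr s) x y
    adj′ x y with splitAt m₁ x | splitAt m₁ y
    ... | inj₁ a | inj₁ b = vert-adj r a b
    ... | inj₂ a | inj₂ b = vert-adj s a b
    ... | inj₁ a | inj₂ b = A₁₂ (vert-in r a) (vert-in s b)
    ... | inj₂ a | inj₁ b = A₂₁ (vert-in s a) (vert-in r b)
    lab : ∀ x → label (expr r ⊕ expr s) x ≡ ℓ (v′ x)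
    lab x with splitAt m₁ x
    ... | inj₁ a = vert-label r a
    ... | inj₂ b = vert-label s b

  module Rename {m : ℕ} (src tgt : Fin m → Fin k) where

    renames : List (Fin m) → Fin k → Fin k
    renames []       l = l
    renames (i ∷ is) l = if renames is l == src i then tgt i else renames is l

    rep-renames : ∀ {S : Fin N → Set} {A ℓ} is → Rep S A ℓ → Rep S A (renames is ∘ ℓ)
    rep-renames []       r = r
    rep-renames (i ∷ is) r = rep-ρ (src i) (tgt i) (rep-renames is r)

    renames-miss : ∀ is {l} → (∀ i → l ≢ src i) → renames is l ≡ l
    renames-miss []       l≢ = refl
    renames-miss (i ∷ is) l≢ rewrite renames-miss is l≢ | ==-≢ (l≢ i) = refl

    module _ (src-inj : ∀ {i j} → src i ≡ src j → i ≡ j) (tgt≢src : ∀ i j → tgt i ≢ src j) where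

      -- No renaming reads a label that another one has written, so a source label changes at most
      -- once, in whatever order the renamings come.
      renames-either : ∀ is i → renames is (src i) ≡ src i ⊎ renames is (src i) ≡ tgt i
      renames-either []       i = inj₁ refl
      renames-either (j ∷ is) i with renames is (src i) ≟ src j | renames-either is i
      ... | no _  | e       = e
      ... | yes p | inj₂ q  = ⊥-elim (tgt≢src i j (trans (sym q) p))
      ... | yes p | inj₁ q  = inj₂ (cong tgt (src-inj (trans (sym p) q)))

      renames-hit : ∀ {is i} → i ∈ is → renames is (src i) ≡ tgt i
      renames-hit {j ∷ is} {i} (there i∈) rewrite renames-hit i∈ | ==-≢ (tgt≢src i j) = refl
      renames-hit {j ∷ is} (here refl) with renames is (src j) ≟ src j | renames-either is j
      ... | yes _ | _      = refl
      ... | no ¬p | inj₁ q = ⊥-elim (¬p q)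
      ... | no _  | inj₂ q = q

  module Join {m : ℕ} (src tgt : Fin m → Fin k) (src≢tgt : ∀ i j → src i ≢ tgt j) (ℓ : Fin N → Fin k) where

    joins : List (Fin m × Fin m) → (Fin N → Fin N → Bool) → Fin N → Fin N → Bool
    joins []             A u v = A u v
    joins ((i , j) ∷ ps) A u v =
      joins ps A u v ∨ ((ℓ u == src i ∧ ℓ v == tgt j) ∨ (ℓ u == tgt j ∧ ℓ v == src i))

    rep-joins : ∀ {S : Fin N → Set} {A} ps → Rep S A ℓ → Rep S (joins ps A) ℓ
    rep-joins []             r = r
    rep-joins ((i , j) ∷ ps) r = rep-η (src i) (tgt j) (src≢tgt i j) (rep-joins ps r)

    joins-hit : ∀ {ps A i j u v} → (i , j) ∈ ps → ℓ u ≡ src i → ℓ v ≡ tgt j → joins ps A u v ≡ true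
    joins-hit {(i , j) ∷ ps} {A} {u = u} {v} (here refl) p q
      rewrite p | q | ==-refl (src i) | ==-refl (tgt j) = ∨-zeroʳ _
    joins-hit {_ ∷ ps} {A} (there ∈ps) p q = cong (_∨ _) (joins-hit {ps} {A} ∈ps p q)

    joins-miss : ∀ {ps A u v} →
                 (∀ {i j} → (i , j) ∈ ps → ℓ u ≡ src i → ℓ v ≡ tgt j → ⊥) →
                 (∀ {i j} → (i , j) ∈ ps → ℓ u ≡ tgt j → ℓ v ≡ src i → ⊥) →
                 joins ps A u v ≡ A u v
    joins-miss {[]} f g = refl
    joins-miss {(i , j) ∷ ps} {A} {u} {v} f g
      rewrite joins-miss {ps} {A} {u} {v} (f ∘ there) (g ∘ there)
      with ℓ u ≟ src i | ℓ v ≟ tgt j | ℓ u ≟ tgt j | ℓ v ≟ src i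
    ... | yes p | yes q | _     | _     = ⊥-elim (f (here refl) p q)
    ... | _     | _     | yes p | yes q = ⊥-elim (g (here refl) p q)
    ... | no _  | _     | no _  | _     = ∨-identityʳ _
    ... | no _  | _     | yes _ | no _  = ∨-identityʳ _
    ... | yes _ | no _  | no _  | _     = ∨-identityʳ _
    ... | yes _ | no _  | yes _ | no _  = ∨-identityʳ _

    joins-sym : ∀ {ps A} → (∀ u v → A u v ≡ A v u) → ∀ u v → joins ps A u v ≡ joins ps A v u
    joins-sym {[]} s u v = s u v
    joins-sym {(i , j) ∷ ps} s u v = cong₂ _∨_ (joins-sym {ps} s u v)
      (trans (∨-comm (ℓ u == src i ∧ ℓ v == tgt j) _)
        (cong₂ _∨_ (∧-comm (ℓ u == tgt j) _) (∧-comm (ℓ u == src i) _)))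

module _ {N K : ℕ} where

  -- The `old` copy carries the current labelling; the `new` copy keeps the second side of a join
  -- apart while edges are added.
  old new : Fin K → Fin (K + K)
  old = _↑ˡ K
  new = K ↑ʳ_

  old-inj : ∀ {i j} → old i ≡ old j → i ≡ j
  old-inj {i} {j} = Finₚ.↑ˡ-injective K i j

  new-inj : ∀ {i j} → new i ≡ new j → i ≡ j
  new-inj {i} {j} = Finₚ.↑ʳ-injective K i j

  old≢new : ∀ i j → old i ≢ new j
  old≢new i j eq with trans (sym (Finₚ.splitAt-↑ˡ K i K)) (trans (cong (splitAt K) eq) (Finₚ.splitAt-↑ʳ K K j))
  ... | ()

  rep-new : ∀ {S : Fin N → Set} {A ℓ} (g : Fin K → Fin K) → Rep S A (old ∘ ℓ) → Rep S A (new ∘ g ∘ ℓ)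
  rep-new {ℓ = ℓ} g r = rep-cong id id (λ _ _ → refl)
    (λ {v} _ → renames-hit old-inj (λ i j eq → old≢new j (g i) (sym eq)) (∈-allFin (ℓ v)))
    (rep-renames (allFin K) r)
    where open Rename old (new ∘ g)

  module ToOld = Rename {N} new old

  -- Renamings inside one copy could chain, for instance when `g` exchanges two labels; the detour
  -- through the `new` copy applies `g` simultaneously.
  rep-relabel : ∀ {S : Fin N → Set} {A ℓ} (g : Fin K → Fin K) → Rep S A (old ∘ ℓ) → Rep S A (old ∘ g ∘ ℓ)
  rep-relabel {ℓ = ℓ} g r = rep-cong id id (λ _ _ → refl)
    (λ {v} _ → ToOld.renames-hit new-inj old≢new (∈-allFin (g (ℓ v))))
    (ToOld.rep-renames (allFin K) (rep-new g r))

  module _ (A : Fin N → Fin N → Bool) (A-sym : ∀ u v → A u v ≡ A v u) (ℓ : Fin N → Fin K)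
           (S P : Fin N → Set) (P? : Decidable P)
           (φ : Fin K → Fin K → Bool)
           (cross : ∀ {u w} → S u → P u → S w → ¬ P w → A u w ≡ φ (ℓ u) (ℓ w)) where

    private
      B : Fin N → Fin N → Bool
      B u v with P? u | P? v
      ... | yes _ | yes _ = A u v
      ... | no _  | no _  = A u v
      ... | yes _ | no _  = false
      ... | no _  | yes _ = false

      λ′ : Fin N → Fin (K + K)
      λ′ v = if ⌊ P? v ⌋ then old (ℓ v) else new (ℓ v)

      B-in : ∀ {u v} → P u → P v → B u v ≡ A u v
      B-in {u} {v} p q with P? u | P? v
      ... | yes _ | yes _ = refl
      ... | no ¬p | _     = ⊥-elim (¬p p)
      ... | _     | no ¬q = ⊥-elim (¬q q)

      B-out : ∀ {u v} → ¬ P u → ¬ P v → B u v ≡ A u v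
      B-out {u} {v} ¬p ¬q with P? u | P? v
      ... | no _  | no _  = refl
      ... | yes p | _     = ⊥-elim (¬p p)
      ... | _     | yes q = ⊥-elim (¬q q)

      B-cross : ∀ {u v} → P u → ¬ P v → B u v ≡ false
      B-cross {u} {v} p ¬q with P? u | P? v
      ... | yes _ | no _  = refl
      ... | no ¬p | _     = ⊥-elim (¬p p)
      ... | _     | yes q = ⊥-elim (¬q q)

      B-cross′ : ∀ {u v} → ¬ P u → P v → B u v ≡ false
      B-cross′ {u} {v} ¬p q with P? u | P? v
      ... | no _  | yes _ = refl
      ... | yes p | _     = ⊥-elim (¬p p)
      ... | _     | no ¬q = ⊥-elim (¬q q)

      λ-old : ∀ {v} → P v → λ′ v ≡ old (ℓ v)
      λ-old {v} p = cong (if_then old (ℓ v) else new (ℓ v)) (⌊⌋-true (P? v) p)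

      λ-new : ∀ {v} → ¬ P v → λ′ v ≡ new (ℓ v)
      λ-new {v} ¬p = cong (if_then old (ℓ v) else new (ℓ v)) (⌊⌋-false (P? v) ¬p)

      open Join {N} old new old≢new λ′

      ok? : Decidable (λ (p : Fin K × Fin K) → φ (proj₁ p) (proj₂ p) ≡ true)
      ok? (i , j) = φ i j Boolₚ.≟ true

      ps : List (Fin K × Fin K)
      ps = filter ok? (cartesianProduct (allFin K) (allFin K))

      joined : ∀ {u w} → S u → P u → S w → ¬ P w → joins ps B u w ≡ A u w
      joined {u} {w} su pu sw pw with φ (ℓ u) (ℓ w) in eq
      ... | true  = trans
        (joins-hit {ps} (∈-filter⁺ ok? (∈-cartesianProduct⁺ (∈-allFin (ℓ u)) (∈-allFin (ℓ w))) eq) (λ-old pu) (λ-new pw))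
        (sym (trans (cross su pu sw pw) eq))
      ... | false = trans
        (joins-miss {ps} miss (λ _ p q → old≢new _ _ (trans (sym (λ-old pu)) p)))
        (trans (B-cross pu pw) (sym (trans (cross su pu sw pw) eq)))
        where
        miss : ∀ {i j} → (i , j) ∈ ps → λ′ u ≡ old i → λ′ w ≡ new j → ⊥
        miss {i} {j} ∈ps p q with proj₂ (∈-filter⁻ ok? {xs = cartesianProduct (allFin K) (allFin K)} ∈ps)
        ... | φij rewrite old-inj (trans (sym (λ-old pu)) p) | new-inj (trans (sym (λ-new pw)) q)
          with trans (sym eq) φij
        ... | ()

      B-sym : ∀ u v → B u v ≡ B v u
      B-sym u v with P? u | P? v
      ... | yes _ | yes _ = A-sym u v
      ... | no _  | no _  = A-sym u v
      ... | yes _ | no _  = refl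
      ... | no _  | yes _ = refl

      all-joined : ∀ {u w} → S u → S w → A u w ≡ joins ps B u w
      all-joined {u} {w} su sw with P? u | P? w
      ... | yes p | no ¬q = sym (joined su p sw ¬q)
      ... | no ¬p | yes q = trans (A-sym u w) (trans (sym (joined sw q su ¬p)) (joins-sym {ps} B-sym w u))
      ... | yes p | yes q = sym (trans
              (joins-miss {ps} (λ _ _ b → old≢new _ _ (trans (sym (λ-old q)) b))
                               (λ _ a _ → old≢new _ _ (trans (sym (λ-old p)) a)))
              (B-in p q))
      ... | no ¬p | no ¬q = sym (trans
              (joins-miss {ps} (λ _ a _ → old≢new _ _ (sym (trans (sym (λ-new ¬p)) a)))
                               (λ _ _ b → old≢new _ _ (sym (trans (sym (λ-new ¬q)) b))))
              (B-out ¬p ¬q))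

    -- The part outside `P` moves to the `new` labels, so joining `old i` to `new j` whenever
    -- `φ i j` holds adds exactly the edges across the split. Afterwards the `new` labels are
    -- renamed back.
    rep-join : Rep (λ v → S v × P v) A (old ∘ ℓ) → Rep (λ v → S v × ¬ P v) A (old ∘ ℓ) → Rep S A (old ∘ ℓ)
    rep-join r s = rep-cong id id (λ _ _ → refl) back
      (ToOld.rep-renames (allFin K)
        (rep-cong
          (λ { (inj₁ (s , _)) → s ; (inj₂ (s , _)) → s })
          (λ {v} sv → [ (λ p → inj₁ (sv , p)) , (λ ¬p → inj₂ (sv , ¬p)) ] (dec v))
          (λ u w → all-joined (un u) (un w)) (λ _ → refl)
          (rep-joins ps (rep-⊕ (λ (_ , p) (_ , ¬p) → ¬p p)
            (λ (_ , p) (_ , q) → B-cross p q) (λ (_ , p) (_ , q) → B-cross′ p q)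
            (rep-cong id id (λ (_ , p) (_ , q) → B-in p q) (λ (_ , p) → sym (λ-old p)) r)
            (rep-cong id id (λ (_ , p) (_ , q) → B-out p q) (λ (_ , p) → sym (λ-new p)) (rep-new id s))))))
      where
      dec : ∀ v → P v ⊎ ¬ P v
      dec v with P? v
      ... | yes p = inj₁ p
      ... | no ¬p = inj₂ ¬p
      un : ∀ {v} → (S v × P v) ⊎ (S v × ¬ P v) → S v
      un (inj₁ (s , _)) = s
      un (inj₂ (s , _)) = s
      back : ∀ {v} → S v → ToOld.renames (allFin K) (λ′ v) ≡ old (ℓ v)
      back {v} _ with P? v
      ... | yes _ = ToOld.renames-miss (allFin K) (old≢new (ℓ v))
      ... | no _  = ToOld.renames-hit new-inj old≢new (∈-allFin (ℓ v))

-- The relation is a parameter: it is agreement on tests in the graph arguments and equality of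
-- labels in the construction of expressions.
record HomSplit {N : ℕ} (A : Fin N → Fin N → Bool) (_≈_ : Fin N → Fin N → Set) (S : Fin N → Set) : Set₁ where
  field
    P   : Fin N → Set
    P?  : Decidable P
    in₁ : ∃ λ v → S v × P v
    in₂ : ∃ λ v → S v × ¬ P v
    hom : ∀ {u u′ w w′} → S u → P u → S u′ → P u′ → S w → ¬ P w → S w′ → ¬ P w′ →
          u ≈ u′ → w ≈ w′ → A u w ≡ A u′ w′

module _ {N K : ℕ} (A : Fin N → Fin N → Bool) (A-sym : ∀ u v → A u v ≡ A v u) (ℓ : Fin N → Fin K) where

  private
    _≈_ : Fin N → Fin N → Set
    u ≈ v = ℓ u ≡ ℓ v

  rep-split : ∀ {S : Fin N → Set} (S? : Decidable S) (h : HomSplit A _≈_ S) → let open HomSplit h in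
              Rep (λ v → S v × P v) A (old {N} ∘ ℓ) → Rep (λ v → S v × ¬ P v) A (old {N} ∘ ℓ) →
              Rep S A (old {N} ∘ ℓ)
  rep-split {S} S? h = rep-join A A-sym ℓ S P P? φ cross
    where
    open HomSplit h
    W : Fin K → Fin K → Fin N → Fin N → Set
    W i j u w = (S u × P u × ℓ u ≡ i) × (S w × ¬ P w × ℓ w ≡ j) × A u w ≡ true
    W? : ∀ i j → Dec (∃ λ u → ∃ λ w → W i j u w)
    W? i j = Finₚ.any? λ u → Finₚ.any? λ w →
      (S? u ×-dec P? u ×-dec (ℓ u ≟ i)) ×-dec (S? w ×-dec ¬? (P? w) ×-dec (ℓ w ≟ j)) ×-dec (A u w Boolₚ.≟ true)
    -- By `hom`, one adjacent pair across the split with labels `i` and `j` forces all such pairs to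
    -- be adjacent.
    φ : Fin K → Fin K → Bool
    φ i j = ⌊ W? i j ⌋
    cross : ∀ {u w} → S u → P u → S w → ¬ P w → A u w ≡ φ (ℓ u) (ℓ w)
    cross {u} {w} su pu sw pw with W? (ℓ u) (ℓ w)
    ... | yes (u′ , w′ , (su′ , pu′ , ℓu) , (sw′ , pw′ , ℓw) , Auw) =
      trans (hom su pu su′ pu′ sw pw sw′ pw′ (sym ℓu) (sym ℓw)) Auw
    ... | no none with A u w in eq
    ...   | true  = ⊥-elim (none (u , w , (su , pu , refl) , (sw , pw , refl) , eq))
    ...   | false = refl

  build-by-splits :
    ∀ {S : Fin N → Set} (S? : Decidable S) → ∃ S →
    (∀ {S′ : Fin N → Set} (S′? : Decidable S′) → ∃ S′ → (∀ {v} → S′ v → S v) →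
       Rep S′ A (old {N} ∘ ℓ) ⊎ HomSplit A _≈_ S′) →
    Rep S A (old {N} ∘ ℓ)
  build-by-splits S? ne step = go S? ne step (<-wellFounded _)
    where
    go : ∀ {S : Fin N → Set} (S? : Decidable S) → ∃ S →
         (∀ {S′ : Fin N → Set} (S′? : Decidable S′) → ∃ S′ → (∀ {v} → S′ v → S v) →
            Rep S′ A (old {N} ∘ ℓ) ⊎ HomSplit A _≈_ S′) →
         Acc _<_ (count S?) → Rep S A (old {N} ∘ ℓ)
    go {S} S? ne step (acc rs) with step S? ne id
    ... | inj₁ r = r
    ... | inj₂ h = rep-split S? h
            (go (λ v → S? v ×-dec P? v) in₁ (λ S′? ne′ sub → step S′? ne′ (proj₁ ∘ sub))
              (rs (count-strict _ S? (λ _ → proj₁) (proj₁ in₂) (proj₁ (proj₂ in₂)) λ p → proj₂ (proj₂ in₂) (proj₂ p))))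
            (go (λ v → S? v ×-dec ¬? (P? v)) in₂ (λ S′? ne′ sub → step S′? ne′ (proj₁ ∘ sub))
              (rs (count-strict _ S? (λ _ → proj₁) (proj₁ in₁) (proj₁ (proj₂ in₁)) λ p → proj₂ p (proj₂ (proj₂ in₁)))))
      where open HomSplit h

  -- With distinct labels every split is homogeneous, in particular that into one vertex and the
  -- rest.
  rep-injective : (∀ v → A v v ≡ false) → ∀ {S : Fin N → Set} (S? : Decidable S) → ∃ S →
                  (∀ {u v} → S u → S v → ℓ u ≡ ℓ v → u ≡ v) → Rep S A (old {N} ∘ ℓ)
  rep-injective irr {S} S? ne inj = build-by-splits S? ne step
    where
    step : ∀ {S′ : Fin N → Set} (S′? : Decidable S′) → ∃ S′ → (∀ {v} → S′ v → S v) →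
           Rep S′ A (old {N} ∘ ℓ) ⊎ HomSplit A _≈_ S′
    step S′? (v , s) sub with Finₚ.any? (λ w → S′? w ×-dec ¬? (w ≟ v))
    ... | yes other = inj₂ record
      { P = _≡ v ; P? = _≟ v ; in₁ = v , s , refl ; in₂ = other
      ; hom = λ su _ su′ _ sw _ sw′ _ p q → cong₂ A (inj (sub su) (sub su′) p) (inj (sub sw) (sub sw′) q) }
    ... | no none = inj₁ (rep-vtx v s (λ {u} su → only u su) (irr v))
      where
      only : ∀ u → _ → u ≡ v
      only u su with u ≟ v
      ... | yes p = p
      ... | no ¬p = ⊥-elim (none (u , su , ¬p))

-- Splitting by Boolean tests

Agree : ∀ {N} → List (Fin N → Bool) → Fin N → Fin N → Set
Agree T u v = All (λ t → t u ≡ t v) T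

bit : Bool → Fin 2
bit b = if b then suc zero else zero

bit-injective : ∀ {a b} → bit a ≡ bit b → a ≡ b
bit-injective {true}  {true}  _ = refl
bit-injective {false} {false} _ = refl

code : ∀ {N} (T : List (Fin N → Bool)) → Fin N → Fin (2 ^ length T)
code []      v = zero
code (t ∷ T) v = combine (bit (t v)) (code T v)

code-agree : ∀ {N} (T : List (Fin N → Bool)) {u v} → code T u ≡ code T v → Agree T u v
code-agree []      eq = []
code-agree (t ∷ T) {u} {v} eq with Finₚ.combine-injective (bit (t u)) (code T u) (bit (t v)) (code T v) eq
... | p , q = bit-injective p ∷ code-agree T q

agree-code : ∀ {N} (T : List (Fin N → Bool)) {u v} → Agree T u v → code T u ≡ code T v
agree-code []      []      = refl
agree-code (t ∷ T) (p ∷ q) = cong₂ combine (cong bit p) (agree-code T q)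

Small : ∀ {N} → ℕ → (Fin N → Set) → Set
Small {N} s S = Σ (Fin N → Fin s) λ p → ∀ {u v} → S u → S v → p u ≡ p v → u ≡ v

Good : (G : Graph) → ℕ → List (Fin (n G) → Bool) → (Fin (n G) → Set) → Set₁
Good G s T S = Small s S ⊎ HomSplit (adj G) (Agree T) S

Decomposable : (G : Graph) → ℕ → ℕ → Set₁
Decomposable G m s =
  Σ (List (Fin (n G) → Bool)) λ T → length T ≤ m ×
    (∀ {S : Fin (n G) → Set} (S? : Decidable S) → ∃ S → Good G s T S)

-- `2 ^ m` labels record the test outcomes and `s` further ones distinguish the vertices of a small
-- set while it is built; the joins double both.
decomposable⇒cw : ∀ {m s} (G : Graph) → 0 < n G → Decomposable G m s →
                  CwAtMost ((2 ^ m + s) + (2 ^ m + s)) G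
decomposable⇒cw {m} {s} G 0<n (T , T≤m , good) =
  Rep.expr r , Rep.vert r , (Rep.vert-inj r , onto) , Rep.vert-adj r
  where
  K = 2 ^ m + s
  ℓ : Fin (n G) → Fin K
  ℓ v = inject≤ (code T v) (ℕₚ.^-monoʳ-≤ 2 T≤m) ↑ˡ s
  ℓ-agree : ∀ {u v} → ℓ u ≡ ℓ v → Agree T u v
  ℓ-agree eq = code-agree T (Finₚ.inject≤-injective _ _ _ _ (Finₚ.↑ˡ-injective s _ _ eq))
  small : ∀ {S : Fin (n G) → Set} (S? : Decidable S) → ∃ S → Small s S → Rep S (adj G) (old {n G} ∘ ℓ)
  small {S} S? ne (p , p-inj) =
    rep-cong id id (λ _ _ → refl) (λ {v} sv → cong (old {n G}) (g-ok sv))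
      (rep-relabel g (rep-injective (adj G) (adj-sym G) ℓ′ (adj-irrefl G) S? ne
        (λ su sv eq → p-inj su sv (Finₚ.↑ʳ-injective (2 ^ m) _ _ eq))))
    where
    ℓ′ : Fin (n G) → Fin K
    ℓ′ v = 2 ^ m ↑ʳ p v
    -- Since `p` is injective on `S`, an auxiliary label determines its vertex and can be exchanged
    -- for the code of that vertex.
    g : Fin K → Fin K
    g l with Finₚ.any? (λ v → S? v ×-dec (ℓ′ v ≟ l))
    ... | yes (v , _) = ℓ v
    ... | no _        = l
    g-ok : ∀ {v} → S v → g (ℓ′ v) ≡ ℓ v
    g-ok {v} sv with Finₚ.any? (λ u → S? u ×-dec (ℓ′ u ≟ ℓ′ v))
    ... | yes (u , su , eq) = cong ℓ (p-inj su sv (Finₚ.↑ʳ-injective (2 ^ m) _ _ eq))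
    ... | no none           = ⊥-elim (none (v , sv , refl))
  All⊤ : Fin (n G) → Set
  All⊤ v = v ≡ v
  step : ∀ {S : Fin (n G) → Set} (S? : Decidable S) → ∃ S → Good G s T S →
         Rep S (adj G) (old {n G} ∘ ℓ) ⊎ HomSplit (adj G) (λ u v → ℓ u ≡ ℓ v) S
  step S? ne (inj₁ sm) = inj₁ (small S? ne sm)
  step S? ne (inj₂ h)  = inj₂ record
    { P = P ; P? = P? ; in₁ = in₁ ; in₂ = in₂
    ; hom = λ a b c d e f g h p q → hom a b c d e f g h (ℓ-agree p) (ℓ-agree q) }
    where open HomSplit h
  r : Rep All⊤ (adj G) (old {n G} ∘ ℓ)
  r = build-by-splits (adj G) (adj-sym G) ℓ (λ v → yes refl) (fromℕ< 0<n , refl) λ S? ne _ → step S? ne (good S? ne)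
  onto : ∀ y → ∃ λ x → ∀ {z} → z ≡ x → Rep.vert r z ≡ y
  onto y with Rep.vert-onto r {y} refl
  ... | x , eq = x , λ { refl → eq }

-- Adjacency and the two forbidden induced subgraphs

module Adjacency (G : Graph) where

  V : Set
  V = Fin (n G)

  _~_ _≁_ : V → V → Set
  u ~ v = adj G u v ≡ true
  u ≁ v = adj G u v ≡ false

  _~?_ : ∀ u v → Dec (u ~ v)
  u ~? v = adj G u v Boolₚ.≟ true

  _≁?_ : ∀ u v → Dec (u ≁ v)
  u ≁? v = adj G u v Boolₚ.≟ false

  adjacent? : ∀ u v → u ~ v ⊎ u ≁ v
  adjacent? u v with adj G u v
  ... | true  = inj₁ refl
  ... | false = inj₂ refl

  ¬~⇒≁ : ∀ {u v} → ¬ u ~ v → u ≁ v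
  ¬~⇒≁ {u} {v} ¬p with adjacent? u v
  ... | inj₁ p = ⊥-elim (¬p p)
  ... | inj₂ q = q

  ~-≁ : ∀ {u v} → u ~ v → u ≁ v → ⊥
  ~-≁ p q with trans (sym p) q
  ... | ()

  ~-sym : ∀ {u v} → u ~ v → v ~ u
  ~-sym {u} {v} p = trans (adj-sym G v u) p

  ≁-sym : ∀ {u v} → u ≁ v → v ≁ u
  ≁-sym {u} {v} p = trans (adj-sym G v u) p

  ≁-refl : ∀ {u} → u ≁ u
  ≁-refl {u} = adj-irrefl G u

  ~⇒≢ : ∀ {u v} → u ~ v → u ≢ v
  ~⇒≢ p refl = ~-≁ p ≁-refl

  ≁-~⇒≢ : ∀ {u v w} → u ≁ w → v ~ w → u ≢ v
  ≁-~⇒≢ p q refl = ~-≁ q p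

  induced : (H : Graph) (f : Fin (n H) → V) →
            (∀ i j → toℕ i < toℕ j → f i ≢ f j × adj G (f i) (f j) ≡ adj H i j) → InducedSubgraph H G
  induced H f h = f , inj , pres
    where
    inj : ∀ {i j} → f i ≡ f j → i ≡ j
    inj {i} {j} eq with ℕₚ.<-cmp (toℕ i) (toℕ j)
    ... | tri< lt _ _ = ⊥-elim (proj₁ (h i j lt) eq)
    ... | tri≈ _ e _  = Finₚ.toℕ-injective e
    ... | tri> _ _ gt = ⊥-elim (proj₁ (h j i gt) (sym eq))
    pres : ∀ i j → adj G (f i) (f j) ≡ adj H i j
    pres i j with ℕₚ.<-cmp (toℕ i) (toℕ j)
    ... | tri< lt _ _ = proj₂ (h i j lt)
    ... | tri> _ _ gt = trans (adj-sym G (f i) (f j)) (trans (proj₂ (h j i gt)) (adj-sym H j i))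
    ... | tri≈ _ e _ with Finₚ.toℕ-injective e
    ...   | refl = trans (adj-irrefl G (f i)) (sym (adj-irrefl H i))

module Forbidden (G : Graph) (no-diamond : Free diamond G) (no-P₂+P₃ : Free P₂+P₃ G) where

  open Adjacency G public

  -- Otherwise the four vertices induce a diamond with `z w` as its missing edge. Diamond-freeness
  -- enters the proof only in this form.
  apex-unique : ∀ {x y z w} → x ~ y → z ~ x → z ~ y → w ~ x → w ~ y → z ≁ w → z ≡ w
  apex-unique {x} {y} {z} {w} xy zx zy wx wy z≁w with z ≟ w
  ... | yes p   = p
  ... | no z≢w = ⊥-elim (no-diamond (induced diamond f h))
    where
    f : Fin 4 → V
    f = lookup (x ∷ y ∷ z ∷ w ∷ [])
    h : ∀ i j → toℕ i < toℕ j → f i ≢ f j × adj G (f i) (f j) ≡ adj diamond i j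
    h zero (suc zero) _ = ~⇒≢ xy , xy
    h zero (suc (suc zero)) _ = ~⇒≢ (~-sym zx) , ~-sym zx
    h zero (suc (suc (suc zero))) _ = ~⇒≢ (~-sym wx) , ~-sym wx
    h (suc zero) (suc (suc zero)) _ = ~⇒≢ (~-sym zy) , ~-sym zy
    h (suc zero) (suc (suc (suc zero))) _ = ~⇒≢ (~-sym wy) , ~-sym wy
    h (suc (suc zero)) (suc (suc (suc zero))) _ = z≢w , z≁w
    h _ zero ()
    h (suc _) (suc zero) (s≤s ())
    h (suc (suc _)) (suc (suc zero)) (s≤s (s≤s ()))
    h (suc (suc (suc _))) (suc (suc (suc zero))) (s≤s (s≤s (s≤s ())))

  P₂+P₃-free : ∀ {p q a b c} → p ~ q → a ~ b → b ~ c → a ≢ c → a ≁ c →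
               p ≁ a → p ≁ b → p ≁ c → q ≁ a → q ≁ b → q ≁ c → ⊥
  P₂+P₃-free {p} {q} {a} {b} {c} pq ab bc a≢c ac pa pb pc qa qb qc = no-P₂+P₃ (induced P₂+P₃ f h)
    where
    f : Fin 5 → V
    f = lookup (p ∷ q ∷ a ∷ b ∷ c ∷ [])
    h : ∀ i j → toℕ i < toℕ j → f i ≢ f j × adj G (f i) (f j) ≡ adj P₂+P₃ i j
    h zero (suc zero) _ = ~⇒≢ pq , pq
    h zero (suc (suc zero)) _ = ≁-~⇒≢ pb ab , pa
    h zero (suc (suc (suc zero))) _ = ≁-~⇒≢ pc bc , pb
    h zero (suc (suc (suc (suc zero)))) _ = ≁-~⇒≢ pb (~-sym bc) , pc
    h (suc zero) (suc (suc zero)) _ = ≁-~⇒≢ qb ab , qa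
    h (suc zero) (suc (suc (suc zero))) _ = ≁-~⇒≢ qc bc , qb
    h (suc zero) (suc (suc (suc (suc zero)))) _ = ≁-~⇒≢ qb (~-sym bc) , qc
    h (suc (suc zero)) (suc (suc (suc zero))) _ = ~⇒≢ ab , ab
    h (suc (suc zero)) (suc (suc (suc (suc zero)))) _ = a≢c , ac
    h (suc (suc (suc zero))) (suc (suc (suc (suc zero)))) _ = ~⇒≢ bc , bc
    h _ zero ()
    h (suc _) (suc zero) (s≤s ())
    h (suc (suc _)) (suc (suc zero)) (s≤s (s≤s ()))
    h (suc (suc (suc _))) (suc (suc (suc zero))) (s≤s (s≤s (s≤s ())))
    h (suc (suc (suc (suc _)))) (suc (suc (suc (suc zero)))) (s≤s (s≤s (s≤s (s≤s ()))))

  P₃-closed : (V → Set) → Set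
  P₃-closed S = ∀ {a b c} → S a → S b → S c → a ~ b → b ~ c → a ≢ c → a ~ c

  -- Two vertices of an edge that is anticomplete to S turn a P₃ in S into a P₂+P₃.
  anticomplete⇒P₃-closed : ∀ {p q} {S : V → Set} → p ~ q → (∀ {v} → S v → p ≁ v × q ≁ v) → P₃-closed S
  anticomplete⇒P₃-closed pq anti {a} {b} {c} sa sb sc ab bc a≢c with adjacent? a c
  ... | inj₁ ac = ac
  ... | inj₂ ac = ⊥-elim (P₂+P₃-free pq ab bc a≢c ac
          (proj₁ (anti sa)) (proj₁ (anti sb)) (proj₁ (anti sc))
          (proj₂ (anti sa)) (proj₂ (anti sb)) (proj₂ (anti sc)))

module Decomposition (G : Graph) where

  open Adjacency G

  module _ {s : ℕ} {T : List (V → Bool)} {S : V → Set} where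

    split : (φ : V → V → Bool) →
            (∀ {u u′ w w′} → Agree T u u′ → Agree T w w′ → φ u w ≡ φ u′ w′) →
            {P : V → Set} → Decidable P → (∃ λ v → S v × P v) → (∃ λ v → S v × ¬ P v) →
            (∀ {u w} → S u → P u → S w → ¬ P w → adj G u w ≡ φ u w) → Good G s T S
    split φ φ-resp P? in₁ in₂ adj≡φ = inj₂ record
      { P? = P? ; in₁ = in₁ ; in₂ = in₂
      ; hom = λ su pu su′ pu′ sw pw sw′ pw′ uu′ ww′ →
          trans (adj≡φ su pu sw pw) (trans (φ-resp uu′ ww′) (sym (adj≡φ su′ pu′ sw′ pw′))) }

    -- If `S` has no vertex besides `v` it is small. Otherwise `v` is split off, and the tests only
    -- have to decide its adjacency to the rest.
    single : Decidable S → (φ : V → Bool) → (∀ {w w′} → Agree T w w′ → φ w ≡ φ w′) →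
             ∀ v → S v → (∀ {w} → S w → w ≢ v → adj G v w ≡ φ w) → Good G (suc s) T S
    single S? φ φ-resp v sv adj≡φ with Finₚ.any? (λ w → S? w ×-dec ¬? (w ≟ v))
    ... | yes other = inj₂ record
      { P = _≡ v ; P? = _≟ v ; in₁ = v , sv , refl ; in₂ = other
      ; hom = λ { _ refl _ refl sw w≢v sw′ w′≢v _ ww′ →
          trans (adj≡φ sw w≢v) (trans (φ-resp ww′) (sym (adj≡φ sw′ w′≢v))) } }
    ... | no none = inj₁ ((λ _ → zero) , λ {u} {w} su sw _ → trans (only u su) (sym (only w sw)))
      where
      only : ∀ u → S u → u ≡ v
      only u su with u ≟ v
      ... | yes p = p
      ... | no ¬p = ⊥-elim (none (u , su , ¬p))

  -- The closed neighbourhood of `v` is its component. Either it is split off with no edges across,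
  -- or it is all of `S` and `v` is complete to the rest.
  P₃-closed⇒good : ∀ {s T} {S : V → Set} → Decidable S → ∃ S →
    (∀ {a b c} → S a → S b → S c → a ~ b → b ~ c → a ≢ c → a ~ c) → Good G (suc s) T S
  P₃-closed⇒good {S = S} S? (v , sv) tr with Finₚ.any? (λ w → S? w ×-dec ¬? ((w ≟ v) ⊎-dec (w ~? v)))
  ... | yes out = split (λ _ _ → false) (λ _ _ → refl) (λ w → (w ≟ v) ⊎-dec (w ~? v)) (v , sv , inj₁ refl) out cross
    where
    cross : ∀ {u w} → S u → u ≡ v ⊎ u ~ v → S w → ¬ (w ≡ v ⊎ w ~ v) → u ≁ w
    cross {u} {w} su pu sw pw with adjacent? u w
    ... | inj₂ q = q
    cross su (inj₁ refl) sw pw | inj₁ uw = ⊥-elim (pw (inj₂ (~-sym uw)))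
    cross {u} {w} su (inj₂ uv) sw pw | inj₁ uw =
      ⊥-elim (pw (inj₂ (tr sw su sv (~-sym uw) uv (pw ∘ inj₁))))
  ... | no none = single S? (λ _ → true) (λ _ → refl) v sv near
    where
    near : ∀ {w} → S w → w ≢ v → v ~ w
    near {w} sw w≢v with adjacent? v w
    ... | inj₁ p = p
    ... | inj₂ q = ⊥-elim (none (w , sw , λ { (inj₁ e) → w≢v e ; (inj₂ p) → ~-≁ (~-sym p) q }))

  agree-at : ∀ {T : List (V → Bool)} {t u v} → t ∈ T → Agree T u v → t u ≡ t v
  agree-at t∈T ag = All.lookup ag t∈T

  -- Adjacency to each deleted vertex becomes a test, so a deleted vertex that occurs in `S` can be
  -- split off at once.
  delete : ∀ {d m s} (D : List V) → length D ≤ d → (T : List (V → Bool)) → length T ≤ m →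
           (∀ {S : V → Set} → Decidable S → ∃ S → (∀ {v} → S v → v ∉ D) → Good G (suc s) T S) →
           Decomposable G (d + m) (suc s)
  delete {s = s} D D≤ T T≤ good = tests , bound , λ S? ne → go S? ne
    where
    tests : List (V → Bool)
    tests = map (adj G) D ++ T
    bound : length tests ≤ _
    bound = subst (_≤ _)
      (sym (trans (Listₚ.length-++ (map (adj G) D)) (cong (_+ length T) (Listₚ.length-map (adj G) D))))
      (ℕₚ.+-mono-≤ D≤ T≤)
    go : ∀ {S : V → Set} → Decidable S → ∃ S → Good G (suc s) tests S
    go {S} S? ne with Any.any? S? D
    ... | yes hit = let (d , d∈D , sd) = find hit in
          single S? (adj G d) (agree-at (∈-++⁺ˡ (∈-map⁺ (adj G) d∈D))) d sd (λ _ _ → refl)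
    ... | no miss with good S? ne (λ sv v∈D → miss (lose v∈D sv))
    ...   | inj₁ sm = inj₁ sm
    ...   | inj₂ h  = let open HomSplit h in inj₂ record
            { P? = P? ; in₁ = in₁ ; in₂ = in₂
            ; hom = λ a b c d e f g h p q → hom a b c d e f g h
                (Allₚ.++⁻ʳ (map (adj G) D) p) (Allₚ.++⁻ʳ (map (adj G) D) q) }

-- Bipartite graphs

module Bipartite (G : Graph) (no-diamond : Free diamond G) (no-P₂+P₃ : Free P₂+P₃ G) where

  open Forbidden G no-diamond no-P₂+P₃
  open Decomposition G

  module _ {s : ℕ} {T : List (V → Bool)} {S : V → Set} (S? : Decidable S)
           (side : V → Bool) (side∈T : side ∈ T)
           (indep : ∀ {u w} → S u → S w → side u ≡ side w → u ≁ w) where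

    private
      X Y : V → Set
      X v = S v × side v ≡ false
      Y v = S v × side v ≡ true

      X? : Decidable X
      X? v = S? v ×-dec (side v Boolₚ.≟ false)
      Y? : Decidable Y
      Y? v = S? v ×-dec (side v Boolₚ.≟ true)

      X-or-Y : ∀ {v} → S v → X v ⊎ Y v
      X-or-Y {v} sv with side v in eq
      ... | true  = inj₂ (sv , refl)
      ... | false = inj₁ (sv , refl)

      ¬X×Y : ∀ {v} → X v → Y v → ⊥
      ¬X×Y (_ , p) (_ , q) with trans (sym p) q
      ... | ()

      XX : ∀ {u w} → X u → X w → u ≁ w
      XX (su , p) (sw , q) = indep su sw (trans p (sym q))

      YY : ∀ {u w} → Y u → Y w → u ≁ w
      YY (su , p) (sw , q) = indep su sw (trans p (sym q))

      nbr-Y : ∀ {x w} → X x → S w → x ~ w → Y w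
      nbr-Y x sw xw with X-or-Y sw
      ... | inj₁ xw′ = ⊥-elim (~-≁ xw (XX x xw′))
      ... | inj₂ yw = yw

      nbr-X : ∀ {y w} → Y y → S w → y ~ w → X w
      nbr-X y sw yw with X-or-Y sw
      ... | inj₁ xw = xw
      ... | inj₂ yw′ = ⊥-elim (~-≁ yw (YY y yw′))

      agree-side : ∀ {u v} → Agree T u v → side u ≡ side v
      agree-side = agree-at side∈T

      -- Otherwise the path `y₁ x y₂` and the edge `x′ y′`, which is anticomplete to it, form a
      -- P₂+P₃.
      swap : ∀ {x x′ y₁ y₂ y′} → X x → X x′ → Y y₁ → Y y₂ → Y y′ →
             x ~ y₁ → x′ ≁ y₁ → x ~ y₂ → x′ ≁ y₂ → x′ ~ y′ → x ≁ y′ → y₁ ≡ y₂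
      swap {x} {x′} {y₁} {y₂} {y′} Xx Xx′ Yy₁ Yy₂ Yy′ xy₁ x′y₁ xy₂ x′y₂ x′y′ xy′ with y₁ ≟ y₂
      ... | yes p = p
      ... | no y₁≢y₂ = ⊥-elim (P₂+P₃-free x′y′ (~-sym xy₁) xy₂ y₁≢y₂ (YY Yy₁ Yy₂)
              x′y₁ (XX Xx′ Xx) x′y₂ (YY Yy′ Yy₁) (≁-sym xy′) (YY Yy′ Yy₂))

      N : V → V → Set
      N x y = Y y × x ~ y

      N? : ∀ x → Decidable (N x)
      N? x y = Y? y ×-dec (x ~? y)

      deg : V → ℕ
      deg x = count (N? x)

      ¬N : ∀ {x y} → Y y → ¬ N x y → x ≁ y
      ¬N Yy ¬n = ¬~⇒≁ (λ xy → ¬n (Yy , xy))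

      -- By `swap` at most one neighbour of `x` is missed by `x′`, and `y′` makes up for it.
      deg-≤ : ∀ {x x′ y′} → X x → X x′ → Y y′ → x′ ~ y′ → x ≁ y′ → deg x ≤ deg x′
      deg-≤ {x} {x′} {y′} Xx Xx′ Yy′ x′y′ xy′ = count-exchange (N? x) (N? x′)
        (λ u v (Yu , xu) ¬nu (Yv , xv) ¬nv →
           swap Xx Xx′ Yu Yv Yy′ xu (¬N Yu ¬nu) xv (¬N Yv ¬nv) x′y′ xy′)
        y′ (Yy′ , x′y′) (λ (_ , q) → ~-≁ q xy′)

      nested : ∀ {x x′} → X x → X x′ → deg x′ < deg x → ∀ {y} → Y y → x′ ~ y → x ~ y
      nested {x} Xx Xx′ lt {y} Yy x′y with adjacent? x y
      ... | inj₁ p = p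
      ... | inj₂ q = ⊥-elim (ℕₚ.<⇒≱ lt (deg-≤ Xx Xx′ Yy x′y q))

      via : ∀ (f : Bool → Bool → Bool) {u w a b} → side u ≡ a → side w ≡ b →
            adj G u w ≡ f a b → adj G u w ≡ f (side u) (side w)
      via f p q e = trans e (sym (cong₂ f p q))

      module Chain {x x′} (Xx : X x) (Xx′ : X x′) (lt : deg x′ < deg x) where

        -- The union of the neighbourhoods of the vertices of low degree. By `nested` the vertices
        -- of high degree are complete to it, while the rest of `Y` sees no vertex of low degree.
        U : V → Set
        U y = ∃ λ w → X w × deg w ≤ deg x′ × w ~ y

        U? : Decidable U
        U? y = Finₚ.any? λ w → X? w ×-dec (deg w ℕₚ.≤? deg x′) ×-dec (w ~? y)

        P : V → Set
        P v = (X v × deg x′ < deg v) ⊎ (Y v × ¬ U v)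

        P? : Decidable P
        P? v = (X? v ×-dec (deg x′ ℕₚ.<? deg v)) ⊎-dec (Y? v ×-dec ¬? (U? v))

        φ : V → V → Bool
        φ u w = not (side u) ∧ side w

        cross : ∀ {u w} → S u → P u → S w → ¬ P w → adj G u w ≡ φ u w
        cross {u} {w} su (inj₁ (Xu , hi)) sw ¬pw with X-or-Y sw
        ... | inj₁ Xw = via (λ a b → not a ∧ b) (proj₂ Xu) (proj₂ Xw) (XX Xu Xw)
        ... | inj₂ Yw with U? w
        ...   | yes (z , Xz , lo , zw) = via (λ a b → not a ∧ b) (proj₂ Xu) (proj₂ Yw)
                  (nested Xu Xz (ℕₚ.≤-<-trans lo hi) Yw zw)
        ...   | no ¬Uw = ⊥-elim (¬pw (inj₂ (Yw , ¬Uw)))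
        cross {u} {w} su (inj₂ (Yu , ¬Uu)) sw ¬pw with X-or-Y sw
        ... | inj₂ Yw = via (λ a b → not a ∧ b) (proj₂ Yu) (proj₂ Yw) (YY Yu Yw)
        ... | inj₁ Xw = via (λ a b → not a ∧ b) (proj₂ Yu) (proj₂ Xw) (¬~⇒≁ λ uw →
                ¬Uu (w , Xw , ℕₚ.≮⇒≥ (λ hi → ¬pw (inj₁ (Xw , hi))) , ~-sym uw))

        good : Good G (suc s) T S
        good = split φ (λ p q → cong₂ (λ a b → not a ∧ b) (agree-side p) (agree-side q)) P?
          (x , proj₁ Xx , inj₁ (Xx , lt))
          (x′ , proj₁ Xx′ , λ { (inj₁ (_ , l)) → ℕₚ.<-irrefl refl l ; (inj₂ (Yx′ , _)) → ¬X×Y Xx′ Yx′ })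
          cross

      module Regular
        (deg≮ : ∀ {x x′} → X x → X x′ → ¬ deg x′ < deg x)
        (nbr : ∀ {v} → S v → ∃ λ w → S w × v ~ w)
        (non-nbr : ∀ {v} → S v → ∃ λ w → S w × side w ≢ side v × v ≁ w) where

        -- Otherwise the neighbourhood of `x′` would lie properly inside that of `x`, against equal
        -- degrees.
        private-nbr : ∀ {x x′ y} → X x → X x′ → Y y → x ~ y → x′ ≁ y → ∃ λ y′ → Y y′ × x′ ~ y′ × x ≁ y′
        private-nbr {x} {x′} {y} Xx Xx′ Yy xy x′y
          with Finₚ.any? (λ y′ → Y? y′ ×-dec (x′ ~? y′) ×-dec (x ≁? y′))
        ... | yes p = p
        ... | no none = ⊥-elim (deg≮ Xx Xx′ (count-strict (N? x′) (N? x) sub y (Yy , xy) (λ (_ , q) → ~-≁ q x′y)))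
          where
          sub : ∀ v → N x′ v → N x v
          sub v (Yv , x′v) with adjacent? x v
          ... | inj₁ p = Yv , p
          ... | inj₂ q = ⊥-elim (none (v , Yv , x′v , q))

        one-private : ∀ {x x′ y₁ y₂} → X x → X x′ → Y y₁ → Y y₂ →
                      x ~ y₁ → x′ ≁ y₁ → x ~ y₂ → x′ ≁ y₂ → y₁ ≡ y₂
        one-private Xx Xx′ Yy₁ Yy₂ a b c d with private-nbr Xx Xx′ Yy₁ a b
        ... | y′ , Yy′ , e , f = swap Xx Xx′ Yy₁ Yy₂ Yy′ a b c d e f

        -- If x and x′ were twins, then so would be all of X by P₂+P₃-freeness,
        -- and a neighbour of x would be complete to X.
        no-twins : ∀ {x x′} → X x → X x′ → x ≢ x′ → ∃ λ y → Y y × x ~ y × x′ ≁ y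
        no-twins {x} {x′} Xx Xx′ x≢x′ with Finₚ.any? (λ y → Y? y ×-dec (x ~? y) ×-dec (x′ ≁? y))
        ... | yes p = p
        ... | no none with nbr (proj₁ Xx)
        ...   | y , sy , xy with nbr-Y Xx sy xy
        ...     | Yy with non-nbr sy
        ...       | x″ , sx″ , sd , yx″ = ⊥-elim (absurd X″ (private-nbr Xx X″ Yy xy (≁-sym yx″)))
          where
          X″ : X x″
          X″ with X-or-Y sx″
          ... | inj₁ p = p
          ... | inj₂ p = ⊥-elim (sd (trans (proj₂ p) (sym (proj₂ Yy))))
          twin : ∀ {y} → Y y → x ~ y → x′ ~ y
          twin {y} Yy xy with adjacent? x′ y
          ... | inj₁ p = p
          ... | inj₂ q = ⊥-elim (none (y , Yy , xy , q))
          absurd : X x″ → (∃ λ y″ → Y y″ × x″ ~ y″ × x ≁ y″) → ⊥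
          absurd X″ (y″ , Yy″ , x″y″ , xy″) with adjacent? x′ y″
          ... | inj₂ q = P₂+P₃-free x″y″ xy (~-sym (twin Yy xy)) x≢x′ (XX Xx Xx′)
                 (XX X″ Xx) (≁-sym yx″) (XX X″ Xx′) (≁-sym xy″) (YY Yy″ Yy) (≁-sym q)
          ... | inj₁ p with private-nbr Xx′ Xx Yy″ p xy″
          ...   | z , Yz , xz , x′z = none (z , Yz , xz , x′z)

        module _ {x₁ x₂} (X₁ : X x₁) (X₂ : X x₂) (x₁≢x₂ : x₁ ≢ x₂) where

          private
            a₁ = proj₁ (no-twins X₁ X₂ x₁≢x₂)
            Y₁ = proj₁ (proj₂ (no-twins X₁ X₂ x₁≢x₂))
            x₁a₁ = proj₁ (proj₂ (proj₂ (no-twins X₁ X₂ x₁≢x₂)))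
            x₂a₁ = proj₂ (proj₂ (proj₂ (no-twins X₁ X₂ x₁≢x₂)))
            a₂ = proj₁ (no-twins X₂ X₁ (x₁≢x₂ ∘ sym))
            Y₂ = proj₁ (proj₂ (no-twins X₂ X₁ (x₁≢x₂ ∘ sym)))
            x₂a₂ = proj₁ (proj₂ (proj₂ (no-twins X₂ X₁ (x₁≢x₂ ∘ sym))))
            x₁a₂ = proj₂ (proj₂ (proj₂ (no-twins X₂ X₁ (x₁≢x₂ ∘ sym))))

          -- N(x₁) = C + a₁ and N(x₂) = C + a₂.  A vertex x₃ missing c ∈ C has N(x₃) = C − c + a₁ + a₂, a vertex
          -- x₄ seeing some z ∉ C + a₁ + a₂ has N(x₄) = C + z, and x₃ has two private neighbours against x₄.
          not-both : ∀ {c z} → Y c → x₁ ~ c → x₂ ~ c → Y z → x₁ ≁ z → x₂ ≁ z → ⊥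
          not-both {c} {z} Yc x₁c x₂c Yz x₁z x₂z with non-nbr (proj₁ Yc) | nbr (proj₁ Yz)
          ... | x₃ , s₃ , sd₃ , cx₃ | x₄ , s₄ , zx₄ = a₁≢a₂ (one-private X₃ X₄ Y₁ Y₂ x₃a₁ x₄a₁ x₃a₂ x₄a₂)
            where
            X₃ : X x₃
            X₃ with X-or-Y s₃
            ... | inj₁ p = p
            ... | inj₂ p = ⊥-elim (sd₃ (trans (proj₂ p) (sym (proj₂ Yc))))
            X₄ : X x₄
            X₄ = nbr-X Yz s₄ zx₄
            a₁≢a₂ : a₁ ≢ a₂
            a₁≢a₂ eq = ~-≁ x₁a₁ (subst (x₁ ≁_) (sym eq) x₁a₂)
            x₄a₁ : x₄ ≁ a₁
            x₄a₁ = ¬~⇒≁ λ p → ~-≁ x₁a₁ (subst (x₁ ≁_) (sym (one-private X₄ X₂ Y₁ Yz p x₂a₁ (~-sym zx₄) x₂z)) x₁z)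
            x₄a₂ : x₄ ≁ a₂
            x₄a₂ = ¬~⇒≁ λ p → ~-≁ x₂a₂ (subst (x₂ ≁_) (sym (one-private X₄ X₁ Y₂ Yz p x₁a₂ (~-sym zx₄) x₁z)) x₂z)
            x₃a₁ : x₃ ~ a₁
            x₃a₁ with adjacent? x₃ a₁
            ... | inj₁ p = p
            ... | inj₂ q = ⊥-elim (~-≁ x₂c (subst (x₂ ≁_) (one-private X₁ X₃ Y₁ Yc x₁a₁ q x₁c (≁-sym cx₃)) x₂a₁))
            x₃a₂ : x₃ ~ a₂
            x₃a₂ with adjacent? x₃ a₂
            ... | inj₁ p = p
            ... | inj₂ q = ⊥-elim (~-≁ x₁c (subst (x₁ ≁_) (one-private X₂ X₃ Y₂ Yc x₂a₂ q x₂c (≁-sym cx₃)) x₁a₂))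

          -- Here `a₁` is the only neighbour of `x₁`. Another neighbour of `a₁` would leave `x₁`
          -- without the private neighbour that `no-twins` provides, so the edge `x₁ a₁` is a
          -- component.
          matching : (∀ {c} → Y c → x₁ ~ c → x₂ ~ c → ⊥) → Good G (suc s) T S
          matching no-common = split (λ _ _ → false) (λ _ _ → refl) (λ v → (v ≟ x₁) ⊎-dec (v ≟ a₁))
            (x₁ , proj₁ X₁ , inj₁ refl)
            (x₂ , proj₁ X₂ , λ { (inj₁ e) → x₁≢x₂ (sym e) ; (inj₂ e) → ¬X×Y X₂ (subst Y (sym e) Y₁) })
            cross
            where
            only-a₁ : ∀ {y} → Y y → x₁ ~ y → y ≡ a₁
            only-a₁ {y} Yy x₁y with adjacent? x₂ y
            ... | inj₁ p = ⊥-elim (no-common Yy x₁y p)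
            ... | inj₂ q = one-private X₁ X₂ Yy Y₁ x₁y q x₁a₁ x₂a₁
            cross : ∀ {u w} → S u → u ≡ x₁ ⊎ u ≡ a₁ → S w → ¬ (w ≡ x₁ ⊎ w ≡ a₁) → u ≁ w
            cross su (inj₁ refl) sw ¬pw = ¬~⇒≁ λ p → ¬pw (inj₂ (only-a₁ (nbr-Y X₁ sw p) p))
            cross su (inj₂ refl) sw ¬pw with X-or-Y sw
            ... | inj₂ Yw = YY Y₁ Yw
            ... | inj₁ Xw = ¬~⇒≁ λ a₁w → let (y , Yy , x₁y , wy) = no-twins X₁ Xw (¬pw ∘ inj₁ ∘ sym) in
                    ~-≁ (~-sym a₁w) (subst (_ ≁_) (only-a₁ Yy x₁y) wy)

          -- The bipartite complement of the matching: `a₂` is the only vertex of `Y` that `x₁`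
          -- misses, and by `no-twins` every other vertex of `X` sees `a₂`.
          co-matching : (∀ {z} → Y z → x₁ ≁ z → x₂ ≁ z → ⊥) → Good G (suc s) T S
          co-matching covered = split (λ u w → side u xor side w)
            (λ p q → cong₂ _xor_ (agree-side p) (agree-side q)) (λ v → (v ≟ x₁) ⊎-dec (v ≟ a₂))
            (x₁ , proj₁ X₁ , inj₁ refl)
            (x₂ , proj₁ X₂ , λ { (inj₁ e) → x₁≢x₂ (sym e) ; (inj₂ e) → ¬X×Y X₂ (subst Y (sym e) Y₂) })
            cross
            where
            only-a₂ : ∀ {y} → Y y → x₁ ≁ y → y ≡ a₂
            only-a₂ {y} Yy x₁y with adjacent? x₂ y
            ... | inj₁ p = one-private X₂ X₁ Yy Y₂ p x₁y x₂a₂ x₁a₂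
            ... | inj₂ q = ⊥-elim (covered Yy x₁y q)
            cross : ∀ {u w} → S u → u ≡ x₁ ⊎ u ≡ a₂ → S w → ¬ (w ≡ x₁ ⊎ w ≡ a₂) → adj G u w ≡ side u xor side w
            cross {w = w} su (inj₁ refl) sw ¬pw with X-or-Y sw
            ... | inj₁ Xw = via _xor_ (proj₂ X₁) (proj₂ Xw) (XX X₁ Xw)
            ... | inj₂ Yw with adjacent? x₁ w
            ...   | inj₁ p = via _xor_ (proj₂ X₁) (proj₂ Yw) p
            ...   | inj₂ q = ⊥-elim (¬pw (inj₂ (only-a₂ Yw q)))
            cross {w = w} su (inj₂ refl) sw ¬pw with X-or-Y sw
            ... | inj₂ Yw = via _xor_ (proj₂ Y₂) (proj₂ Yw) (YY Y₂ Yw)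
            ... | inj₁ Xw = via _xor_ (proj₂ Y₂) (proj₂ Xw)
                    (let (y , Yy , wy , x₁y) = no-twins Xw X₁ (¬pw ∘ inj₁) in
                     ~-sym (subst (w ~_) (only-a₂ Yy x₁y) wy))

          two-good : Good G (suc s) T S
          two-good with Finₚ.any? (λ c → Y? c ×-dec (x₁ ~? c) ×-dec (x₂ ~? c))
          ... | yes (c , Yc , p , q) = co-matching (not-both Yc p q)
          ... | no none = matching λ Yc p q → none (_ , Yc , p , q)

        good : ∃ X → Good G (suc s) T S
        good (x , Xx) with nbr (proj₁ Xx)
        ... | y , sy , xy with non-nbr sy
        ...   | x′ , sx′ , sd , yx′ with X-or-Y sx′
        ...     | inj₁ Xx′ = two-good Xx Xx′ λ { refl → ~-≁ xy (≁-sym yx′) }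
        ...     | inj₂ Yx′ = ⊥-elim (sd (trans (proj₂ Yx′) (sym (proj₂ (nbr-Y Xx sy xy)))))

      nbr? : ∀ v → Dec (∃ λ w → S w × v ~ w)
      nbr? v = Finₚ.any? λ w → S? w ×-dec (v ~? w)

      non-nbr? : ∀ v → Dec (∃ λ w → S w × side w ≢ side v × v ≁ w)
      non-nbr? v = Finₚ.any? λ w → S? w ×-dec ¬? (side w Boolₚ.≟ side v) ×-dec (v ≁? w)

      full : ∀ v → S v → ¬ (∃ λ w → S w × side w ≢ side v × v ≁ w) → Good G (suc s) T S
      full v sv none = single S? (λ w → side v xor side w) (λ p → cong (side v xor_) (agree-side p)) v sv
        λ {w} sw _ → adj≡ w sw
        where
        adj≡ : ∀ w → S w → adj G v w ≡ side v xor side w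
        adj≡ w sw with X-or-Y sv | X-or-Y sw
        ... | inj₁ Xv | inj₁ Xw = via _xor_ (proj₂ Xv) (proj₂ Xw) (XX Xv Xw)
        ... | inj₂ Yv | inj₂ Yw = via _xor_ (proj₂ Yv) (proj₂ Yw) (YY Yv Yw)
        ... | inj₁ Xv | inj₂ Yw with adjacent? v w
        ...   | inj₁ p = via _xor_ (proj₂ Xv) (proj₂ Yw) p
        ...   | inj₂ q = ⊥-elim (none (w , sw , (λ e → ¬X×Y (sw , trans e (proj₂ Xv)) Yw) , q))
        adj≡ w sw | inj₂ Yv | inj₁ Xw with adjacent? v w
        ...   | inj₁ p = via _xor_ (proj₂ Yv) (proj₂ Xw) p
        ...   | inj₂ q = ⊥-elim (none (w , sw , (λ e → ¬X×Y Xw (sw , trans e (proj₂ Yv))) , q))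

    -- Isolated vertices and vertices complete to the other side are split off first; this supplies
    -- the neighbours and non-neighbours on which the regular case relies.
    bipartite⇒good : ∃ S → Good G (suc s) T S
    bipartite⇒good (v , sv) with Finₚ.any? (λ v → S? v ×-dec ¬? (nbr? v))
    ... | yes (u , su , none) =
            single S? (λ _ → false) (λ _ → refl) u su λ sw _ → ¬~⇒≁ λ p → none (_ , sw , p)
    ... | no all-nbr with Finₚ.any? (λ v → S? v ×-dec ¬? (non-nbr? v))
    ...   | yes (u , su , none) = full u su none
    ...   | no all-non with Finₚ.any? (λ x → Finₚ.any? λ x′ → X? x ×-dec X? x′ ×-dec (deg x′ ℕₚ.<? deg x))
    ...     | yes (x , x′ , Xx , Xx′ , lt) = Chain.good Xx Xx′ lt
    ...     | no flat = Regular.good (λ Xx Xx′ lt → flat (_ , _ , Xx , Xx′ , lt)) nbr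
                (λ {v} sv → decidable-stable (non-nbr? v) λ none → all-non (v , sv , none))
                some-X
      where
      nbr : ∀ {v} → S v → ∃ λ w → S w × v ~ w
      nbr {v} sv = decidable-stable (nbr? v) λ none → all-nbr (v , sv , none)
      some-X : ∃ X
      some-X with X-or-Y sv
      ... | inj₁ Xv = v , Xv
      ... | inj₂ Yv = let (w , sw , p) = nbr sv in w , nbr-X Yv sw p

-- Bounded lists, cliques and traces on a vertex set

⌊⌋-cong : ∀ {P Q : Set} (P? : Dec P) (Q? : Dec Q) → (P → Q) → (Q → P) → ⌊ P? ⌋ ≡ ⌊ Q? ⌋
⌊⌋-cong (yes p) Q? to from = sym (⌊⌋-true Q? (to p))
⌊⌋-cong (no ¬p) Q? to from = sym (⌊⌋-false Q? (¬p ∘ from))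

-- Monotonicity of `R` allows the lists found for the single indices to be concatenated.
collect : ∀ {A : Set} {b} k (R : Fin k → List A → Set) →
          (∀ {i xs ys} → (∀ {a} → a ∈ xs → a ∈ ys) → R i xs → R i ys) →
          (∀ i → ∃ λ xs → length xs ≤ b × R i xs) →
          ∃ λ xs → length xs ≤ k * b × (∀ i → R i xs)
collect zero    R mono each = [] , z≤n , λ ()
collect (suc k) R mono each with each zero | collect k (R ∘ suc) mono (each ∘ suc)
... | xs , xs≤ , r | ys , ys≤ , rs =
  xs ++ ys , subst (_≤ _) (sym (Listₚ.length-++ xs)) (ℕₚ.+-mono-≤ xs≤ ys≤) , λ
    { zero → mono ∈-++⁺ˡ r ; (suc i) → mono (∈-++⁺ʳ xs) (rs i) }

list⇒small : ∀ {N s} (xs : List (Fin N)) → length xs ≤ suc s → {S : Fin N → Set} →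
             (∀ {v} → S v → v ∈ xs) → Small (suc s) S
list⇒small {N} {s} xs xs≤ {S} S⊆xs = p , inj
  where
  open DecMembership (_≟_ {N}) using (_∈?_)
  p : Fin N → Fin (suc s)
  p v with v ∈? xs
  ... | yes v∈ = inject≤ (Any.index v∈) xs≤
  ... | no _   = zero
  inj : ∀ {u v} → S u → S v → p u ≡ p v → u ≡ v
  inj {u} {v} su sv eq with u ∈? xs | v ∈? xs
  ... | no ∉  | _     = ⊥-elim (∉ (S⊆xs su))
  ... | _     | no ∉  = ⊥-elim (∉ (S⊆xs sv))
  ... | yes a | yes b = trans (lookup-index a)
          (trans (cong (List.lookup xs) (Finₚ.inject≤-injective xs≤ xs≤ _ _ eq)) (sym (lookup-index b)))

module Cliques (G : Graph) where

  open Adjacency G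

  K₄-free K₅-free : Set
  K₄-free = ∀ {a b c d} → a ~ b → a ~ c → a ~ d → b ~ c → b ~ d → c ~ d → ⊥
  K₅-free = ∀ {a b c d e} → a ~ b → a ~ c → a ~ d → a ~ e → b ~ c → b ~ d → b ~ e → c ~ d → c ~ e → d ~ e → ⊥

  clique-cover : K₅-free → {Q : V → Set} → Decidable Q → (∀ {u v} → Q u → Q v → u ≢ v → u ~ v) →
                 ∃ λ xs → length xs ≤ 4 × (∀ {v} → Q v → v ∈ xs)
  clique-cover no-K₅ {Q} Q? clique = go₀
    where
    open DecMembership (_≟_ {n G}) using (_∈?_)
    next : ∀ xs → (∃ λ v → Q v × v ∉ xs) ⊎ (∀ {v} → Q v → v ∈ xs)
    next xs with Finₚ.any? (λ v → Q? v ×-dec ¬? (v ∈? xs))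
    ... | yes p = inj₁ p
    ... | no ¬p = inj₂ λ {v} q → decidable-stable (v ∈? xs) λ v∉ → ¬p (v , q , v∉)
    adj′ : ∀ {u v xs} → Q u → Q v → v ∉ xs → u ∈ xs → u ~ v
    adj′ qu qv v∉ u∈ = clique qu qv λ { refl → v∉ u∈ }
    go₀ : ∃ λ xs → length xs ≤ 4 × (∀ {v} → Q v → v ∈ xs)
    go₀ with next []
    ... | inj₂ done = [] , z≤n , done
    ... | inj₁ (a , qa , _) with next (a ∷ [])
    ...  | inj₂ done = _ , s≤s z≤n , done
    ...  | inj₁ (b , qb , b∉) with next (a ∷ b ∷ [])
    ...   | inj₂ done = _ , s≤s (s≤s z≤n) , done
    ...   | inj₁ (c , qc , c∉) with next (a ∷ b ∷ c ∷ [])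
    ...    | inj₂ done = _ , s≤s (s≤s (s≤s z≤n)) , done
    ...    | inj₁ (d , qd , d∉) with next (a ∷ b ∷ c ∷ d ∷ [])
    ...     | inj₂ done = _ , s≤s (s≤s (s≤s (s≤s z≤n))) , done
    ...     | inj₁ (e , qe , e∉) = ⊥-elim (no-K₅
                (adj′ qa qb b∉ (here refl)) (adj′ qa qc c∉ (here refl)) (adj′ qa qd d∉ (here refl))
                (adj′ qa qe e∉ (here refl)) (adj′ qb qc c∉ (there (here refl)))
                (adj′ qb qd d∉ (there (here refl))) (adj′ qb qe e∉ (there (here refl)))
                (adj′ qc qd d∉ (there (there (here refl)))) (adj′ qc qe e∉ (there (there (here refl))))
                (adj′ qd qe e∉ (there (there (there (here refl))))))

  Opposed : List V → V → V → Set
  Opposed H u v = Any (λ h → Any (λ h′ → (u ~ h × v ≁ h) × (v ~ h′ × u ≁ h′) × h ≁ h′) H) H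

  -- In each of the three situations `star-clique` finds a forbidden induced subgraph.
  data Form (H : List V) (u v : V) : Set where
    avoided : ∀ {h h′} → h ∈ H → h′ ∈ H → h ~ h′ → u ≁ h → u ≁ h′ → v ≁ h → v ≁ h′ → Form H u v
    shared  : ∀ {h} → h ∈ H → u ~ h → v ~ h → Form H u v
    opposed : Opposed H u v → Form H u v

  opposed′ : ∀ {H u v h h′} → h ∈ H → h′ ∈ H → u ~ h → v ≁ h → v ~ h′ → u ≁ h′ → h ≁ h′ → Form H u v
  opposed′ h∈ h′∈ a b c d e = opposed (lose h∈ (lose h′∈ ((a , b) , (c , d) , e)))

-- Graphs that are near-homogeneous with respect to a bounded vertex set

module NearHomogeneous (G : Graph) (no-diamond : Free diamond G) (no-P₂+P₃ : Free P₂+P₃ G) where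

  open Forbidden G no-diamond no-P₂+P₃
  open Decomposition G
  open Cliques G

  -- Adjacent apexes complete a K₄, nonadjacent ones a diamond.
  apex! : K₄-free → ∀ {x y z w} → x ~ y → z ~ x → z ~ y → w ~ x → w ~ y → z ≡ w
  apex! no-K₄ {x} {y} {z} {w} xy zx zy wx wy with adjacent? z w
  ... | inj₁ zw = ⊥-elim (no-K₄ xy (~-sym zx) (~-sym wx) (~-sym zy) (~-sym wy) zw)
  ... | inj₂ zw = apex-unique xy zx zy wx wy zw

  module Complemented (σ : V → V → Bool) (σ-sym : ∀ u v → σ u v ≡ σ v u) where

    F : V → V → Bool
    F u v = adj G u v xor σ u v

    Flip Plain : V → V → Set
    Flip  u v = F u v ≡ true
    Plain u v = F u v ≡ false

    F-sym : ∀ u v → F u v ≡ F v u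
    F-sym u v = cong₂ _xor_ (adj-sym G u v) (σ-sym u v)

    Flip? : ∀ u v → Dec (Flip u v)
    Flip? u v = F u v Boolₚ.≟ true

    Plain? : ∀ u v → Dec (Plain u v)
    Plain? u v = F u v Boolₚ.≟ false

    ¬Flip⇒Plain : ∀ {u v} → ¬ Flip u v → Plain u v
    ¬Flip⇒Plain {u} {v} ¬f with F u v
    ... | true  = ⊥-elim (¬f refl)
    ... | false = refl

    Flip-Plain : ∀ {u v} → Flip u v → Plain u v → ⊥
    Flip-Plain p q with trans (sym p) q
    ... | ()

    Flip-sym : ∀ {u v} → Flip u v → Flip v u
    Flip-sym {u} {v} p = trans (F-sym v u) p

    Plain-sym : ∀ {u v} → Plain u v → Plain v u
    Plain-sym {u} {v} p = trans (F-sym v u) p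

    adj-plain : ∀ {u v} → Plain u v → adj G u v ≡ σ u v
    adj-plain {u} {v} p with adj G u v | σ u v
    ... | true  | true  = refl
    ... | false | false = refl

    adj-flip : ∀ {u v} → Flip u v → adj G u v ≡ not (σ u v)
    adj-flip {u} {v} p with adj G u v | σ u v
    ... | true  | false = refl
    ... | false | true  = refl

    flip-~ : ∀ {u v} → Flip u v → σ u v ≡ false → u ~ v
    flip-~ p q = trans (adj-flip p) (cong not q)

    flip-≁ : ∀ {u v} → Flip u v → σ u v ≡ true → u ≁ v
    flip-≁ p q = trans (adj-flip p) (cong not q)

  module Components (D : List V) (M : ℕ) (π : V → Fin M)
    (σ : V → V → Bool) (σ-sym : ∀ u v → σ u v ≡ σ v u)
    (σ-cong : ∀ {u u′ v v′} → π u ≡ π u′ → π v ≡ π v′ → σ u v ≡ σ u′ v′)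
    (σ-same : ∀ {u v} → π u ≡ π v → σ u v ≡ false)
    (σ⇒K₄-free : ∀ {u v} → σ u v ≡ true → K₄-free) where

    open Complemented σ σ-sym
    open DecMembership (_≟_ {n G}) using (_∈?_)

    σ? : ∀ u v → σ u v ≡ true ⊎ σ u v ≡ false
    σ? u v with σ u v
    ... | true  = inj₁ refl
    ... | false = inj₂ refl

    -- A vertex is `Plain` to itself by `σ-same`, so distinctness has to be demanded separately.
    Far : V → V → Set
    Far x v = v ≢ x × Plain x v

    Far? : ∀ x v → Dec (Far x v)
    Far? x v = ¬? (v ≟ x) ×-dec Plain? x v

    Edge : Fin M → Fin M → V → V → Set
    Edge i j p q = (p ∉ D × π p ≡ i) × (q ∉ D × π q ≡ j) × Flip p q

    Edge? : ∀ i j p q → Dec (Edge i j p q)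
    Edge? i j p q = (¬? (p ∈? D) ×-dec (π p ≟ i)) ×-dec (¬? (q ∈? D) ×-dec (π q ≟ j)) ×-dec Flip? p q

    FarEdge : Fin M → Fin M → V → V → V → V → V → Set
    FarEdge i j x y z p q = Edge i j p q × (Far x p × Far x q) × (Far y p × Far y q) × (Far z p × Far z q)

    FarEdge? : ∀ i j x y z → Dec (∃ λ p → ∃ λ q → FarEdge i j x y z p q)
    FarEdge? i j x y z = Finₚ.any? λ p → Finₚ.any? λ q → Edge? i j p q ×-dec
      (Far? x p ×-dec Far? x q) ×-dec (Far? y p ×-dec Far? y q) ×-dec (Far? z p ×-dec Far? z q)

    -- Three vertices, because a copy of an edge will have to be far from the vertices of an induced
    -- P₃ of `F`, or from two of them and an earlier copy.
    Rich : Fin M → Fin M → Set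
    Rich i j = ∀ {x y z} → x ∉ D → y ∉ D → z ∉ D → ∃ λ p → ∃ λ q → FarEdge i j x y z p q

    module Sparsify (no-K₅ : K₅-free) (tests : List (V → Bool)) (agree-π : ∀ {u v} → Agree tests u v → π u ≡ π v)
      (star-clique : ∀ {v u u′} → v ∉ D → u ∉ D → π u ≡ π u′ → Flip v u → Flip v u′ → u ≢ u′ → u ~ u′) where

      B : ℕ
      -- The vertex itself and, by `star-clique`, a clique of at most four F-neighbours in each
      -- class.
      B = suc (M * 4)

      near : ∀ x → ∃ λ xs → length xs ≤ B × (x ∉ D → ∀ {v} → v ∉ D → ¬ Far x v → v ∈ xs)
      near x with x ∈? D
      ... | yes x∈ = [] , z≤n , λ x∉ → ⊥-elim (x∉ x∈)
      ... | no x∉  with collect M (λ i xs → ∀ {v} → (v ∉ D × π v ≡ i) × Flip x v → v ∈ xs)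
              (λ sub f q → sub (f q))
              (λ i → clique-cover no-K₅ (λ v → (¬? (v ∈? D) ×-dec (π v ≟ i)) ×-dec Flip? x v)
                (λ { ((u∉ , πu) , xu) ((v∉ , πv) , xv) → star-clique x∉ u∉ (trans πu (sym πv)) xu xv }))
      ...   | xs , xs≤ , all = x ∷ xs , s≤s xs≤ , λ _ {v} v∉ ¬far → covered v v∉ ¬far
        where
        covered : ∀ v → v ∉ D → ¬ Far x v → v ∈ x ∷ xs
        covered v v∉ ¬far with v ≟ x
        ... | yes v≡x = here v≡x
        ... | no v≢x  with Flip? x v
        ...   | yes f = there (all (π v) ((v∉ , refl) , f))
        ...   | no ¬f = ⊥-elim (¬far (v≢x , ¬Flip⇒Plain ¬f))

      Settled : Fin M → Fin M → List V → Set
      Settled i j xs = Rich i j ⊎ (∀ {p q} → Edge i j p q → p ∈ xs ⊎ q ∈ xs)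

      -- If a triple has no far edge of this type, then the at most `3 * B` vertices that are not
      -- far from the triple meet every edge of the type.
      settle : ∀ i j → ∃ λ xs → length xs ≤ B + (B + B) × Settled i j xs
      settle i j with Finₚ.any? (λ x → Finₚ.any? λ y → Finₚ.any? λ z →
                        ¬? (x ∈? D) ×-dec ¬? (y ∈? D) ×-dec ¬? (z ∈? D) ×-dec ¬? (FarEdge? i j x y z))
      ... | no rich = [] , z≤n , inj₁ λ {x} {y} {z} x∉ y∉ z∉ →
              decidable-stable (FarEdge? i j x y z) λ none → rich (x , y , z , x∉ , y∉ , z∉ , none)
      ... | yes (x , y , z , x∉ , y∉ , z∉ , none) with near x | near y | near z
      ...   | xs , xs≤ , cx | ys , ys≤ , cy | zs , zs≤ , cz =
              xs ++ (ys ++ zs) ,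
              subst (_≤ B + (B + B)) (sym (trans (Listₚ.length-++ xs) (cong (length xs +_) (Listₚ.length-++ ys))))
                (ℕₚ.+-mono-≤ xs≤ (ℕₚ.+-mono-≤ ys≤ zs≤)) ,
              inj₂ poor
        where
        far-or-hit : ∀ {v} → v ∉ D → (Far x v × Far y v × Far z v) ⊎ v ∈ xs ++ (ys ++ zs)
        far-or-hit {v} v∉ with Far? x v | Far? y v | Far? z v
        ... | yes a | yes b | yes c = inj₁ (a , b , c)
        ... | no a  | _     | _     = inj₂ (∈-++⁺ˡ (cx x∉ v∉ a))
        ... | yes _ | no b  | _     = inj₂ (∈-++⁺ʳ xs (∈-++⁺ˡ (cy y∉ v∉ b)))
        ... | yes _ | yes _ | no c  = inj₂ (∈-++⁺ʳ xs (∈-++⁺ʳ ys (cz z∉ v∉ c)))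
        poor : ∀ {p q} → Edge i j p q → p ∈ xs ++ (ys ++ zs) ⊎ q ∈ xs ++ (ys ++ zs)
        poor {p} {q} e@((p∉ , _) , (q∉ , _) , _) with far-or-hit p∉ | far-or-hit q∉
        ... | inj₂ h | _      = inj₁ h
        ... | inj₁ _ | inj₂ h = inj₂ h
        ... | inj₁ (a , b , c) | inj₁ (a′ , b′ , c′) =
                ⊥-elim (none (p , q , e , (a , a′) , (b , b′) , (c , c′)))

      settled : ∃ λ E → length E ≤ M * (M * (B + (B + B))) × (∀ i j → Settled i j E)
      settled = collect M (λ i xs → ∀ j → Settled i j xs) (λ sub f j → mono sub (f j))
        (λ i → collect M (Settled i) mono (settle i))
        where
        mono : ∀ {i j xs ys} → (∀ {a} → a ∈ xs → a ∈ ys) → Settled i j xs → Settled i j ys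
        mono sub (inj₁ r) = inj₁ r
        mono sub (inj₂ p) = inj₂ λ e → [ inj₁ ∘ sub , inj₂ ∘ sub ] (p e)

      module Rest (E : List V) (all-settled : ∀ i j → Settled i j E) where

        Ok : V → Set
        Ok v = v ∉ D ++ E

        ok-D : ∀ {v} → Ok v → v ∉ D
        ok-D ok v∈ = ok (∈-++⁺ˡ v∈)

        rich : ∀ {p q} → Ok p → Ok q → Flip p q → Rich (π p) (π q)
        rich {p} {q} p∉ q∉ pq with all-settled (π p) (π q)
        ... | inj₁ r = r
        ... | inj₂ poor = ⊥-elim ([ p∉ ∘ ∈-++⁺ʳ D , q∉ ∘ ∈-++⁺ʳ D ] (poor ((ok-D p∉ , refl) , (ok-D q∉ , refl) , pq)))

        -- A far copy t′ of t sees x exactly when x and t are opposed.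
        far-adj : ∀ {x t t′ b} → Far x t′ → π t′ ≡ π t → σ x t ≡ b → adj G x t′ ≡ b
        far-adj {x} (_ , pl) eq s = trans (adj-plain pl) (trans (σ-cong {x} refl eq) s)

        edge-σ : ∀ {p q p′ q′ b} → Edge (π p) (π q) p′ q′ → σ p q ≡ b → σ p′ q′ ≡ b
        edge-σ ((_ , ep) , (_ , eq) , _) s = trans (σ-cong ep eq) s

        flip-sym-σ : ∀ {u v b} → σ u v ≡ b → σ v u ≡ b
        flip-sym-σ {u} {v} = trans (σ-sym v u)

        -- A far copy `p′ r′` of `p r` satisfies `p ~ r′` and `r ~ p′`. If `σ q r` is false, the
        -- edge `r p′` and the path `q p r′` form a P₂+P₃; if it is true, two copies of `r` are
        -- nonadjacent apexes of the edge `p q`.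
        induced-P₃-one-dense : ∀ {p q r} → Ok p → Ok q → Ok r → Flip p q → Flip p r → Plain q r → q ≢ r →
                               σ p q ≡ false → σ p r ≡ true → ⊥
        induced-P₃-one-dense {p} {q} {r} p∉ q∉ r∉ pq pr qr q≢r σpq σpr
          with rich p∉ r∉ pr (ok-D p∉) (ok-D q∉) (ok-D r∉)
        ... | p′ , r′ , e@((p′∉ , πp′) , (r′∉ , πr′) , p′r′) , (pp′ , pr′) , (qp′ , qr′) , (rp′ , rr′)
          with σ? q r
        ...   | inj₂ σqr = P₂+P₃-free
                  (far-adj rp′ πp′ (flip-sym-σ σpr)) (~-sym (flip-~ pq σpq)) (far-adj pr′ πr′ σpr)
                  (≢-sym (proj₁ qr′)) (far-adj qr′ πr′ σqr)
                  (≁-sym (trans (adj-plain qr) σqr)) (≁-sym (flip-≁ pr σpr)) (far-adj rr′ πr′ (σ-same {r} refl))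
                  (≁-sym (far-adj qp′ πp′ (flip-sym-σ σpq))) (≁-sym (far-adj pp′ πp′ (σ-same {p} refl)))
                  (flip-≁ p′r′ (edge-σ e σpr))
        ...   | inj₁ σqr with rich p∉ r∉ pr (ok-D p∉) (ok-D q∉) r′∉
        ...     | p″ , r″ , ((_ , _) , (_ , πr″) , _) , (_ , pr″) , (_ , qr″) , (_ , r′r″) =
                  proj₁ r′r″ (sym (apex-unique (flip-~ pq σpq)
                    (~-sym (far-adj pr′ πr′ σpr)) (~-sym (far-adj qr′ πr′ σqr))
                    (~-sym (far-adj pr″ πr″ σpr)) (~-sym (far-adj qr″ πr″ σqr))
                    (far-adj r′r″ refl (σ-same (trans πr′ (sym πr″))))))

        -- With `σ p q` and `σ p r` false, a far copy of `p q` is an edge anticomplete to the path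
        -- `q p r`, unless `σ q r` holds and gives the triangle. With both true, either the edge
        -- `p q′` and the path `q p′ r` form a P₂+P₃, or `q` and a copy of it are nonadjacent apexes
        -- of the edge `p′ r`.
        induced-P₃⇒triangle : ∀ {p q r} → Ok p → Ok q → Ok r → Flip p q → Flip p r → Plain q r → q ≢ r →
                              p ~ q × p ~ r × q ~ r × K₄-free
        induced-P₃⇒triangle {p} {q} {r} p∉ q∉ r∉ pq pr qr q≢r with σ? p q | σ? p r
        ... | inj₂ σpq | inj₁ σpr = ⊥-elim (induced-P₃-one-dense p∉ q∉ r∉ pq pr qr q≢r σpq σpr)
        ... | inj₁ σpq | inj₂ σpr = ⊥-elim (induced-P₃-one-dense p∉ r∉ q∉ pr pq (Plain-sym qr) (≢-sym q≢r) σpr σpq)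
        ... | inj₂ σpq | inj₂ σpr with σ? q r
        ...   | inj₁ σqr = flip-~ pq σpq , flip-~ pr σpr , trans (adj-plain qr) σqr , σ⇒K₄-free σqr
        ...   | inj₂ σqr with rich p∉ q∉ pq (ok-D p∉) (ok-D q∉) (ok-D r∉)
        ...     | p′ , q′ , e@((_ , πp′) , (_ , πq′) , p′q′) , (pp′ , pq′) , (qp′ , qq′) , (rp′ , rq′) =
                  ⊥-elim (P₂+P₃-free (flip-~ p′q′ (edge-σ e σpq)) (~-sym (flip-~ pq σpq)) (flip-~ pr σpr)
                    q≢r (trans (adj-plain qr) σqr)
                    (≁-sym (far-adj qp′ πp′ (flip-sym-σ σpq))) (≁-sym (far-adj pp′ πp′ (σ-same {p} refl)))
                    (≁-sym (far-adj rp′ πp′ (flip-sym-σ σpr)))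
                    (≁-sym (far-adj qq′ πq′ (σ-same {q} refl))) (≁-sym (far-adj pq′ πq′ σpq))
                    (≁-sym (far-adj rq′ πq′ (flip-sym-σ σqr))))
        induced-P₃⇒triangle {p} {q} {r} p∉ q∉ r∉ pq pr qr q≢r | inj₁ σpq | inj₁ σpr
          with rich p∉ q∉ pq (ok-D p∉) (ok-D q∉) (ok-D r∉)
        ... | p′ , q′ , e@((p′∉ , πp′) , (_ , πq′) , p′q′) , (pp′ , pq′) , (qp′ , qq′) , (rp′ , rq′)
          with σ? q r
        ...   | inj₂ σqr = ⊥-elim (P₂+P₃-free (far-adj pq′ πq′ σpq)
                  (far-adj qp′ πp′ (flip-sym-σ σpq)) (~-sym (far-adj rp′ πp′ (flip-sym-σ σpr)))
                  q≢r (trans (adj-plain qr) σqr)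
                  (flip-≁ pq σpq) (far-adj pp′ πp′ (σ-same {p} refl)) (flip-≁ pr σpr)
                  (≁-sym (far-adj qq′ πq′ (σ-same {q} refl))) (≁-sym (flip-≁ p′q′ (edge-σ e σpq)))
                  (≁-sym (far-adj rq′ πq′ (flip-sym-σ σqr))))
        ...   | inj₁ σqr with rich p∉ q∉ pq (ok-D q∉) (ok-D r∉) p′∉
        ...     | p″ , q″ , ((_ , _) , (_ , πq″) , _) , (_ , qq″) , (_ , rq″) , (_ , p′q″) =
                  ⊥-elim (proj₁ qq″ (sym (apex-unique (~-sym (far-adj rp′ πp′ (flip-sym-σ σpr)))
                    (far-adj qp′ πp′ (flip-sym-σ σpq)) (trans (adj-plain qr) σqr)
                    (~-sym (far-adj p′q″ πq″ (trans (σ-cong πp′ (refl {x = π q})) σpq)))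
                    (~-sym (far-adj rq″ πq″ (flip-sym-σ σqr)))
                    (far-adj qq″ πq″ (σ-same {q} refl)))))

        -- Distinct triangles of G cannot share an edge, so two induced P₃'s of F
        -- cannot overlap in an edge.
        closed : ∀ {p q r} → Ok p → Ok q → Ok r → Flip p q → Flip p r → Plain q r → q ≢ r →
                 ∀ {s t} → Ok s → Ok t → Flip p s → Flip s t → t ≢ p → Plain p t → ⊥
        closed {p} {q} {r} p∉ q∉ r∉ pq pr qr q≢r {s} {t} s∉ t∉ ps st t≢p pt
          with induced-P₃⇒triangle p∉ q∉ r∉ pq pr qr q≢r
             | induced-P₃⇒triangle s∉ p∉ t∉ (Flip-sym ps) st pt (≢-sym t≢p)
        ... | p~q , p~r , q~r , no-K₄ | s~p , s~t , p~t , _ = absurd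
          where
          -- q and t are distinct apexes of the edge ps.
          off-q : ∀ {q} → Ok q → Flip p q → Plain s q → q ≢ s → ⊥
          off-q {q} q∉ pq sq q≢s with induced-P₃⇒triangle p∉ s∉ q∉ ps pq sq (≢-sym q≢s)
          ... | _ , p~q , s~q , _ with apex! no-K₄ s~p (~-sym s~t) (~-sym p~t) (~-sym s~q) (~-sym p~q)
          ...   | refl = Flip-Plain st sq
          absurd : ⊥
          absurd with q ≟ s | r ≟ s | Flip? s q | Flip? s r
          ... | yes refl | _ | _ | _ with apex! no-K₄ s~p (~-sym s~t) (~-sym p~t) (~-sym q~r) (~-sym p~r)
          ...   | refl = Flip-Plain pr pt
          absurd | no _ | yes refl | _ | _ with apex! no-K₄ s~p (~-sym s~t) (~-sym p~t) q~r (~-sym p~q)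
          ...   | refl = Flip-Plain pq pt
          absurd | no q≢s | no r≢s | no ¬sq | _ = off-q q∉ pq (¬Flip⇒Plain ¬sq) q≢s
          absurd | no q≢s | no r≢s | yes _ | no ¬sr = off-q r∉ pr (¬Flip⇒Plain ¬sr) r≢s
          absurd | no q≢s | no r≢s | yes sq | yes sr with induced-P₃⇒triangle s∉ q∉ r∉ sq sr qr q≢r
          ... | s~q , s~r , _ , _ with apex! no-K₄ q~r s~q s~r p~q p~r
          ...   | refl = ~⇒≢ s~p refl

        -- No F-edge leaves the closed F-neighbourhood of `p`, so adjacency across its boundary is
        -- `σ`. If it exhausts `S`, then `near p` bounds `S`.
        block : ∀ {S : V → Set} → Decidable S → (∀ {v} → S v → Ok v) → ∀ p → S p →
                (∀ {s t} → S s → S t → Flip p s → Flip s t → t ≢ p → Plain p t → ⊥) → Good G B tests S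
        block {S} S? ok p sp clo with Finₚ.any? (λ v → S? v ×-dec ¬? ((v ≟ p) ⊎-dec Flip? p v))
        ... | yes out = split σ
                (λ uu′ ww′ → σ-cong (agree-π uu′) (agree-π ww′))
                (λ v → (v ≟ p) ⊎-dec Flip? p v) (p , sp , inj₁ refl) out cross
          where
          cross : ∀ {u w} → S u → u ≡ p ⊎ Flip p u → S w → ¬ (w ≡ p ⊎ Flip p w) → adj G u w ≡ σ u w
          cross su (inj₁ refl) sw ¬pw = adj-plain (¬Flip⇒Plain (¬pw ∘ inj₂))
          cross su (inj₂ pu)   sw ¬pw = adj-plain (¬Flip⇒Plain λ uw →
            clo su sw pu uw (¬pw ∘ inj₁) (¬Flip⇒Plain (¬pw ∘ inj₂)))
        ... | no none = inj₁ (let (xs , xs≤ , cov) = near p in list⇒small xs xs≤ λ {v} sv →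
                cov (ok-D (ok sp)) (ok-D (ok sv)) λ (v≢p , pl) →
                  none (v , sv , λ { (inj₁ e) → v≢p e ; (inj₂ f) → Flip-Plain f pl }))

        good : ∀ {S : V → Set} → Decidable S → ∃ S → (∀ {v} → S v → Ok v) → Good G B tests S
        good {S} S? (v , sv) ok with Finₚ.any? (λ s → Finₚ.any? λ t →
            S? s ×-dec S? t ×-dec Flip? v s ×-dec Flip? s t ×-dec ¬? (t ≟ v) ×-dec Plain? v t)
        ... | no none = block S? ok v sv λ ss st vs st′ t≢v vt → none (_ , _ , ss , st , vs , st′ , t≢v , vt)
        -- Now `v s t` is an induced P₃ of `F` with centre `s`, so `closed` makes the closed
        -- neighbourhood of `s` a component.
        ... | yes (s , t , ss , st , vs , s~t , t≢v , vt) = block S? ok s ss λ ss′ st′ →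
                closed (ok ss) (ok sv) (ok st) (Flip-sym vs) s~t vt (≢-sym t≢v) (ok ss′) (ok st′)

      decomposable : ∀ {d m} → length D ≤ d → length tests ≤ m →
                     Decomposable G ((d + M * (M * (B + (B + B)))) + m) B
      decomposable {d} {m} D≤ tests≤ = go settled
        where
        go : (∃ λ E → length E ≤ M * (M * (B + (B + B))) × (∀ i j → Settled i j E)) →
             Decomposable G ((d + M * (M * (B + (B + B)))) + m) B
        go (E , E≤ , all) = delete (D ++ E) (subst (_≤ _) (sym (Listₚ.length-++ D)) (ℕₚ.+-mono-≤ D≤ E≤))
          tests tests≤ (Rest.good E all)

  module Pattern (H D : List V)
    (form : ∀ {u v} → u ∉ D → v ∉ D → Form H u v)
    (opposed⇒K₄-free : ∀ {u v} → Opposed H u v → K₄-free) where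

    open DecMembership (_≟_ {n G}) using (_∈?_)

    tests : List (V → Bool)
    tests = map (adj G) H

    M : ℕ
    M = 2 ^ length tests

    π : V → Fin M
    π = code tests

    same-adj : ∀ {u v h} → π u ≡ π v → h ∈ H → adj G u h ≡ adj G v h
    same-adj {u} {v} {h} eq h∈ = trans (adj-sym G u h)
      (trans (agree-at (∈-map⁺ (adj G) h∈) (code-agree tests eq)) (adj-sym G h v))

    Opposed? : ∀ u v → Dec (Opposed H u v)
    Opposed? u v = Any.any? (λ h → Any.any? (λ h′ →
      ((u ~? h) ×-dec (v ≁? h)) ×-dec ((v ~? h′) ×-dec (u ≁? h′)) ×-dec (h ≁? h′)) H) H

    σ : V → V → Bool
    σ u v = ⌊ Opposed? u v ⌋

    opposed-resp : ∀ {u u′ v v′} → π u ≡ π u′ → π v ≡ π v′ → Opposed H u v → Opposed H u′ v′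
    opposed-resp {u} {u′} {v} {v′} pu pv o with find o
    ... | h , h∈ , o′ with find o′
    ...   | h′ , h′∈ , (a , b) , (c , d) , e = lose h∈ (lose h′∈
            ( (trans (sym (same-adj pu h∈)) a , trans (sym (same-adj pv h∈)) b)
            , (trans (sym (same-adj pv h′∈)) c , trans (sym (same-adj pu h′∈)) d) , e))

    opposed-sym : ∀ {u v} → Opposed H u v → Opposed H v u
    opposed-sym o with find o
    ... | h , h∈ , o′ with find o′
    ...   | h′ , h′∈ , p , q , e = lose h′∈ (lose h∈ (q , p , ≁-sym e))

    σ-cong : ∀ {u u′ v v′} → π u ≡ π u′ → π v ≡ π v′ → σ u v ≡ σ u′ v′
    σ-cong {u} {u′} {v} {v′} pu pv =
      ⌊⌋-cong (Opposed? u v) (Opposed? u′ v′) (opposed-resp pu pv) (opposed-resp (sym pu) (sym pv))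

    σ-sym : ∀ u v → σ u v ≡ σ v u
    σ-sym u v = ⌊⌋-cong (Opposed? u v) (Opposed? v u) opposed-sym opposed-sym

    σ-same : ∀ {u v} → π u ≡ π v → σ u v ≡ false
    σ-same {u} {v} eq = ⌊⌋-false (Opposed? u v) λ o →
      let (h , h∈ , o′) = find o ; (_ , _ , (a , b) , _) = find o′ in ~-≁ (trans (sym (same-adj eq h∈)) a) b

    σ-true : ∀ {u v} → σ u v ≡ true → Opposed H u v
    σ-true {u} {v} eq with Opposed? u v
    ... | yes o = o

    σ-false : ∀ {u v} → σ u v ≡ false → ¬ Opposed H u v
    σ-false {u} {v} eq with Opposed? u v
    ... | no o = o

    open Complemented σ σ-sym

    -- Let `u` and `u′` be nonadjacent. If `v` and `u` are opposed through `h` and `h′`, the edge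
    -- `v h` and the path `u h′ u′` form a P₂+P₃. Otherwise `u v u′` is a path of G: an avoided edge
    -- of `H` completes it to a P₂+P₃, and a shared `h` makes `u` and `u′` apexes of the edge `v h`.
    star-clique : ∀ {v u u′} → v ∉ D → u ∉ D → π u ≡ π u′ → Flip v u → Flip v u′ → u ≢ u′ → u ~ u′
    star-clique {v} {u} {u′} v∉ u∉ uu′ vu vu′ u≢u′ with adjacent? u u′
    ... | inj₁ p = p
    ... | inj₂ u≁u′ = ⊥-elim (absurd (σ v u) refl)
      where
      absurd : ∀ b → σ v u ≡ b → ⊥
      absurd true  eq with find (σ-true eq)
      ... | h , h∈ , o with find o
      ...   | h′ , h′∈ , (vh , uh) , (uh′ , vh′) , hh′ =
              P₂+P₃-free vh uh′ (~-sym (trans (sym (same-adj uu′ h′∈)) uh′)) u≢u′ u≁u′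
                (flip-≁ vu eq) vh′ (flip-≁ vu′ (trans (σ-cong {v} refl (sym uu′)) eq))
                (≁-sym uh) hh′ (≁-sym (trans (sym (same-adj uu′ h∈)) uh))
      absurd false eq with form v∉ u∉
      ... | opposed o = σ-false eq o
      ... | avoided h∈ h′∈ hh′ vh vh′ uh uh′ =
              P₂+P₃-free hh′ (~-sym (flip-~ vu eq)) (flip-~ vu′ (trans (σ-cong {v} refl (sym uu′)) eq)) u≢u′ u≁u′
                (≁-sym uh) (≁-sym vh) (≁-sym (trans (sym (same-adj uu′ h∈)) uh))
                (≁-sym uh′) (≁-sym vh′) (≁-sym (trans (sym (same-adj uu′ h′∈)) uh′))
      ... | shared h∈ vh uh = u≢u′ (apex-unique vh (~-sym (flip-~ vu eq)) uh
              (~-sym (flip-~ vu′ (trans (σ-cong {v} refl (sym uu′)) eq))) (trans (sym (same-adj uu′ h∈)) uh) u≁u′)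

    near-homogeneous : ∀ {d h} → K₅-free → length D ≤ d → length tests ≤ h →
      Decomposable G ((d + M * (M * (suc (M * 4) + (suc (M * 4) + suc (M * 4))))) + h) (suc (M * 4))
    near-homogeneous no-K₅ = Components.Sparsify.decomposable D M π σ σ-sym σ-cong σ-same
      (opposed⇒K₄-free ∘ σ-true) no-K₅ tests (agree-code tests) star-clique

abstract

  -- Three vertices with at most one neighbour each in a K₅ leave an edge of it anticomplete to
  -- them. All index triples are checked by evaluation.
  avoid₃ : ∀ (a b c : Fin 5) → ∃ λ i → ∃ λ j → i ≢ j × (i ≢ a × i ≢ b × i ≢ c) × (j ≢ a × j ≢ b × j ≢ c)
  avoid₃ = toWitness
    {a? = Finₚ.all? λ a → Finₚ.all? λ b → Finₚ.all? λ c → Finₚ.any? λ i → Finₚ.any? λ j →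
          ¬? (i ≟ j) ×-dec (¬? (i ≟ a) ×-dec ¬? (i ≟ b) ×-dec ¬? (i ≟ c))
                     ×-dec (¬? (j ≟ a) ×-dec ¬? (j ≟ b) ×-dec ¬? (j ≟ c))} tt

-- Graphs with a K₅

module LargeClique (G : Graph) (no-diamond : Free diamond G) (no-P₂+P₃ : Free P₂+P₃ G) where

  open Forbidden G no-diamond no-P₂+P₃
  open Decomposition G

  module _ (k : Fin 5 → V) (k-clique : ∀ {i j} → i ≢ j → k i ~ k j) where

    private
      k₀ k₁ : V
      k₀ = k zero
      k₁ = k (suc zero)

    -- The maximal clique through the edge k₀k₁, unique by diamond-freeness.
    K : V → Set
    K v = (v ≡ k₀ ⊎ v ~ k₀) × (v ≡ k₁ ⊎ v ~ k₁)

    K? : Decidable K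
    K? v = ((v ≟ k₀) ⊎-dec (v ~? k₀)) ×-dec ((v ≟ k₁) ⊎-dec (v ~? k₁))

    k∈K : ∀ i → K (k i)
    k∈K zero = inj₁ refl , inj₂ (k-clique λ ())
    k∈K (suc zero) = inj₂ (k-clique λ ()) , inj₁ refl
    k∈K (suc (suc i)) = inj₂ (k-clique λ ()) , inj₂ (k-clique λ ())

    K-clique : ∀ {u v} → K u → K v → u ≢ v → u ~ v
    K-clique (inj₁ refl , _) (inj₁ refl , _) u≢v = ⊥-elim (u≢v refl)
    K-clique (inj₁ refl , _) (inj₂ vk₀ , _)  u≢v = ~-sym vk₀
    K-clique (inj₂ uk₀ , _)  (inj₁ refl , _) u≢v = uk₀
    K-clique (inj₂ _ , inj₁ refl) (inj₂ _ , inj₁ refl) u≢v = ⊥-elim (u≢v refl)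
    K-clique (inj₂ _ , inj₁ refl) (inj₂ _ , inj₂ vk₁)  u≢v = ~-sym vk₁
    K-clique (inj₂ _ , inj₂ uk₁)  (inj₂ _ , inj₁ refl) u≢v = uk₁
    K-clique {u} {v} (inj₂ uk₀ , inj₂ uk₁) (inj₂ vk₀ , inj₂ vk₁) u≢v with adjacent? u v
    ... | inj₁ p = p
    ... | inj₂ q = ⊥-elim (u≢v (apex-unique (k-clique {zero} {suc zero} λ ()) uk₀ uk₁ vk₀ vk₁ q))

    K-∉ : ∀ {a v} → K a → ¬ K v → a ≢ v
    K-∉ ka ¬kv refl = ¬kv ka

    missing : ∀ {v} → ¬ K v → ∃ λ c → K c × v ≁ c
    missing {v} ¬kv with (v ≟ k₀) ⊎-dec (v ~? k₀) | (v ≟ k₁) ⊎-dec (v ~? k₁)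
    ... | yes p | yes q = ⊥-elim (¬kv (p , q))
    ... | no ¬p | _     = k₀ , k∈K zero , ¬~⇒≁ (¬p ∘ inj₂)
    ... | yes _ | no ¬q = k₁ , k∈K (suc zero) , ¬~⇒≁ (¬q ∘ inj₂)

    -- With two neighbours in `K`, `v` and a vertex of `K` that it misses would be nonadjacent
    -- apexes of the edge between them.
    one-nbr : ∀ {v a b} → ¬ K v → K a → K b → v ~ a → v ~ b → a ≡ b
    one-nbr {v} {a} {b} ¬kv ka kb va vb with a ≟ b | missing ¬kv
    ... | yes p | _ = p
    ... | no a≢b | c , kc , vc = ⊥-elim (K-∉ kc ¬kv (sym (apex-unique (K-clique ka kb a≢b) va vb
            (K-clique kc ka (≁-~⇒≢ (≁-sym vc) (~-sym va))) (K-clique kc kb (≁-~⇒≢ (≁-sym vc) (~-sym vb))) vc)))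

    index : ∀ {v} → ¬ K v → ∃ λ i → ∀ {j} → j ≢ i → v ≁ k j
    index {v} ¬kv with Finₚ.any? (λ j → v ~? k j)
    ... | no none = zero , λ _ → ¬~⇒≁ λ p → none (_ , p)
    ... | yes (i , vi) = i , λ {j} j≢i → ¬~⇒≁ λ vj →
            ~⇒≢ (k-clique j≢i) (one-nbr ¬kv (k∈K j) (k∈K i) vj vi)

    outside-closed : ∀ {a b c} → ¬ K a → ¬ K b → ¬ K c → a ~ b → b ~ c → a ≢ c → a ~ c
    outside-closed {a} {b} {c} ¬ka ¬kb ¬kc ab bc a≢c with adjacent? a c
    ... | inj₁ p = p
    ... | inj₂ ac with index ¬ka | index ¬kb | index ¬kc
    ...   | ia , fa | ib , fb | ic , fc with avoid₃ ia ib ic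
    ...     | i , j , i≢j , (i₁ , i₂ , i₃) , (j₁ , j₂ , j₃) =
              ⊥-elim (P₂+P₃-free (k-clique i≢j) ab bc a≢c ac
                (≁-sym (fa i₁)) (≁-sym (fb i₂)) (≁-sym (fc i₃)) (≁-sym (fa j₁)) (≁-sym (fb j₂)) (≁-sym (fc j₃)))

    -- Some `k i` is seen by none of `q₁`, `q₂` and `a`; the path through `k i`, `x` and `a` would
    -- be anticomplete to the edge `q₁ q₂`.
    K-nbr-hits-edges : ∀ {q₁ q₂ a x} → ¬ K q₁ → ¬ K q₂ → ¬ K a → q₁ ~ q₂ → a ≁ q₁ → a ≁ q₂ →
                       K x → x ~ a → x ≁ q₁ → x ≁ q₂ → ⊥
    K-nbr-hits-edges {a = a} ¬k₁ ¬k₂ ¬ka q₁q₂ aq₁ aq₂ kx xa xq₁ xq₂ with index ¬k₁ | index ¬k₂ | index ¬ka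
    ... | i₁ , f₁ | i₂ , f₂ | ia , fa with avoid₃ i₁ i₂ ia
    ...   | i , _ , _ , (i≢₁ , i≢₂ , i≢a) , _ =
            P₂+P₃-free q₁q₂ (K-clique (k∈K i) kx (≁-~⇒≢ (≁-sym (fa i≢a)) xa)) xa (K-∉ (k∈K i) ¬ka) (≁-sym (fa i≢a))
              (f₁ i≢₁) (≁-sym xq₁) (≁-sym aq₁) (f₂ i≢₂) (≁-sym xq₂) (≁-sym aq₂)

    Kᵇ : V → Bool
    Kᵇ v = ⌊ K? v ⌋

    K-nbrs : ∀ q → ¬ K q → ∃ λ xs → length xs ≤ 1 × (∀ {x} → K x → q ~ x → x ∈ xs)
    K-nbrs q ¬kq with Finₚ.any? (λ x → K? x ×-dec (q ~? x))
    ... | no none = [] , z≤n , λ kx qx → ⊥-elim (none (_ , kx , qx))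
    ... | yes (x , kx , qx) = x ∷ [] , s≤s z≤n , λ ky qy → here (one-nbr ¬kq ky kx qy qx)

    module _ {s : ℕ} {T : List (V → Bool)} {S : V → Set} (S? : Decidable S)
             (Q : V → Bool) (Q∈T : Q ∈ T) (K∈T : Kᵇ ∈ T)
             (pendant : ∀ {x u w} → S x → K x → S u → ¬ K u → x ~ u → S w → ¬ K w → u ≢ w → adj G u w ≡ Q u ∧ Q w) where

      private
        f : Bool → Bool → Bool → Bool → Bool
        f a b c d = (a ∧ b) ∨ ((not a ∧ not b) ∧ (c ∧ d))

        f-eq : ∀ {u w a b e} → Kᵇ u ≡ a → Kᵇ w ≡ b → e ≡ f a b (Q u) (Q w) → e ≡ f (Kᵇ u) (Kᵇ w) (Q u) (Q w)
        f-eq {u} {w} p q e = trans e (sym (cong₂ (λ a b → f a b (Q u) (Q w)) p q))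

      -- The split takes `x` with its neighbours outside `K`, which by `one-nbr` see nothing else in
      -- `K`. So across it `K` is complete, no edge joins `K` to the outside, and `Q` decides the
      -- pairs outside `K`.
      split-off-K : ∀ x → S x → K x → Good G (suc s) T S
      split-off-K x sx kx with Finₚ.any? (λ w → S? w ×-dec ¬? ((w ≟ x) ⊎-dec (¬? (K? w) ×-dec (x ~? w))))
      ... | yes out = split (λ u w → f (Kᵇ u) (Kᵇ w) (Q u) (Q w)) f-resp
              (λ w → (w ≟ x) ⊎-dec (¬? (K? w) ×-dec (x ~? w))) (x , sx , inj₁ refl) out cross
        where
        f-resp : ∀ {u u′ w w′} → Agree T u u′ → Agree T w w′ →
               f (Kᵇ u) (Kᵇ w) (Q u) (Q w) ≡ f (Kᵇ u′) (Kᵇ w′) (Q u′) (Q w′)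
        f-resp p q rewrite agree-at K∈T p | agree-at K∈T q | agree-at Q∈T p | agree-at Q∈T q = refl
        cross : ∀ {u w} → S u → u ≡ x ⊎ (¬ K u × x ~ u) → S w → ¬ (w ≡ x ⊎ (¬ K w × x ~ w)) →
                adj G u w ≡ f (Kᵇ u) (Kᵇ w) (Q u) (Q w)
        cross {u} {w} su (inj₁ refl) sw ¬pw with toSum (K? w)
        ... | inj₁ kw = f-eq {u} {w} (⌊⌋-true (K? u) kx) (⌊⌋-true (K? w) kw) (K-clique kx kw (¬pw ∘ inj₁ ∘ sym))
        ... | inj₂ ¬kw = f-eq {u} {w} (⌊⌋-true (K? u) kx) (⌊⌋-false (K? w) ¬kw) (¬~⇒≁ λ p → ¬pw (inj₂ (¬kw , p)))
        cross {u} {w} su (inj₂ (¬ku , xu)) sw ¬pw with toSum (K? w)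
        ... | inj₁ kw = f-eq {u} {w} (⌊⌋-false (K? u) ¬ku) (⌊⌋-true (K? w) kw)
                (¬~⇒≁ λ uw → ¬pw (inj₁ (one-nbr ¬ku kw kx uw (~-sym xu))))
        ... | inj₂ ¬kw = f-eq {u} {w} (⌊⌋-false (K? u) ¬ku) (⌊⌋-false (K? w) ¬kw)
                (pendant sx kx su ¬ku xu sw ¬kw λ { refl → ¬pw (inj₂ (¬ku , xu)) })
      ... | no none = single S? (λ _ → true) (λ _ → refl) x sx near
        where
        near : ∀ {w} → S w → w ≢ x → x ~ w
        near {w} sw w≢x with K? w | adjacent? x w
        ... | _      | inj₁ p = p
        ... | yes kw | inj₂ _ = K-clique kx kw (≢-sym w≢x)
        ... | no ¬kw | inj₂ q = ⊥-elim (none (w , sw , λ { (inj₁ e) → w≢x e ; (inj₂ (_ , p)) → ~-≁ p q }))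

      pendants⇒good : ∃ S → Good G (suc s) T S
      pendants⇒good ne with Finₚ.any? (λ x → S? x ×-dec K? x)
      ... | yes (x , sx , kx) = split-off-K x sx kx
      ... | no none = P₃-closed⇒good S? ne λ sa sb sc →
              outside-closed (λ p → none (_ , sa , p)) (λ p → none (_ , sb , p)) (λ p → none (_ , sc , p))

    -- An edge `q₁ q₂` outside `K` is deleted with its at most two neighbours in `K`. By
    -- `K-nbr-hits-edges` any outside vertex that still has a neighbour in `K` belongs to the clique
    -- of `q₁`, so adjacency to `q₁` can serve as `Q`. Four deletions and two tests make six.
    large-clique : Decomposable G 6 1
    large-clique with Finₚ.any? (λ q₁ → Finₚ.any? λ q₂ → ¬? (K? q₁) ×-dec ¬? (K? q₂) ×-dec (q₁ ~? q₂))
    ... | no none = delete {d = 4} [] z≤n (Kᵇ ∷ (λ _ → false) ∷ []) (s≤s (s≤s z≤n)) λ S? ne _ →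
            pendants⇒good S? (λ _ → false) (there (here refl)) (here refl)
              (λ _ _ _ ¬ku _ _ ¬kw _ → ¬~⇒≁ λ uw → none (_ , _ , ¬ku , ¬kw , uw)) ne
    ... | yes (q₁ , q₂ , ¬k₁ , ¬k₂ , q₁q₂) with K-nbrs q₁ ¬k₁ | K-nbrs q₂ ¬k₂
    ...   | xs , xs≤ , cov₁ | ys , ys≤ , cov₂ =
            delete (q₁ ∷ q₂ ∷ xs ++ ys)
              (s≤s (s≤s (subst (_≤ 2) (sym (Listₚ.length-++ xs)) (ℕₚ.+-mono-≤ xs≤ ys≤))))
              (Kᵇ ∷ adj G q₁ ∷ []) (s≤s (s≤s z≤n)) λ S? ne S∌D →
            pendants⇒good S? (adj G q₁) (there (here refl)) (here refl) (pendant S∌D) ne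
      where
      pendant : ∀ {S : V → Set} → (∀ {v} → S v → v ∉ q₁ ∷ q₂ ∷ xs ++ ys) →
                ∀ {x u w} → S x → K x → S u → ¬ K u → x ~ u → S w → ¬ K w → u ≢ w →
                adj G u w ≡ adj G q₁ u ∧ adj G q₁ w
      pendant S∌D {x} {u} {w} sx kx su ¬ku xu sw ¬kw u≢w = trans uw (sym (cong (_∧ adj G q₁ w) q₁u))
        where
        xq₁ : x ≁ q₁
        xq₁ = ¬~⇒≁ λ p → S∌D sx (there (there (∈-++⁺ˡ (cov₁ kx (~-sym p)))))
        xq₂ : x ≁ q₂
        xq₂ = ¬~⇒≁ λ p → S∌D sx (there (there (∈-++⁺ʳ xs (cov₂ kx (~-sym p)))))
        q₁u : q₁ ~ u
        q₁u with adjacent? u q₁ | adjacent? u q₂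
        ... | inj₁ p | _ = ~-sym p
        ... | inj₂ _ | inj₁ p = outside-closed ¬k₁ ¬k₂ ¬ku q₁q₂ (~-sym p) λ { refl → S∌D su (here refl) }
        ... | inj₂ p | inj₂ q = ⊥-elim (K-nbr-hits-edges ¬k₁ ¬k₂ ¬ku q₁q₂ p q kx xu xq₁ xq₂)
        uw : adj G u w ≡ adj G q₁ w
        uw with adjacent? q₁ w
        ... | inj₁ p = trans (outside-closed ¬ku ¬k₁ ¬kw (~-sym q₁u) p u≢w) (sym p)
        ... | inj₂ q = trans (¬~⇒≁ λ uw → ~-≁ (outside-closed ¬k₁ ¬ku ¬kw q₁u uw λ { refl → S∌D sw (here refl) }) q)
                             (sym q)

-- K₅-free graphs with a K₄, an induced C₅, a net, or a triangle and a far edge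

nh-tests nh-size : ℕ → ℕ
-- There are `2 ^ h` traces on `h` vertices. The largest case is `h = 6`, where `nh-size` is 257 and
-- `nh-tests` is 3158016; the final bounds `2 ^ 9` and `2 ^ 22` accommodate it.
nh-size h = suc (2 ^ h * 4)
nh-tests h = 2 ^ h * (2 ^ h * (nh-size h + (nh-size h + nh-size h)))

next : Fin 5 → Fin 5
next zero = suc zero
next (suc zero) = suc (suc zero)
next (suc (suc zero)) = suc (suc (suc zero))
next (suc (suc (suc zero))) = suc (suc (suc (suc zero)))
next (suc (suc (suc (suc zero)))) = zero

C₅ : Fin 5 → Fin 5 → Bool
C₅ i j = (next i == j) ∨ (next j == i)

all-vec? : ∀ {n} {P : Vec Bool n → Set} → Decidable P → Dec (∀ a → P a)
all-vec? {zero} P? with P? []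
... | yes p = yes λ { [] → p }
... | no ¬p = no λ f → ¬p (f [])
all-vec? {suc n} P? with all-vec? (λ a → P? (true ∷ a)) | all-vec? (λ a → P? (false ∷ a))
... | yes p | yes q = yes λ { (true ∷ a) → p a ; (false ∷ a) → q a }
... | no ¬p | _     = no λ f → ¬p (f ∘ (true ∷_))
... | yes _ | no ¬q = no λ f → ¬q (f ∘ (false ∷_))

module _ (a b : Vec Bool 5) where

  private
    a? : ∀ i x → Dec (lookup a i ≡ x)
    a? i x = lookup a i Boolₚ.≟ x
    b? : ∀ i x → Dec (lookup b i ≡ x)
    b? i x = lookup b i Boolₚ.≟ x

  Sparse : Set
  Sparse = ∀ i → ¬ (lookup a i ≡ true × lookup a (next i) ≡ true)

  Avoided Shared Opposing : Set
  Avoided = ∃ λ i → (lookup a i ≡ false × lookup a (next i) ≡ false) × (lookup b i ≡ false × lookup b (next i) ≡ false)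
  Shared = ∃ λ i → lookup a i ≡ true × lookup b i ≡ true
  Opposing = ∃ λ i → ∃ λ j →
    (lookup a i ≡ true × lookup b i ≡ false) × (lookup b j ≡ true × lookup a j ≡ false) × C₅ i j ≡ false

  sparse? : Dec Sparse
  sparse? = Finₚ.all? λ i → ¬? (a? i true ×-dec a? (next i) true)

  forms? : Dec (Avoided ⊎ Shared ⊎ Opposing)
  forms? = (Finₚ.any? λ i → (a? i false ×-dec a? (next i) false) ×-dec (b? i false ×-dec b? (next i) false))
    ⊎-dec (Finₚ.any? λ i → a? i true ×-dec b? i true)
    ⊎-dec (Finₚ.any? λ i → Finₚ.any? λ j →
             (a? i true ×-dec b? i false) ×-dec (b? j true ×-dec a? j false) ×-dec (C₅ i j Boolₚ.≟ false))

abstract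

  -- Sparse traces are the eleven independent sets of the 5-cycle; all pairs are checked by
  -- evaluation.
  C₅-forms : ∀ a b → Sparse a a → Sparse b b → Avoided a b ⊎ Shared a b ⊎ Opposing a b
  C₅-forms = toWitness {a? = all-vec? λ a → all-vec? λ b → sparse? a a →-dec sparse? b b →-dec forms? a b} tt

  avoid₂ : ∀ (a b : Fin 4) → ∃ λ i → ∃ λ j → i ≢ j × (i ≢ a × i ≢ b) × (j ≢ a × j ≢ b)
  avoid₂ = toWitness
    {a? = Finₚ.all? λ a → Finₚ.all? λ b → Finₚ.any? λ i → Finₚ.any? λ j →
          ¬? (i ≟ j) ×-dec (¬? (i ≟ a) ×-dec ¬? (i ≟ b)) ×-dec (¬? (j ≟ a) ×-dec ¬? (j ≟ b))} tt

  others : ∀ (a : Fin 3) → ∃ λ i → ∃ λ j → i ≢ j × i ≢ a × j ≢ a × (∀ t → t ≡ i ⊎ t ≡ j ⊎ t ≡ a)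
  others = toWitness {a? = Finₚ.all? λ a → Finₚ.any? λ i → Finₚ.any? λ j →
    ¬? (i ≟ j) ×-dec ¬? (i ≟ a) ×-dec ¬? (j ≟ a) ×-dec
    Finₚ.all? λ t → (t ≟ i) ⊎-dec (t ≟ j) ⊎-dec (t ≟ a)} tt

  third : ∀ (a b : Fin 3) → ∃ λ i → i ≢ a × i ≢ b
  third = toWitness {a? = Finₚ.all? λ a → Finₚ.all? λ b → Finₚ.any? λ i → ¬? (i ≟ a) ×-dec ¬? (i ≟ b)} tt

module DenseCases (G : Graph) (no-diamond : Free diamond G) (no-P₂+P₃ : Free P₂+P₃ G) where

  open Forbidden G no-diamond no-P₂+P₃
  open Decomposition G
  open Cliques G
  open NearHomogeneous G no-diamond no-P₂+P₃

  nh : ∀ (H D : List V) {d h} → K₅-free → (∀ {u v} → u ∉ D → v ∉ D → Form H u v) →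
       (∀ {u v} → Opposed H u v → K₄-free) → length D ≤ d → length (map (adj G) H) ≡ h →
       Decomposable G ((d + nh-tests h) + h) (nh-size h)
  nh H D no-K₅ form opp D≤ refl = Pattern.near-homogeneous H D form opp no-K₅ D≤ ℕₚ.≤-refl

  at-most-one : ∀ {m v} (k : Fin (suc m) → V) → (∀ {i j} → v ~ k i → v ~ k j → i ≡ j) →
                ∃ λ i → ∀ {j} → j ≢ i → v ≁ k j
  at-most-one {v = v} k uniq with Finₚ.any? (λ i → v ~? k i)
  ... | no none = zero , λ _ → ¬~⇒≁ λ p → none (_ , p)
  ... | yes (i , vi) = i , λ j≢i → ¬~⇒≁ λ vj → j≢i (uniq vj vi)

  module _ {m : ℕ} (k : Fin m → V) (k-clique : ∀ {i j} → i ≢ j → k i ~ k j) where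

    -- A missed `k l` would be an apex of the edge between `k i` and `k j` nonadjacent to the apex
    -- `v`.
    two⇒all : ∀ {v i j} → v ∉ List.tabulate k → v ~ k i → v ~ k j → i ≢ j → ∀ l → v ~ k l
    two⇒all {v} {i} {j} v∉ vi vj i≢j l with l ≟ i | l ≟ j
    ... | yes refl | _ = vi
    ... | no _ | yes refl = vj
    ... | no l≢i | no l≢j with adjacent? v (k l)
    ...   | inj₁ p = p
    ...   | inj₂ q = ⊥-elim (v∉ (subst (_∈ List.tabulate k)
              (sym (apex-unique (k-clique i≢j) vi vj (k-clique l≢i) (k-clique l≢j) q)) (∈-tabulate⁺ {f = k} l)))

  -- With at most one neighbour each in the K₄, two outside vertices avoid one of its edges. A
  -- clique admits no opposed pairs, so nothing is complemented and `F` is the graph itself.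
  K₄-case : K₅-free → (k : Fin 4 → V) → (∀ {i j} → i ≢ j → k i ~ k j) →
            Decomposable G ((4 + nh-tests 4) + 4) (nh-size 4)
  K₄-case no-K₅ k k-clique = nh H H no-K₅ form (λ o → ⊥-elim (not-opposed o)) ℕₚ.≤-refl refl
    where
    H : List V
    H = List.tabulate k
    one : ∀ {v} → v ∉ H → ∀ {i j} → v ~ k i → v ~ k j → i ≡ j
    one {v} v∉ {i} {j} vi vj with i ≟ j
    ... | yes p = p
    ... | no i≢j = let all = two⇒all k k-clique v∉ vi vj i≢j in
            ⊥-elim (no-K₅ (all zero) (all (suc zero)) (all (suc (suc zero))) (all (suc (suc (suc zero))))
              (k-clique λ ()) (k-clique λ ()) (k-clique λ ()) (k-clique λ ()) (k-clique λ ()) (k-clique λ ()))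
    form : ∀ {u v} → u ∉ H → v ∉ H → Form H u v
    form u∉ v∉ with at-most-one k (one u∉) | at-most-one k (one v∉)
    ... | a , fa | b , fb with avoid₂ a b
    ...   | i , j , i≢j , (ia , ib) , (ja , jb) =
              avoided (∈-tabulate⁺ {f = k} i) (∈-tabulate⁺ {f = k} j) (k-clique i≢j) (fa ia) (fa ja) (fb ib) (fb jb)
    H⊆k : ∀ {h} → h ∈ H → ∃ λ i → h ≡ k i
    H⊆k = ∈-tabulate⁻ {f = k}
    not-opposed : ∀ {u v} → Opposed H u v → ⊥
    not-opposed o with find o
    ... | h , h∈ , o′ with find o′ | H⊆k h∈
    ...   | h′ , h′∈ , (uh , _) , (_ , uh′) , hh′ | i , refl with H⊆k h′∈
    ...     | j , refl with i ≟ j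
    ...       | yes refl = ~-≁ uh uh′
    ...       | no i≢j   = ~-≁ (k-clique i≢j) hh′

  module _ (no-K₄ : K₄-free) where

    K₄-free⇒K₅-free : K₅-free
    K₄-free⇒K₅-free ab ac ad _ bc bd _ cd _ _ = no-K₄ ab ac ad bc bd cd

    -- Only the at most five common neighbours of consecutive cycle vertices are deleted; every
    -- other vertex, including those of the cycle, has a sparse trace.
    C₅-case : (c : Fin 5 → V) → (∀ i j → adj G (c i) (c j) ≡ C₅ i j) →
              Decomposable G ((5 + nh-tests 5) + 5) (nh-size 5)
    C₅-case c c-adj = nh H D K₄-free⇒K₅-free form (λ _ → no-K₄) (proj₁ (proj₂ apexes)) refl
      where
      H : List V
      H = List.tabulate c
      c-next : ∀ i → c i ~ c (next i)
      c-next i = trans (c-adj i (next i)) (cong (_∨ (next (next i) == i)) (==-refl (next i)))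
      apexes : ∃ λ xs → length xs ≤ 5 * 1 × (∀ i {v} → v ~ c i → v ~ c (next i) → v ∈ xs)
      apexes = collect 5 (λ i xs → ∀ {v} → v ~ c i → v ~ c (next i) → v ∈ xs) (λ sub f p q → sub (f p q)) each
        where
        each : ∀ i → ∃ λ xs → length xs ≤ 1 × (∀ {v} → v ~ c i → v ~ c (next i) → v ∈ xs)
        each i with Finₚ.any? (λ v → (v ~? c i) ×-dec (v ~? c (next i)))
        ... | no none = [] , z≤n , λ p q → ⊥-elim (none (_ , p , q))
        ... | yes (w , p , q) = w ∷ [] , s≤s z≤n , λ p′ q′ → here (apex! no-K₄ (c-next i) p′ q′ p q)
      D : List V
      D = proj₁ apexes
      pattern-of : V → Vec Bool 5
      pattern-of v = Vec.tabulate (λ i → adj G v (c i))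
      at : ∀ {v x} i → lookup (pattern-of v) i ≡ x → adj G v (c i) ≡ x
      at {v} i eq = trans (sym (lookup∘tabulate (λ i → adj G v (c i)) i)) eq
      sparse : ∀ {v} → v ∉ D → Sparse (pattern-of v) (pattern-of v)
      sparse v∉ i (p , q) = v∉ (proj₂ (proj₂ apexes) i (at i p) (at (next i) q))
      form : ∀ {u v} → u ∉ D → v ∉ D → Form H u v
      form {u} {v} u∉ v∉ with C₅-forms (pattern-of u) (pattern-of v) (sparse u∉) (sparse v∉)
      ... | inj₁ (i , (p , q) , (p′ , q′)) = avoided (∈-tabulate⁺ {f = c} i) (∈-tabulate⁺ {f = c} (next i)) (c-next i)
              (at i p) (at (next i) q) (at i p′) (at (next i) q′)
      ... | inj₂ (inj₁ (i , p , q)) = shared (∈-tabulate⁺ {f = c} i) (at i p) (at i q)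
      ... | inj₂ (inj₂ (i , j , (p , q) , (p′ , q′) , ij)) = opposed′ (∈-tabulate⁺ {f = c} i) (∈-tabulate⁺ {f = c} j)
              (at i p) (at i q) (at j p′) (at j q′) (trans (c-adj i j) ij)

    module Triangle (k : Fin 3 → V) (k-clique : ∀ {i j} → i ≢ j → k i ~ k j) where

      D : List V
      D = List.tabulate k

      one : ∀ {v i j} → v ∉ D → v ~ k i → v ~ k j → i ≡ j
      one {v} {i} {j} v∉ vi vj with i ≟ j
      ... | yes p = p
      ... | no i≢j = let all = two⇒all k k-clique v∉ vi vj i≢j in
              ⊥-elim (no-K₄ (all zero) (all (suc zero)) (all (suc (suc zero))) (k-clique λ ()) (k-clique λ ()) (k-clique λ ()))

      k≢ : ∀ {v} i → v ∉ D → k i ≢ v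
      k≢ i v∉ refl = v∉ (∈-tabulate⁺ {f = k} i)

      -- Two vertices attached to the same or to at most one vertex of the triangle share
      -- a neighbour in it or avoid one of its edges.
      triangle-form : ∀ (H : List V) → (∀ i → k i ∈ H) →
        (∀ {u v i j} → u ∉ D → v ∉ D → i ≢ j → u ~ k i → v ~ k j → Form H u v) →
        ∀ {u v} → u ∉ D → v ∉ D → Form H u v
      triangle-form H k∈H mixed {u} {v} u∉ v∉ with Finₚ.any? (λ i → u ~? k i) | Finₚ.any? (λ j → v ~? k j)
      ... | yes (i , ui) | yes (j , vj) with i ≟ j
      ...   | yes refl = shared (k∈H i) ui vj
      ...   | no i≢j   = mixed u∉ v∉ i≢j ui vj
      triangle-form H k∈H mixed {u} {v} u∉ v∉ | no none | _ with at-most-one k (one {v} v∉)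
      ... | a , fa with others a
      ...   | i , j , i≢j , ia , ja , _ = avoided (k∈H i) (k∈H j) (k-clique i≢j)
                (¬~⇒≁ λ p → none (_ , p)) (¬~⇒≁ λ p → none (_ , p)) (fa ia) (fa ja)
      triangle-form H k∈H mixed {u} {v} u∉ v∉ | yes _ | no none with at-most-one k (one {u} u∉)
      ... | a , fa with others a
      ...   | i , j , i≢j , ia , ja , _ = avoided (k∈H i) (k∈H j) (k-clique i≢j)
                (fa ia) (fa ja) (¬~⇒≁ λ p → none (_ , p)) (¬~⇒≁ λ p → none (_ , p))

      other : ∀ {v i j} → v ∉ D → v ~ k i → j ≢ i → v ≁ k j
      other v∉ vi j≢i = ¬~⇒≁ λ vj → j≢i (one v∉ vj vi)

      -- If `u` and `v` see different triangle vertices, the private neighbour `a l` of the third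
      -- one decides: seen by both it is shared, seen by neither its edge to `k l` is avoided, and
      -- seen by one it is opposed to the triangle neighbour of the other.
      net-case : (a : Fin 3 → V) → (∀ i → a i ∉ D) → (∀ i → a i ~ k i) →
                 Decomposable G ((3 + nh-tests 6) + 6) (nh-size 6)
      net-case a a∉ ak = nh H D K₄-free⇒K₅-free (triangle-form H k∈ mixed) (λ _ → no-K₄) ℕₚ.≤-refl refl
        where
        H : List V
        H = List.tabulate k ++ List.tabulate a
        k∈ : ∀ i → k i ∈ H
        k∈ i = ∈-++⁺ˡ (∈-tabulate⁺ {f = k} i)
        a∈ : ∀ i → a i ∈ H
        a∈ i = ∈-++⁺ʳ (List.tabulate k) (∈-tabulate⁺ {f = a} i)
        mixed : ∀ {u v i j} → u ∉ D → v ∉ D → i ≢ j → u ~ k i → v ~ k j → Form H u v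
        mixed {u} {v} {i} {j} u∉ v∉ i≢j ui vj with third i j
        ... | l , l≢i , l≢j with adjacent? u (a l) | adjacent? v (a l)
        ...   | inj₁ p | inj₁ q = shared (a∈ l) p q
        ...   | inj₂ p | inj₂ q = avoided (k∈ l) (a∈ l) (~-sym (ak l)) (other u∉ ui l≢i) p (other v∉ vj l≢j) q
        ...   | inj₁ p | inj₂ q = opposed′ (a∈ l) (k∈ j) p q vj (other u∉ ui (≢-sym i≢j)) (other (a∉ l) (ak l) (≢-sym l≢j))
        ...   | inj₂ p | inj₁ q = opposed′ (k∈ i) (a∈ l) ui (other v∉ vj i≢j) q p (≁-sym (other (a∉ l) (ak l) (≢-sym l≢i)))

      far-edge-case : ∀ {b b′} → b ~ b′ → (∀ i → b ≁ k i) → (∀ i → b′ ≁ k i) →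
                      Decomposable G ((3 + nh-tests 5) + 5) (nh-size 5)
      far-edge-case {b} {b′} bb′ bk b′k =
        nh H D K₄-free⇒K₅-free (triangle-form H k∈ mixed) (λ _ → no-K₄) ℕₚ.≤-refl refl
        where
        H : List V
        H = List.tabulate k ++ (b ∷ b′ ∷ [])
        k∈ : ∀ i → k i ∈ H
        k∈ i = ∈-++⁺ˡ (∈-tabulate⁺ {f = k} i)
        b∈ : b ∈ H
        b∈ = ∈-++⁺ʳ (List.tabulate k) (here refl)
        b′∈ : b′ ∈ H
        b′∈ = ∈-++⁺ʳ (List.tabulate k) (there (here refl))
        -- Otherwise the edge `b b′` and the path through `k j`, `k i` and `u` form a P₂+P₃.
        hit : ∀ {u i j} → u ∉ D → i ≢ j → u ~ k i → u ≁ b → u ≁ b′ → ⊥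
        hit {u} {i} {j} u∉ i≢j ui ub ub′ = P₂+P₃-free bb′ (k-clique (≢-sym i≢j)) (~-sym ui) (k≢ j u∉)
          (≁-sym (other u∉ ui (≢-sym i≢j))) (bk j) (bk i) (≁-sym ub) (b′k j) (b′k i) (≁-sym ub′)
        mixed : ∀ {u v i j} → u ∉ D → v ∉ D → i ≢ j → u ~ k i → v ~ k j → Form H u v
        mixed {u} {v} {i} {j} u∉ v∉ i≢j ui vj with adjacent? u b | adjacent? u b′ | adjacent? v b | adjacent? v b′
        ... | inj₁ p | _      | inj₁ q | _      = shared b∈ p q
        ... | inj₁ p | _      | inj₂ q | _      = opposed′ b∈ (k∈ j) p q vj (other u∉ ui (≢-sym i≢j)) (bk j)
        ... | inj₂ _ | inj₁ p | _      | inj₁ q = shared b′∈ p q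
        ... | inj₂ _ | inj₁ p | _      | inj₂ q = opposed′ b′∈ (k∈ j) p q vj (other u∉ ui (≢-sym i≢j)) (b′k j)
        ... | inj₂ p | inj₂ q | _      | _      = ⊥-elim (hit u∉ i≢j ui p q)

-- Graphs without K₄, induced C₅ and tripods

module SparseCases (G : Graph) (no-diamond : Free diamond G) (no-P₂+P₃ : Free P₂+P₃ G) where

  open Forbidden G no-diamond no-P₂+P₃
  open Decomposition G
  open Cliques G
  open Bipartite G no-diamond no-P₂+P₃
  open NearHomogeneous G no-diamond no-P₂+P₃ using (apex!)

  C₅-free Triangle-free : Set
  C₅-free = ∀ {a b c d e} → a ~ b → b ~ c → c ~ d → d ~ e → e ~ a →
            a ≁ c → a ≁ d → b ≁ d → b ≁ e → c ≁ e → ⊥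
  Triangle-free = ∀ {a b c} → a ~ b → b ~ c → a ~ c → ⊥

  open DecMembership (_≟_ {n G}) using (_∈?_)

  split-triple : ∀ {T} {S : V → Set} → Decidable S → (φ : V → V → Bool) →
    (∀ {u u′ w w′} → Agree T u u′ → Agree T w w′ → φ u w ≡ φ u′ w′) →
    ∀ x y z → S x → (∀ {u w} → S u → u ∈ x ∷ y ∷ z ∷ [] → S w → w ∉ x ∷ y ∷ z ∷ [] → adj G u w ≡ φ u w) →
    Good G 3 T S
  split-triple {S = S} S? φ φ-resp x y z sx adj≡φ with Finₚ.any? (λ w → S? w ×-dec ¬? (w ∈? (x ∷ y ∷ z ∷ [])))
  ... | yes out = split φ φ-resp (_∈? (x ∷ y ∷ z ∷ [])) (x , sx , here refl) out adj≡φ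
  ... | no none = inj₁ (list⇒small (x ∷ y ∷ z ∷ []) ℕₚ.≤-refl λ {v} sv →
          decidable-stable (v ∈? (x ∷ y ∷ z ∷ [])) λ v∉ → none (v , sv , v∉))

  module OneSided (no-K₄ : K₄-free) (no-C₅ : C₅-free) (Out : V → Set) (Out? : Decidable Out)
    (k₁ k₂ k₃ : V) (k₁k₂ : k₁ ~ k₂) (k₁k₃ : k₁ ~ k₃) (k₂k₃ : k₂ ~ k₃)
    (≢k₁ : ∀ {v} → Out v → v ≢ k₁) (≢k₃ : ∀ {v} → Out v → v ≢ k₃)
    (≁k₃ : ∀ {v} → Out v → v ≁ k₃)
    (B-indep : ∀ {u w} → Out u → Out w → u ≁ k₁ → u ≁ k₂ → w ≁ k₁ → w ≁ k₂ → u ≁ w) where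

    A₁ A₂ B : V → Set
    A₁ v = Out v × v ~ k₁
    A₂ v = Out v × v ~ k₂
    B  v = Out v × v ≁ k₁ × v ≁ k₂

    A₁≁k₂ : ∀ {v} → A₁ v → v ≁ k₂
    A₁≁k₂ (o , vk₁) = ¬~⇒≁ λ vk₂ → ≢k₃ o (apex! no-K₄ k₁k₂ vk₁ vk₂ (~-sym k₁k₃) (~-sym k₂k₃))

    A₂≁k₁ : ∀ {v} → A₂ v → v ≁ k₁
    A₂≁k₁ (o , vk₂) = ¬~⇒≁ λ vk₁ → ~-≁ vk₂ (A₁≁k₂ (o , vk₁))

    A₁B-closed : P₃-closed (λ v → Out v × v ≁ k₂)
    A₁B-closed = anticomplete⇒P₃-closed k₂k₃ λ (o , p) → ≁-sym p , ≁-sym (≁k₃ o)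

    A₂B-closed : P₃-closed (λ v → Out v × v ≁ k₁)
    A₂B-closed = anticomplete⇒P₃-closed k₁k₃ λ (o , p) → ≁-sym p , ≁-sym (≁k₃ o)

    -- The edge `p q` already has the apex `k₁`.
    edge-apex : ∀ {p q v} → A₁ p → A₁ q → p ~ q → Out v → v ~ p → v ~ q → ⊥
    edge-apex (_ , pk₁) (_ , qk₁) pq o vp vq = ≢k₁ o (apex! no-K₄ pq vp vq (~-sym pk₁) (~-sym qk₁))

    -- Otherwise the edge `p q` and the path `k₃ k₂ a` form a P₂+P₃.
    edge-hits : ∀ {p q a} → A₁ p → A₁ q → p ~ q → A₂ a → a ~ p ⊎ a ~ q
    edge-hits {p} {q} {a} P Q pq A with adjacent? a p | adjacent? a q
    ... | inj₁ x | _      = inj₁ x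
    ... | _      | inj₁ y = inj₂ y
    ... | inj₂ x | inj₂ y = ⊥-elim (P₂+P₃-free pq (~-sym k₂k₃) (~-sym (proj₂ A))
            (≢-sym (≢k₃ (proj₁ A))) (≁-sym (≁k₃ (proj₁ A)))
            (≁k₃ (proj₁ P)) (A₁≁k₂ P) (≁-sym x) (≁k₃ (proj₁ Q)) (A₁≁k₂ Q) (≁-sym y))

    -- Otherwise `p q y k₂ x` is an induced C₅.
    cross-complete : ∀ {p q x y} → A₁ p → A₁ q → p ~ q → A₂ x → A₂ y → x ~ p → y ~ q → x ~ y
    cross-complete {p} {q} {x} {y} P Q pq X Y xp yq with adjacent? x y
    ... | inj₁ e = e
    ... | inj₂ e = ⊥-elim (no-C₅ pq (~-sym yq) (proj₂ Y) (~-sym (proj₂ X)) xp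
            (≁-sym (¬~⇒≁ λ yp → edge-apex P Q pq (proj₁ Y) yp yq)) (A₁≁k₂ P) (A₁≁k₂ Q)
            (≁-sym (¬~⇒≁ λ xq → edge-apex P Q pq (proj₁ X) xp xq)) (≁-sym e))

    A₂-tr : ∀ {x y z} → A₂ x → A₂ y → A₂ z → x ~ y → y ~ z → x ≢ z → x ~ z
    A₂-tr X Y Z = A₂B-closed (proj₁ X , A₂≁k₁ X) (proj₁ Y , A₂≁k₁ Y) (proj₁ Z , A₂≁k₁ Z)

    -- If both p and q had neighbours in A₂, these neighbourhoods would be complete to each other and A₂ a clique.
    edge-full : ∀ {p q w w′} → A₁ p → A₁ q → p ~ q → A₂ w → A₂ w′ → w ≢ w′ → w ≁ w′ → w ~ p →
                ∀ {a} → A₂ a → a ~ p × a ≁ q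
    edge-full {p} {q} {w} {w′} P Q pq W W′ w≢w′ ww′ wp {a} A with edge-hits P Q pq A
    ... | inj₁ ap = ap , ¬~⇒≁ λ aq → edge-apex P Q pq (proj₁ A) ap aq
    ... | inj₂ aq with edge-hits P Q pq W′
    ...   | inj₂ w′q = ⊥-elim (~-≁ (cross-complete P Q pq W W′ wp w′q) ww′)
    ...   | inj₁ w′p = ⊥-elim (~-≁ (A₂-tr W A W′ (cross-complete P Q pq W A wp aq)
                         (~-sym (cross-complete P Q pq W′ A w′p aq)) w≢w′) ww′)

    -- Closure would give `b ~ q`, and then `b` is a second apex of the edge `a q`.
    B-nbr-isolated : ∀ {b a q} → B b → A₁ a → A₁ q → b ~ a → a ~ q → ⊥
    B-nbr-isolated {b} {a} {q} (bo , bk₁ , bk₂) A Q ba aq = edge-apex A Q aq bo ba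
      (A₁B-closed (bo , bk₂) (proj₁ A , A₁≁k₂ A) (proj₁ Q , A₁≁k₂ Q) ba aq (≁-~⇒≢ bk₁ (proj₂ Q)))

    B-one-nbr : ∀ {b a a′} → B b → A₁ a → A₁ a′ → b ~ a → b ~ a′ → a ≡ a′
    B-one-nbr {b} {a} {a′} Bb A A′ ba ba′ with a ≟ a′
    ... | yes e = e
    ... | no a≢a′ = ⊥-elim (B-nbr-isolated Bb A A′ ba
            (A₁B-closed (proj₁ A , A₁≁k₂ A) (proj₁ Bb , proj₂ (proj₂ Bb)) (proj₁ A′ , A₁≁k₂ A′) (~-sym ba) ba′ a≢a′))

    A₁-one-B : ∀ {b b′ a} → B b → B b′ → A₁ a → b ~ a → b′ ~ a → b ≡ b′
    A₁-one-B {b} {b′} {a} (bo , bk₁ , bk₂) (bo′ , bk₁′ , bk₂′) A ba ba′ with b ≟ b′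
    ... | yes e = e
    ... | no b≢b′ = ⊥-elim (~-≁ (A₁B-closed (bo , bk₂) (proj₁ A , A₁≁k₂ A) (bo′ , bk₂′) ba (~-sym ba′) b≢b′)
            (B-indep bo bo′ bk₁ bk₂ bk₁′ bk₂′))

    -- Otherwise `b a₁ k₁ k₂ a₂` is an induced C₅.
    triangle-edge : ∀ {b a₁ a₂} → B b → A₁ a₁ → A₂ a₂ → b ~ a₁ → b ~ a₂ → a₁ ~ a₂
    triangle-edge {b} {a₁} {a₂} (bo , bk₁ , bk₂) A A′ ba₁ ba₂ with adjacent? a₁ a₂
    ... | inj₁ e = e
    ... | inj₂ e = ⊥-elim (no-C₅ ba₁ (proj₂ A) k₁k₂ (~-sym (proj₂ A′)) (~-sym ba₂)
            bk₁ bk₂ (A₁≁k₂ A) e (≁-sym (A₂≁k₁ A′)))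

    -- Otherwise the edge `b a₁` is anticomplete to the path `k₃ k₂ a`.
    triangle-full : ∀ {b a₁ a₂} → B b → A₁ a₁ → A₂ a₂ → b ~ a₁ → b ~ a₂ → (∀ {a} → A₂ a → b ~ a → a ≡ a₂) →
           ∀ {a} → A₂ a → a₁ ~ a
    triangle-full {b} {a₁} {a₂} Bb@(bo , bk₁ , bk₂) X Y ba₁ ba₂ uniq {a} A with adjacent? a₁ a | adjacent? b a
    ... | inj₁ e | _ = e
    ... | inj₂ _ | inj₁ ba rewrite uniq A ba = triangle-edge Bb X Y ba₁ ba₂
    ... | inj₂ e | inj₂ ba = ⊥-elim (P₂+P₃-free ba₁ (~-sym k₂k₃) (~-sym (proj₂ A)) (≢-sym (≢k₃ (proj₁ A)))
            (≁-sym (≁k₃ (proj₁ A))) (≁k₃ bo) bk₂ ba (≁k₃ (proj₁ X)) (A₁≁k₂ X) e)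

    A₁? : Decidable A₁
    A₁? v = Out? v ×-dec (v ~? k₁)

    A₂? : Decidable A₂
    A₂? v = Out? v ×-dec (v ~? k₂)

    Nbr₂? : ∀ v → Dec (∃ λ a → A₂ a × v ~ a)
    Nbr₂? v = Finₚ.any? λ a → A₂? a ×-dec (v ~? a)

    nbr₂ : V → Bool
    nbr₂ v = ⌊ Nbr₂? v ⌋

    module _ {T : List (V → Bool)} (nbr₂∈T : nbr₂ ∈ T) (k₂∈T : adj G k₂ ∈ T)
             {S : V → Set} (S? : Decidable S) (S⊆Out : ∀ {v} → S v → Out v) where

      -- Towards the rest of `S`, `p` behaves like `k₂` and `q` has no neighbours, by `edge-full`
      -- and closure; the test `nbr₂` tells `p` from `q`. The triple lists `q` twice because only
      -- two vertices are split off.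
      split-edge : ∀ {p q y y′} → S p → A₁ p → A₁ q → p ~ q →
                   A₂ y → A₂ y′ → y ≢ y′ → y ≁ y′ → y ~ p → Good G 3 T S
      split-edge {p} {q} {y} {y′} sp Ap Aq pq Y Y′ y≢y′ yy′ yp =
        split-triple S? (λ u w → nbr₂ u ∧ adj G k₂ w)
          (λ a b → cong₂ _∧_ (agree-at nbr₂∈T a) (agree-at k₂∈T b))
          p q q sp cross
        where
        full : ∀ {a} → A₂ a → a ~ p × a ≁ q
        full = edge-full Ap Aq pq Y Y′ y≢y′ yy′ yp
        off : ∀ {w} → S w → w ≢ p → w ≢ q → w ≁ k₂ → w ≁ p × w ≁ q
        off sw w≢p w≢q wk₂ =
          ¬~⇒≁ (λ wp → edge-apex Ap Aq pq (S⊆Out sw) wp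
            (A₁B-closed (S⊆Out sw , wk₂) (proj₁ Ap , A₁≁k₂ Ap) (proj₁ Aq , A₁≁k₂ Aq) wp pq w≢q)) ,
          ¬~⇒≁ (λ wq → edge-apex Ap Aq pq (S⊆Out sw)
            (A₁B-closed (S⊆Out sw , wk₂) (proj₁ Aq , A₁≁k₂ Aq) (proj₁ Ap , A₁≁k₂ Ap) wq (~-sym pq) w≢p) wq)
        nbr₂p : nbr₂ p ≡ true
        nbr₂p = ⌊⌋-true (Nbr₂? p) (y , Y , ~-sym yp)
        nbr₂q : nbr₂ q ≡ false
        nbr₂q = ⌊⌋-false (Nbr₂? q) λ (a , A , qa) → ~-≁ (~-sym qa) (proj₂ (full A))
        cross-p : ∀ {w} → S w → w ≢ p → w ≢ q → adj G p w ≡ adj G k₂ w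
        cross-p {w} sw w≢p w≢q with adjacent? w k₂
        ... | inj₁ e = trans (~-sym (proj₁ (full (S⊆Out sw , e)))) (sym (~-sym e))
        ... | inj₂ e = trans (≁-sym (proj₁ (off sw w≢p w≢q e))) (sym (≁-sym e))
        cross-q : ∀ {w} → S w → w ≢ p → w ≢ q → q ≁ w
        cross-q {w} sw w≢p w≢q with adjacent? w k₂
        ... | inj₁ e = ≁-sym (proj₂ (full (S⊆Out sw , e)))
        ... | inj₂ e = ≁-sym (proj₂ (off sw w≢p w≢q e))
        cross : ∀ {u w} → S u → u ∈ p ∷ q ∷ q ∷ [] → S w → w ∉ p ∷ q ∷ q ∷ [] → adj G u w ≡ nbr₂ u ∧ adj G k₂ w
        cross {w = w} su (here refl) sw w∉ = trans (cross-p sw (w∉ ∘ here) (w∉ ∘ there ∘ here))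
          (sym (cong (_∧ adj G k₂ w) nbr₂p))
        cross {w = w} su (there (here refl)) sw w∉ = trans (cross-q sw (w∉ ∘ here) (w∉ ∘ there ∘ here))
          (sym (cong (_∧ adj G k₂ w) nbr₂q))
        cross {w = w} su (there (there (here refl))) sw w∉ = trans (cross-q sw (w∉ ∘ here) (w∉ ∘ there ∘ here))
          (sym (cong (_∧ adj G k₂ w) nbr₂q))

  module NoTripod (no-K₄ : K₄-free) (no-K₅ : K₅-free) (no-C₅ : C₅-free)
    (k₁ k₂ k₃ : V) (k₁k₂ : k₁ ~ k₂) (k₁k₃ : k₁ ~ k₃) (k₂k₃ : k₂ ~ k₃)
    (A₃-empty : ∀ {v} → v ≢ k₁ → v ≢ k₂ → v ≢ k₃ → v ≁ k₃)
    (B-indep′ : ∀ {u w} → u ≁ k₁ → u ≁ k₂ → u ≁ k₃ → w ≁ k₁ → w ≁ k₂ → w ≁ k₃ → u ≁ w) where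

    D : List V
    D = k₁ ∷ k₂ ∷ k₃ ∷ []

    Out : V → Set
    Out v = v ≢ k₁ × v ≢ k₂ × v ≢ k₃

    Out? : Decidable Out
    Out? v = ¬? (v ≟ k₁) ×-dec ¬? (v ≟ k₂) ×-dec ¬? (v ≟ k₃)

    ≁k₃ : ∀ {v} → Out v → v ≁ k₃
    ≁k₃ (a , b , c) = A₃-empty a b c

    module L = OneSided no-K₄ no-C₅ Out Out? k₁ k₂ k₃ k₁k₂ k₁k₃ k₂k₃ proj₁ (proj₂ ∘ proj₂) ≁k₃
      (λ uo wo a b c d → B-indep′ a b (≁k₃ uo) c d (≁k₃ wo))
    module R = OneSided no-K₄ no-C₅ Out Out? k₂ k₁ k₃ (~-sym k₁k₂) k₂k₃ k₁k₃ (proj₁ ∘ proj₂) (proj₂ ∘ proj₂) ≁k₃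
      (λ uo wo a b c d → B-indep′ b a (≁k₃ uo) d c (≁k₃ wo))

    open L using (A₁; A₂; B; A₁?; A₂?; A₁≁k₂; A₂≁k₁)

    B? : Decidable B
    B? v = Out? v ×-dec (v ≁? k₁) ×-dec (v ≁? k₂)

    kind : ∀ {v} → Out v → A₁ v ⊎ A₂ v ⊎ B v
    kind {v} o with adjacent? v k₁ | adjacent? v k₂
    ... | inj₁ p | _      = inj₁ (o , p)
    ... | inj₂ _ | inj₁ q = inj₂ (inj₁ (o , q))
    ... | inj₂ p | inj₂ q = inj₂ (inj₂ (o , p , q))

    swapB : ∀ {v} → B v → R.B v
    swapB (o , p , q) = o , q , p

    -- The intended bipartition: `A₂` and the part of `B` attached to `A₁` against everything else.
    -- Neighbours are taken in the whole graph, so that one test serves all sets `S`.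
    Side? : ∀ v → Dec (v ~ k₂ ⊎ (v ≁ k₁ × ∃ λ a → A₁ a × v ~ a))
    Side? v = (v ~? k₂) ⊎-dec ((v ≁? k₁) ×-dec R.Nbr₂? v)

    side : V → Bool
    side v = ⌊ Side? v ⌋

    T : List (V → Bool)
    T = adj G k₁ ∷ adj G k₂ ∷ L.nbr₂ ∷ R.nbr₂ ∷ side ∷ []

    module _ (x₁ x₂ : V) (X₁ : A₁ x₁) (X₂ : A₁ x₂) (x₁≢x₂ : x₁ ≢ x₂) (x₁x₂ : x₁ ≁ x₂)
             (y₁ y₂ : V) (Y₁ : A₂ y₁) (Y₂ : A₂ y₂) (y₁≢y₂ : y₁ ≢ y₂) (y₁y₂ : y₁ ≁ y₂) where

      module _ {S : V → Set} (S? : Decidable S) (S⊆Out : ∀ {v} → S v → Out v) where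

        -- Towards the rest of `S`, `a₁` behaves like `k₂`, `a₂` like `k₁`, and `b` has no
        -- neighbours.
        split-triangle : ∀ {b a₁ a₂} → S b → B b → A₁ a₁ → A₂ a₂ → b ~ a₁ → b ~ a₂ → Good G 3 T S
        split-triangle {b} {a₁} {a₂} sb Bb X Y ba₁ ba₂ =
          split-triple S? (λ u w → (adj G k₁ u ∧ adj G k₂ w) ∨ (adj G k₂ u ∧ adj G k₁ w))
            (λ p q → cong₂ _∨_
              (cong₂ _∧_ (agree-at {T} (here refl) p) (agree-at {T} (there (here refl)) q))
              (cong₂ _∧_ (agree-at {T} (there (here refl)) p) (agree-at {T} (here refl) q)))
            b a₁ a₂ sb cross
          where
          φ-eq : ∀ {u w x y} → adj G k₁ u ≡ x → adj G k₂ u ≡ y →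
                 adj G u w ≡ (x ∧ adj G k₂ w) ∨ (y ∧ adj G k₁ w) →
                 adj G u w ≡ (adj G k₁ u ∧ adj G k₂ w) ∨ (adj G k₂ u ∧ adj G k₁ w)
          φ-eq {w = w} p q e = trans e (sym (cong₂ (λ x y → (x ∧ adj G k₂ w) ∨ (y ∧ adj G k₁ w)) p q))
          b-off : ∀ {w} → Out w → w ≢ a₁ → w ≢ a₂ → b ≁ w
          b-off {w} wo w≢a₁ w≢a₂ = ¬~⇒≁ λ bw → [ (λ A → w≢a₁ (L.B-one-nbr Bb A X bw ba₁))
            , [ (λ A → w≢a₂ (R.B-one-nbr (swapB Bb) A Y bw ba₂))
              , (λ Bw → ~-≁ bw (B-indep′ (proj₁ (proj₂ Bb)) (proj₂ (proj₂ Bb)) (≁k₃ (proj₁ Bb))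
                                  (proj₁ (proj₂ Bw)) (proj₂ (proj₂ Bw)) (≁k₃ wo))) ] ] (kind wo)
          a₁-adj : ∀ {w} → Out w → w ≢ b → adj G a₁ w ≡ adj G k₂ w
          a₁-adj {w} wo w≢b with kind wo
          ... | inj₁ A = trans (¬~⇒≁ λ e → L.B-nbr-isolated Bb X A ba₁ e) (sym (≁-sym (A₁≁k₂ A)))
          ... | inj₂ (inj₁ A) = trans (L.triangle-full Bb X Y ba₁ ba₂ (λ A ba → R.B-one-nbr (swapB Bb) A Y ba ba₂) A)
                  (sym (~-sym (proj₂ A)))
          ... | inj₂ (inj₂ Bw) = trans (¬~⇒≁ λ e → w≢b (L.A₁-one-B Bw Bb X (~-sym e) ba₁)) (sym (≁-sym (proj₂ (proj₂ Bw))))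
          a₂-adj : ∀ {w} → Out w → w ≢ b → adj G a₂ w ≡ adj G k₁ w
          a₂-adj {w} wo w≢b with kind wo
          ... | inj₂ (inj₁ A) = trans (¬~⇒≁ λ e → R.B-nbr-isolated (swapB Bb) Y A ba₂ e) (sym (≁-sym (A₂≁k₁ A)))
          ... | inj₁ A = trans (R.triangle-full (swapB Bb) Y X ba₂ ba₁ (λ A ba → L.B-one-nbr Bb A X ba ba₁) A)
                  (sym (~-sym (proj₂ A)))
          ... | inj₂ (inj₂ Bw) = trans (¬~⇒≁ λ e → w≢b (R.A₁-one-B (swapB Bw) (swapB Bb) Y (~-sym e) ba₂))
                  (sym (≁-sym (proj₁ (proj₂ Bw))))
          cross : ∀ {u w} → S u → u ∈ b ∷ a₁ ∷ a₂ ∷ [] → S w → w ∉ b ∷ a₁ ∷ a₂ ∷ [] →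
                  adj G u w ≡ (adj G k₁ u ∧ adj G k₂ w) ∨ (adj G k₂ u ∧ adj G k₁ w)
          cross {u} {w} su (here refl) sw w∉ = φ-eq {u} {w} (≁-sym (proj₁ (proj₂ Bb))) (≁-sym (proj₂ (proj₂ Bb)))
            (b-off (S⊆Out sw) (w∉ ∘ there ∘ here) (w∉ ∘ there ∘ there ∘ here))
          cross {u} {w} su (there (here refl)) sw w∉ = φ-eq {u} {w} (~-sym (proj₂ X)) (≁-sym (A₁≁k₂ X))
            (trans (a₁-adj (S⊆Out sw) (w∉ ∘ here)) (sym (∨-identityʳ _)))
          cross {u} {w} su (there (there (here refl))) sw w∉ = φ-eq {u} {w} (≁-sym (A₂≁k₁ Y)) (~-sym (proj₂ Y))
            (a₂-adj (S⊆Out sw) (w∉ ∘ here))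

        good : ∃ S → Good G 3 T S
        good ne with Finₚ.any? (λ p → Finₚ.any? λ q → S? p ×-dec S? q ×-dec A₁? p ×-dec A₁? q ×-dec (p ~? q))
        ... | yes (p , q , sp , sq , Ap , Aq , pq) with L.edge-hits Ap Aq pq Y₁
        ...   | inj₁ y₁p = L.split-edge {T} (there (there (here refl))) (there (here refl)) S? S⊆Out
                  sp Ap Aq pq Y₁ Y₂ y₁≢y₂ y₁y₂ y₁p
        ...   | inj₂ y₁q = L.split-edge {T} (there (there (here refl))) (there (here refl)) S? S⊆Out
                  sq Aq Ap (~-sym pq) Y₁ Y₂ y₁≢y₂ y₁y₂ y₁q
        good ne | no none₁
          with Finₚ.any? (λ p → Finₚ.any? λ q → S? p ×-dec S? q ×-dec A₂? p ×-dec A₂? q ×-dec (p ~? q))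
        ... | yes (p , q , sp , sq , Ap , Aq , pq) with R.edge-hits Ap Aq pq X₁
        ...   | inj₁ x₁p = R.split-edge {T} (there (there (there (here refl)))) (here refl) S? S⊆Out
                  sp Ap Aq pq X₁ X₂ x₁≢x₂ x₁x₂ x₁p
        ...   | inj₂ x₁q = R.split-edge {T} (there (there (there (here refl)))) (here refl) S? S⊆Out
                  sq Aq Ap (~-sym pq) X₁ X₂ x₁≢x₂ x₁x₂ x₁q
        -- Only `b` is required to lie in `S`, since `side` refers to neighbours in the whole graph.
        good ne | no none₁ | no none₂
          with Finₚ.any? (λ b → Finₚ.any? λ a₁ → Finₚ.any? λ a₂ →
                 S? b ×-dec B? b ×-dec A₁? a₁ ×-dec A₂? a₂ ×-dec (b ~? a₁) ×-dec (b ~? a₂))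
        ... | yes (b , a₁ , a₂ , sb , Bb , X , Y , p , q) = split-triangle sb Bb X Y p q
        ... | no none = bipartite⇒good S? side (there (there (there (there (here refl))))) indep ne
          where
          data Kind (v : V) : Bool → Set where
            a₁ : A₁ v → Kind v false
            a₂ : A₂ v → Kind v true
            b₁ : B v → (∀ {a} → A₁ a → v ≁ a) → Kind v false
            b₂ : B v → (∃ λ a → A₁ a × v ~ a) → Kind v true
          classify : ∀ {v} → S v → Kind v (side v)
          classify {v} sv with kind (S⊆Out sv) | Side? v
          ... | inj₁ A | yes (inj₁ p) = ⊥-elim (~-≁ p (A₁≁k₂ A))
          ... | inj₁ A | yes (inj₂ (p , _)) = ⊥-elim (~-≁ (proj₂ A) p)
          ... | inj₁ A | no _ = a₁ A
          ... | inj₂ (inj₁ A) | yes _ = a₂ A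
          ... | inj₂ (inj₁ A) | no ¬s = ⊥-elim (¬s (inj₁ (proj₂ A)))
          ... | inj₂ (inj₂ Bv) | yes (inj₁ p) = ⊥-elim (~-≁ p (proj₂ (proj₂ Bv)))
          ... | inj₂ (inj₂ Bv) | yes (inj₂ (_ , nb)) = b₂ Bv nb
          ... | inj₂ (inj₂ Bv) | no ¬s = b₁ Bv λ {a} A → ¬~⇒≁ λ va → ¬s (inj₂ (proj₁ (proj₂ Bv) , a , A , va))
          BB : ∀ {u w} → B u → B w → u ≁ w
          BB (uo , p , q) (wo , r , s) = B-indep′ p q (≁k₃ uo) r s (≁k₃ wo)
          indep′ : ∀ {u w x} → S u → S w → Kind u x → Kind w x → u ≁ w
          indep′ su sw (a₁ U) (a₁ W) = ¬~⇒≁ λ e → none₁ (_ , _ , su , sw , U , W , e)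
          indep′ su sw (a₂ U) (a₂ W) = ¬~⇒≁ λ e → none₂ (_ , _ , su , sw , U , W , e)
          indep′ su sw (a₁ U) (b₁ W f) = ≁-sym (f U)
          indep′ su sw (b₁ U f) (a₁ W) = f W
          indep′ su sw (a₂ U) (b₂ W (a , A , wa)) = ¬~⇒≁ λ e → none (_ , _ , _ , sw , W , A , U , wa , ~-sym e)
          indep′ su sw (b₂ U (a , A , ua)) (a₂ W) = ¬~⇒≁ λ e → none (_ , _ , _ , su , U , A , W , ua , e)
          indep′ su sw (b₁ U _) (b₁ W _) = BB U W
          indep′ su sw (b₂ U _) (b₂ W _) = BB U W
          indep : ∀ {u w} → S u → S w → side u ≡ side w → u ≁ w
          indep {u} {w} su sw eq = indep′ su sw (classify su) (subst (Kind w) (sym eq) (classify sw))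

    clique-side : ∀ (A : V → Set) → Decidable A →
      (∀ {u v} → A u → A v → u ≢ v → u ~ v) ⊎ (∃ λ u → ∃ λ v → A u × A v × u ≢ v × u ≁ v)
    clique-side A A? with Finₚ.any? (λ u → Finₚ.any? λ v → A? u ×-dec A? v ×-dec ¬? (u ≟ v) ×-dec (u ≁? v))
    ... | yes w = inj₂ w
    ... | no none = inj₁ λ {u} {v} Au Av u≢v →
            decidable-stable (u ~? v) λ ¬p → none (u , v , Au , Av , u≢v , ¬~⇒≁ ¬p)

    out : ∀ {v} (xs : List V) → v ∉ D ++ xs → Out v
    out xs v∉ = v∉ ∘ here , v∉ ∘ there ∘ here , v∉ ∘ there ∘ there ∘ here

    -- The clique has at most four vertices, which with the triangle makes seven deletions.
    remove-clique : ∀ {A : V → Set} → Decidable A → (∀ {u v} → A u → A v → u ≢ v → u ~ v) →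
      P₃-closed (λ v → Out v × ¬ A v) → Decomposable G (7 + 5) 3
    remove-clique {A} A? clique closed with clique-cover no-K₅ A? clique
    ... | xs , xs≤ , cov = delete (D ++ xs) (s≤s (s≤s (s≤s xs≤))) T ℕₚ.≤-refl λ S? ne S∌ →
            P₃-closed⇒good S? ne λ sa sb sc → closed (m S∌ sa) (m S∌ sb) (m S∌ sc)
      where
      m : ∀ {S : V → Set} → (∀ {v} → S v → v ∉ D ++ xs) → ∀ {v} → S v → Out v × ¬ A v
      m S∌ sv = out xs (S∌ sv) , λ Av → S∌ sv (there (there (there (cov Av))))

    -- If `A₁` is a clique, its deletion leaves the edge `k₁ k₃` anticomplete to the rest, and
    -- similarly for `A₂`. Otherwise both contain a nonadjacent pair, as `edge-full` requires.
    no-tripod-case : Decomposable G (7 + 5) 3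
    no-tripod-case with clique-side A₁ A₁? | clique-side A₂ A₂?
    ... | inj₁ c | _ = remove-clique A₁? c λ a b c → L.A₂B-closed (f a) (f b) (f c)
      where
      f : ∀ {v} → Out v × ¬ A₁ v → Out v × v ≁ k₁
      f (o , ¬A) = o , ¬~⇒≁ λ p → ¬A (o , p)
    ... | inj₂ _ | inj₁ c = remove-clique A₂? c λ a b c → L.A₁B-closed (f a) (f b) (f c)
      where
      f : ∀ {v} → Out v × ¬ A₂ v → Out v × v ≁ k₂
      f (o , ¬A) = o , ¬~⇒≁ λ p → ¬A (o , p)
    ... | inj₂ (x₁ , x₂ , X₁ , X₂ , x≢ , x≁) | inj₂ (y₁ , y₂ , Y₁ , Y₂ , y≢ , y≁) =
            delete {d = 7} D (s≤s (s≤s (s≤s z≤n))) T ℕₚ.≤-refl λ S? ne S∌ →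
              good x₁ x₂ X₁ X₂ x≢ x≁ y₁ y₂ Y₁ Y₂ y≢ y≁ S? (λ sv → out [] (S∌ sv)) ne

-- Triangle-free graphs without an induced C₅

module TriangleFreeCase (G : Graph) (no-diamond : Free diamond G) (no-P₂+P₃ : Free P₂+P₃ G) where

  open Forbidden G no-diamond no-P₂+P₃
  open Decomposition G
  open Bipartite G no-diamond no-P₂+P₃
  open SparseCases G no-diamond no-P₂+P₃ using (C₅-free; Triangle-free)

  module _ (no-△ : Triangle-free) (no-C₅ : C₅-free) (k₁ k₂ : V) (k₁k₂ : k₁ ~ k₂) where

    private
      A₁ A₂ W : V → Set
      A₁ v = v ≢ k₂ × v ~ k₁
      A₂ v = v ≢ k₁ × v ~ k₂
      W  v = v ≁ k₁ × v ≁ k₂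

      A₁≁k₂ : ∀ {v} → v ~ k₁ → v ≁ k₂
      A₁≁k₂ vk₁ = ¬~⇒≁ λ vk₂ → no-△ vk₁ k₁k₂ vk₂

      A₂≁k₁ : ∀ {v} → v ~ k₂ → v ≁ k₁
      A₂≁k₁ vk₂ = ¬~⇒≁ λ vk₁ → no-△ vk₁ k₁k₂ vk₂

      -- The colouring extends that of the edge `k₁ k₂`: a vertex of `W` goes opposite to `A₁` or
      -- `A₂` if it sees a vertex there, and opposite to its partner in `W` if that partner is
      -- attached to `A₂`.
      Nbr₁ Link Side : V → Set
      Nbr₁ v = ∃ λ a → A₁ a × v ~ a
      Link v = ∃ λ w → W w × v ~ w × ∃ λ a → A₂ a × w ~ a
      Side v = v ~ k₂ ⊎ (v ≁ k₁ × (Nbr₁ v ⊎ Link v))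

      A₁? : Decidable A₁
      A₁? v = ¬? (v ≟ k₂) ×-dec (v ~? k₁)
      A₂? : Decidable A₂
      A₂? v = ¬? (v ≟ k₁) ×-dec (v ~? k₂)

      Side? : Decidable Side
      Side? v = (v ~? k₂) ⊎-dec ((v ≁? k₁) ×-dec
        ((Finₚ.any? λ a → A₁? a ×-dec (v ~? a)) ⊎-dec
         (Finₚ.any? λ w → ((w ≁? k₁) ×-dec (w ≁? k₂)) ×-dec (v ~? w) ×-dec Finₚ.any? λ a → A₂? a ×-dec (w ~? a))))

      side : V → Bool
      side v = ⌊ Side? v ⌋

      W-closed : P₃-closed W
      W-closed = anticomplete⇒P₃-closed k₁k₂ λ (p , q) → ≁-sym p , ≁-sym q

      -- A P₃-closed set in a triangle-free graph induces only isolated vertices and edges.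
      W-no-P₃ : ∀ {a b c} → W a → W b → W c → a ~ b → b ~ c → a ≡ c
      W-no-P₃ {a} {c = c} Wa Wb Wc ab bc with a ≟ c
      ... | yes e = e
      ... | no a≢c = ⊥-elim (no-△ ab bc (W-closed Wa Wb Wc ab bc a≢c))

      -- Otherwise `w a₁ k₁ k₂ a₂` is an induced C₅.
      one-kind : ∀ {w a₁ a₂} → W w → A₁ a₁ → A₂ a₂ → w ~ a₁ → w ~ a₂ → ⊥
      one-kind (wk₁ , wk₂) (_ , a₁k₁) (_ , a₂k₂) wa₁ wa₂ = no-C₅ wa₁ a₁k₁ k₁k₂ (~-sym a₂k₂) (~-sym wa₂)
        wk₁ wk₂ (A₁≁k₂ a₁k₁) (¬~⇒≁ λ e → no-△ wa₁ e wa₂) (≁-sym (A₂≁k₁ a₂k₂))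

      -- Otherwise `k a w w′ a′` is an induced C₅.
      W-edge : ∀ {k w w′ a a′} → w ≁ k → w′ ≁ k → a ~ k → a′ ~ k → w ~ w′ → w ~ a → w′ ~ a′ → ⊥
      W-edge wk w′k ak a′k ww′ wa w′a′ = no-C₅ (~-sym ak) (~-sym wa) ww′ w′a′ a′k
        (≁-sym wk) (≁-sym w′k) (¬~⇒≁ λ e → no-△ wa e ww′) (¬~⇒≁ λ e → no-△ ak (~-sym a′k) e)
        (¬~⇒≁ λ e → no-△ ww′ w′a′ e)

      data Kind (v : V) : Bool → Set where
        a₁ : A₁ v → Kind v false
        a₂ : A₂ v → Kind v true
        b₁ : W v → ¬ Nbr₁ v → ¬ Link v → Kind v false
        b₂ : W v → Nbr₁ v → Kind v true
        b₃ : W v → Link v → Kind v true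

      classify : ∀ {v} → v ≢ k₁ → v ≢ k₂ → Kind v (side v)
      classify {v} v≢k₁ v≢k₂ with Side? v
      ... | yes (inj₁ p) = a₂ (v≢k₁ , p)
      ... | yes (inj₂ (p , nb)) with adjacent? v k₂
      ...   | inj₁ q = a₂ (v≢k₁ , q)
      ...   | inj₂ q = [ b₂ (p , q) , b₃ (p , q) ] nb
      classify {v} v≢k₁ v≢k₂ | no ¬s with adjacent? v k₁
      ... | inj₁ p = a₁ (v≢k₂ , p)
      ... | inj₂ p = b₁ (p , ¬~⇒≁ (¬s ∘ inj₁)) (λ nb → ¬s (inj₂ (p , inj₁ nb))) (λ l → ¬s (inj₂ (p , inj₂ l)))

      -- An edge inside W sees some neighbour of k₁ or k₂, so both of its ends cannot be of kind b₁.
      b₁-indep : ∀ {x u w} → A₁ x ⊎ A₂ x → W u → ¬ Nbr₁ u → ¬ Link u → W w → ¬ Nbr₁ w → ¬ Link w → u ≁ w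
      b₁-indep {x} {u} {w} X Wu nu lu Ww nw lw = ¬~⇒≁ (absurd X)
        where
        absurd : A₁ x ⊎ A₂ x → u ~ w → ⊥
        absurd (inj₁ A@(x≢ , xk₁)) uw = P₂+P₃-free uw (~-sym k₁k₂) (~-sym xk₁) (≢-sym x≢) (≁-sym (A₁≁k₂ xk₁))
          (proj₂ Wu) (proj₁ Wu) (¬~⇒≁ λ e → nu (x , A , e)) (proj₂ Ww) (proj₁ Ww) (¬~⇒≁ λ e → nw (x , A , e))
        absurd (inj₂ A@(x≢ , xk₂)) uw = P₂+P₃-free uw k₁k₂ (~-sym xk₂) (≢-sym x≢) (≁-sym (A₂≁k₁ xk₂))
          (proj₁ Wu) (proj₂ Wu) (¬~⇒≁ λ e → lw (u , Wu , ~-sym uw , x , A , e))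
          (proj₁ Ww) (proj₂ Ww) (¬~⇒≁ λ e → lu (w , Ww , uw , x , A , e))

      a₂-link : ∀ {u w} → A₂ u → W w → Link w → w ~ u → ⊥
      a₂-link U Ww (w′ , W′ , ww′ , a , A , w′a) wu = W-edge (proj₂ Ww) (proj₂ W′) (proj₂ U) (proj₂ A) ww′ wu w′a

      nbr₁-link : ∀ {u w} → W u → Nbr₁ u → W w → Link w → u ~ w → ⊥
      nbr₁-link Wu (a , A , ua) Ww (w′ , W′ , ww′ , a′ , A′ , w′a′) uw with W-no-P₃ Wu Ww W′ uw ww′
      ... | refl = one-kind Wu A A′ ua w′a′

      link-link : ∀ {u w} → W u → Link u → W w → Link w → u ~ w → ⊥
      link-link Wu (u′ , U′ , uu′ , a , A , u′a) Ww (w′ , W′ , ww′ , a′ , A′ , w′a′) uw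
        with W-no-P₃ Ww Wu U′ (~-sym uw) uu′ | W-no-P₃ Wu Ww W′ uw ww′
      ... | refl | refl = W-edge (proj₂ Wu) (proj₂ Ww) (proj₂ A′) (proj₂ A) uw w′a′ u′a

      indep : ∀ {x u w b} → A₁ x ⊎ A₂ x → Kind u b → Kind w b → u ≁ w
      indep X (a₁ U) (a₁ W) = ¬~⇒≁ λ e → no-△ e (proj₂ W) (proj₂ U)
      indep X (a₂ U) (a₂ W) = ¬~⇒≁ λ e → no-△ e (proj₂ W) (proj₂ U)
      indep X (a₁ U) (b₁ _ nw _) = ¬~⇒≁ λ e → nw (_ , U , ~-sym e)
      indep X (b₁ _ nu _) (a₁ W) = ¬~⇒≁ λ e → nu (_ , W , e)
      indep X (b₁ U nu lu) (b₁ W nw lw) = b₁-indep X U nu lu W nw lw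
      indep X (a₂ U) (b₂ W (a , A , wa)) = ¬~⇒≁ λ e → one-kind W A U wa (~-sym e)
      indep X (b₂ U (a , A , ua)) (a₂ W) = ¬~⇒≁ λ e → one-kind U A W ua e
      indep X (a₂ U) (b₃ W l) = ¬~⇒≁ λ e → a₂-link U W l (~-sym e)
      indep X (b₃ U l) (a₂ W) = ¬~⇒≁ λ e → a₂-link W U l e
      indep X (b₂ U (a , A , ua)) (b₂ W (a′ , A′ , wa′)) = ¬~⇒≁ λ e →
        W-edge (proj₁ U) (proj₁ W) (proj₂ A) (proj₂ A′) e ua wa′
      indep X (b₂ U nb) (b₃ W l) = ¬~⇒≁ λ e → nbr₁-link U nb W l e
      indep X (b₃ U l) (b₂ W nb) = ¬~⇒≁ λ e → nbr₁-link W nb U l (~-sym e)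
      indep X (b₃ U l) (b₃ W l′) = ¬~⇒≁ λ e → link-link U l W l′ e

    triangle-free-case : Decomposable G 3 1
    triangle-free-case = delete (k₁ ∷ k₂ ∷ []) ℕₚ.≤-refl (side ∷ []) ℕₚ.≤-refl good
      where
      good : ∀ {S : V → Set} → Decidable S → ∃ S → (∀ {v} → S v → v ∉ k₁ ∷ k₂ ∷ []) → Good G 1 (side ∷ []) S
      good {S} S? ne S∌ with Finₚ.any? (λ x → A₁? x ⊎-dec A₂? x)
      ... | yes (x , X) = bipartite⇒good S? side (here refl) (λ {u} {w} su sw eq →
              indep X (classify (S∌ su ∘ here) (S∌ su ∘ there ∘ here))
                (subst (Kind w) (sym eq) (classify (S∌ sw ∘ here) (S∌ sw ∘ there ∘ here)))) ne
      -- The edge `k₁ k₂` is anticomplete to everything that is left.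
      ... | no none = P₃-closed⇒good S? ne λ sa sb sc → W-closed (in-W sa) (in-W sb) (in-W sc)
        where
        in-W : ∀ {v} → S v → W v
        in-W {v} sv = ¬~⇒≁ (λ e → none (v , inj₁ (S∌ sv ∘ there ∘ here , e))) ,
                      ¬~⇒≁ (λ e → none (v , inj₂ (S∌ sv ∘ here , e)))

-- The case distinction and the final bound

any-vec? : ∀ {n} m {P : Vec (Fin n) m → Set} → Decidable P → Dec (∃ P)
any-vec? zero P? with P? []
... | yes p = yes ([] , p)
... | no ¬p = no λ { ([] , p) → ¬p p }
any-vec? (suc m) P? with Finₚ.any? (λ x → any-vec? m (λ xs → P? (x ∷ xs)))
... | yes (x , xs , p) = yes (x ∷ xs , p)
... | no ¬p = no λ { (x ∷ xs , p) → ¬p (x , xs , p) }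

weaken : ∀ (G : Graph) {m m′ s s′} → m ≤ m′ → s ≤ s′ → Decomposable G m s → Decomposable G m′ s′
weaken G m≤ s≤ (T , T≤ , good) = T , ℕₚ.≤-trans T≤ m≤ , λ S? ne → go (good S? ne)
  where
  go : ∀ {S} → Good G _ T S → Good G _ T S
  go (inj₁ (p , inj)) = inj₁ ((λ v → inject≤ (p v) s≤) , λ a b eq → inj a b (Finₚ.inject≤-injective s≤ s≤ _ _ eq))
  go (inj₂ h) = inj₂ h

-- The bounds are abstract because 2 ^ test-bound occurs in the type of the theorem and must not be evaluated.
abstract

  test-bound size-bound : ℕ
  test-bound = 2 ^ 22
  size-bound = 2 ^ 9

  bounded : ∀ (G : Graph) {m s} → Bool.T (m ℕ.≤ᵇ 2 ^ 22) → Bool.T (s ℕ.≤ᵇ 2 ^ 9) → Decomposable G m s → Decomposable G test-bound size-bound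
  bounded G {m} {s} p q = weaken G (ℕₚ.≤ᵇ⇒≤ m _ p) (ℕₚ.≤ᵇ⇒≤ s _ q)

module Main (G : Graph) (no-diamond : Free diamond G) (no-P₂+P₃ : Free P₂+P₃ G) where

  open Forbidden G no-diamond no-P₂+P₃
  open Decomposition G
  open Cliques G
  open LargeClique G no-diamond no-P₂+P₃
  open DenseCases G no-diamond no-P₂+P₃
  open SparseCases G no-diamond no-P₂+P₃
  open TriangleFreeCase G no-diamond no-P₂+P₃

  clique? : ∀ m → Dec (∃ λ (xs : Vec V m) → AllPairs _~_ xs)
  clique? m = any-vec? m (allPairs? _~?_)

  clique-lookup : ∀ {m} {xs : Vec V m} → AllPairs _~_ xs → ∀ {i j} → i ≢ j → lookup xs i ~ lookup xs j
  clique-lookup (ps ∷ c) {zero} {zero} i≢j = ⊥-elim (i≢j refl)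
  clique-lookup {xs = _ ∷ xs} (ps ∷ c) {zero} {suc j} i≢j = VecAll.lookup ps (∈-lookup j xs)
  clique-lookup {xs = _ ∷ xs} (ps ∷ c) {suc i} {zero} i≢j = ~-sym (VecAll.lookup ps (∈-lookup i xs))
  clique-lookup (ps ∷ c) {suc i} {suc j} i≢j = clique-lookup c (i≢j ∘ cong suc)

  InducedC₅ : Vec V 5 → Set
  InducedC₅ c = ∀ i j → adj G (lookup c i) (lookup c j) ≡ C₅ i j

  InducedC₅? : Decidable InducedC₅
  InducedC₅? c = Finₚ.all? λ i → Finₚ.all? λ j → adj G (lookup c i) (lookup c j) Boolₚ.≟ C₅ i j

  no-C₅ : ¬ ∃ InducedC₅ → C₅-free
  no-C₅ none {a} {b} {c} {d} {e} ab bc cd de ea ac ad bd be ce = none (a ∷ b ∷ c ∷ d ∷ e ∷ [] , h)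
    where
    ae : a ~ e
    ae = ~-sym ea
    h : InducedC₅ (a ∷ b ∷ c ∷ d ∷ e ∷ [])
    h zero zero = ≁-refl
    h zero (suc zero) = ab
    h zero (suc (suc zero)) = ac
    h zero (suc (suc (suc zero))) = ad
    h zero (suc (suc (suc (suc zero)))) = ae
    h (suc zero) zero = ~-sym ab
    h (suc zero) (suc zero) = ≁-refl
    h (suc zero) (suc (suc zero)) = bc
    h (suc zero) (suc (suc (suc zero))) = bd
    h (suc zero) (suc (suc (suc (suc zero)))) = be
    h (suc (suc zero)) zero = ≁-sym ac
    h (suc (suc zero)) (suc zero) = ~-sym bc
    h (suc (suc zero)) (suc (suc zero)) = ≁-refl
    h (suc (suc zero)) (suc (suc (suc zero))) = cd
    h (suc (suc zero)) (suc (suc (suc (suc zero)))) = ce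
    h (suc (suc (suc zero))) zero = ≁-sym ad
    h (suc (suc (suc zero))) (suc zero) = ≁-sym bd
    h (suc (suc (suc zero))) (suc (suc zero)) = ~-sym cd
    h (suc (suc (suc zero))) (suc (suc (suc zero))) = ≁-refl
    h (suc (suc (suc zero))) (suc (suc (suc (suc zero)))) = de
    h (suc (suc (suc (suc zero)))) zero = ~-sym ae
    h (suc (suc (suc (suc zero)))) (suc zero) = ≁-sym be
    h (suc (suc (suc (suc zero)))) (suc (suc zero)) = ≁-sym ce
    h (suc (suc (suc (suc zero)))) (suc (suc (suc zero))) = ~-sym de
    h (suc (suc (suc (suc zero)))) (suc (suc (suc (suc zero)))) = ≁-refl

  triangle-case : K₄-free → C₅-free → (k : Fin 3 → V) → (∀ {i j} → i ≢ j → k i ~ k j) →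
                  Decomposable G test-bound size-bound
  triangle-case no-K₄ no-C₅ k k-clique = by-cases
    where
    open Triangle no-K₄ k k-clique
    open DecMembership (_≟_ {n G}) using (_∈?_)
    tripod? : ∀ i → Dec (∃ λ a → a ∉ D × a ~ k i)
    tripod? i = Finₚ.any? λ a → ¬? (a ∈? D) ×-dec (a ~? k i)
    no-tripod : (∀ b b′ → b ~ b′ → (∀ i → b ≁ k i) → (∀ i → b′ ≁ k i) → ⊥) →
                ∀ i → ¬ (∃ λ a → a ∉ D × a ~ k i) → Decomposable G test-bound size-bound
    no-tripod no-far i none with others i
    -- The triangle vertex without a private neighbour takes the role of `k₃`.
    ... | j , l , j≢l , j≢i , l≢i , all = bounded G tt tt (NoTripod.no-tripod-case no-K₄ (K₄-free⇒K₅-free no-K₄) no-C₅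
            (k j) (k l) (k i) (k-clique j≢l) (k-clique j≢i) (k-clique l≢i)
            (λ p q r → ¬~⇒≁ λ vk → none (_ , outside p q r , vk))
            (λ a b c d e f → ¬~⇒≁ λ uw → no-far _ _ uw (each a b c) (each d e f)))
      where
      outside : ∀ {v} → v ≢ k j → v ≢ k l → v ≢ k i → v ∉ D
      outside p q r v∈ with ∈-tabulate⁻ {f = k} v∈
      ... | t , refl with all t
      ...   | inj₁ refl        = p refl
      ...   | inj₂ (inj₁ refl) = q refl
      ...   | inj₂ (inj₂ refl) = r refl
      each : ∀ {v} → v ≁ k j → v ≁ k l → v ≁ k i → ∀ t → v ≁ k t
      each p q r t with all t
      ... | inj₁ refl        = p
      ... | inj₂ (inj₁ refl) = q
      ... | inj₂ (inj₂ refl) = r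
    by-cases : Decomposable G test-bound size-bound
    by-cases with Finₚ.any? (λ b → Finₚ.any? λ b′ →
                    (b ~? b′) ×-dec (Finₚ.all? λ i → b ≁? k i) ×-dec (Finₚ.all? λ i → b′ ≁? k i))
    ... | yes (b , b′ , bb′ , p , q) = bounded G tt tt (far-edge-case bb′ p q)
    ... | no none with Finₚ.all? tripod?
    ...   | yes f = bounded G tt tt (net-case (proj₁ ∘ f) (proj₁ ∘ proj₂ ∘ f) (proj₂ ∘ proj₂ ∘ f))
    ...   | no ¬f = let (i , ¬a) = Finₚ.¬∀⟶∃¬ 3 _ tripod? ¬f in
              no-tripod (λ b b′ e p q → none (b , b′ , e , p , q)) i ¬a

  decomposable : Decomposable G test-bound size-bound
  decomposable with clique? 5
  ... | yes (k , c) = bounded G tt tt (large-clique (lookup k) (clique-lookup c))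
  ... | no ¬K₅ with clique? 4
  ...   | yes (k , c) = bounded G tt tt (K₄-case no-K₅ (lookup k) (clique-lookup c))
    where
    no-K₅ : K₅-free
    no-K₅ ab ac ad ae bc bd be cd ce de = ¬K₅ (_ ∷ _ ∷ _ ∷ _ ∷ _ ∷ [] ,
      (ab ∷ ac ∷ ad ∷ ae ∷ []) ∷ (bc ∷ bd ∷ be ∷ []) ∷ (cd ∷ ce ∷ []) ∷ (de ∷ []) ∷ [] ∷ [])
  ...   | no ¬K₄ with any-vec? 5 InducedC₅?
  ...     | yes (c , h) = bounded G tt tt (C₅-case no-K₄ (lookup c) h)
    where
    no-K₄ : K₄-free
    no-K₄ ab ac ad bc bd cd = ¬K₄ (_ ∷ _ ∷ _ ∷ _ ∷ [] ,
      (ab ∷ ac ∷ ad ∷ []) ∷ (bc ∷ bd ∷ []) ∷ (cd ∷ []) ∷ [] ∷ [])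
  ...     | no ¬C₅ with clique? 3
  ...       | yes (k , c) = triangle-case no-K₄ (no-C₅ ¬C₅) (lookup k) (clique-lookup c)
    where
    no-K₄ : K₄-free
    no-K₄ ab ac ad bc bd cd = ¬K₄ (_ ∷ _ ∷ _ ∷ _ ∷ [] ,
      (ab ∷ ac ∷ ad ∷ []) ∷ (bc ∷ bd ∷ []) ∷ (cd ∷ []) ∷ [] ∷ [])
  ...       | no ¬△ with Finₚ.any? (λ u → Finₚ.any? λ v → u ~? v)
  ...         | yes (u , v , uv) = bounded G tt tt (triangle-free-case
                  (λ ab bc ac → ¬△ (_ ∷ _ ∷ _ ∷ [] , (ab ∷ ac ∷ []) ∷ (bc ∷ []) ∷ [] ∷ [])) (no-C₅ ¬C₅) u v uv)
  ...         | no none = bounded G tt tt (delete {d = 0} {m = 0} {s = 0} [] z≤n [] z≤n λ S? ne _ →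
                  P₃-closed⇒good S? ne λ _ _ _ ab _ _ → ⊥-elim (none (_ , _ , ab)))

theorem1 : Σ ℕ λ c → (G : Graph) → 0 < n G → Free diamond G → Free P₂+P₃ G → CwAtMost c G
theorem1 = (2 ^ test-bound + size-bound) + (2 ^ test-bound + size-bound) , λ G 0<n no-diamond no-P₂+P₃ →
  decomposable⇒cw G 0<n (Main.decomposable G no-diamond no-P₂+P₃)
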